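{- Let $k\ge 0$ and $\delta\ge k+2$ be integers, and let $n$ be sufficiently large (i.e. $n\ge n_0(k,\delta)$ for some $n_0$ depending only on $k$ and $\delta$). If $G$ is an $n$-vertex graph with minimum degree $\delta(G)\ge\delta$ and $$q(G)\ge 2(n-\delta+k-1),$$ then $G$ is $k$-edge-Hamiltonian unless $G\in\mathcal{H}_{n,k,\delta}^{(1)}$ or $G\in\mathcal{L}_{n,k,\delta}^{(1)}$.
   Context: All graphs are finite and simple, considered up to isomorphism. $q(G)$ is the signless Laplacian spectral radius, i.e. the largest eigenvalue of $Q(G)=D(G)+A(G)$, where $A(G)$ is the adjacency matrix and $D(G)$ the diagonal matrix of vertex degrees. $K_s$ is the complete graph on $s$ vertices, $I_t$ is the edgeless graph on $t$ vertices, $G\cup H$ is the disjoint union, and $G\vee H$ is the join (obtained from $G\cup H$ by adding all edges between $G$ and $H$). A Hamilton cycle is a cycle through all vertices. A graph $G$ is $k$-edge-Hamiltonian if any collection of vertex-disjoint paths in $G$ with at most $k$ edges altogether is contained in a Hamilton cycle of $G$. Define $H_{n,k,\delta}:=K_\delta\vee(K_{n-2\delta+k}\cup I_{\delta-k})$. In it, let $X$ be the set of $\delta-k$ vertices (of degree $\delta$) of $I_{\delta-k}$, $Y$ the set of $\delta$ vertices (of degree $n-1$) of $K_\delta$, and $Z$ the set of the remaining $n-2\delta+k$ vertices (of degree $n-\delta+k-1$). Let $E_1(H_{n,k,\delta})$ be the set of edges with both endpoints in $Y\cup Z$, and $$\mathcal{H}_{n,k,\delta}^{(1)}=\{H_{n,k,\delta}\setminus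 E' : E'\subseteq E_1(H_{n,k,\delta}),\ |E'|\le\lfloor\delta(\delta-k)/4\rfloor\},$$ where $G\setminus E'$ means deleting the edges of $E'$. Define $L_{n,k,\delta}:=K_{k+1}\vee(K_{n-\delta-1}\cup K_{\delta-k})$. In it, let $X$ be the set of vertices (of degree $\delta$) of $K_{\delta-k}$, $Y$ the set of vertices (of degree $n-1$) of $K_{k+1}$, and $Z$ the set of the remaining $n-\delta-1$ vertices (of degree $n-\delta+k-1$). Let $E_1(L_{n,k,\delta})$ be the set of edges with both endpoints in $Y\cup Z$, and $$\mathcal{L}_{n,k,\delta}^{(1)}=\{L_{n,k,\delta}\setminus E' : E'\subseteq E_1(L_{n,k,\delta}),\ |E'|\le\lfloor(k+1)(\delta-k)/4\rfloor\}.$$ -}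

module Defs where

open import Algebra.Bundles.Raw using (RawMonoid)
open import Algebra.Bundles using (module CommutativeMonoid)
import Algebra.Properties.CommutativeSemigroup as CommutativeSemigroupProperties
import Algebra.Definitions.RawMonoid as RawMonoidDefs
open import Data.Bool.Base using (if_then_else_)
open import Data.Empty using (⊥)
open import Data.Fin.Base using (Fin)
import Data.Fin.Properties as Fin
open import Data.Fin.Subset using (Subset; ∣_∣)
open import Data.Integer.Base using (ℤ; +_)
open import Data.List.Base using (List; length; map; zip; drop; _∷ʳ_)
open import Data.List.NonEmpty.Base as List⁺ using (List⁺; toList; head; tail)
open import Data.List.Membership.Propositional using (_∈_)
import Data.List.Membership.DecPropositional as DecMembership
open import Data.List.Relation.Binary.Disjoint.Propositional using (Disjoint)
open import Data.List.Relation.Unary.All using (All)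
open import Data.List.Relation.Unary.AllPairs using (AllPairs)
open import Data.List.Relation.Unary.Linked using (Linked)
open import Data.List.Relation.Unary.Unique.Propositional using (Unique)
open import Data.Nat.ListAction using (sum)
open import Data.Nat.Base as ℕ using (ℕ; _∸_; _⊔_)
import Data.Nat.DivMod as ℕ
import Data.Nat.Properties as ℕ
open import Data.Product.Base using (Σ; ∃; _×_; _,_; proj₁; proj₂)
import Data.Product.Properties as Product
open import Data.Rational.Base as ℚ using (ℚ; 0ℚ; 1ℚ; Positive; 1/_)
  renaming (∣_∣ to ∣_∣ℚ)
import Data.Rational.Properties as ℚ
open import Data.Sum.Base using (_⊎_; inj₁; inj₂; swap)
import Data.Sum.Properties as Sum
open import Data.Unit.Base using (⊤; tt)
import Data.Vec.Base as Vec
open import Function.Base using (_on_; _∘_)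
open import Function.Bundles using (_↔_; _⇔_; module Inverse)
open import Level using (0ℓ)
open import Relation.Binary.Core using (Rel)
open import Relation.Binary.Definitions using (Decidable; DecidableEquality; Symmetric)
open import Relation.Binary.PropositionalEquality
  using (_≡_; _≢_; refl; sym; trans; cong; cong₂; subst; module ≡-Reasoning)
open import Relation.Nullary using (¬_; yes; no; does)
open import Relation.Nullary.Decidable using (¬?; _×-dec_; _⊎-dec_)

-- Cauchy sequences of rationals; equality of reals is _≈ᴿ_, not _≡_.

record ℝ : Set where
  constructor mkℝ
  field
    seq    : ℕ → ℚ
    cauchy : ∀ ε → .{{Positive ε}} →
             ∃ λ N → ∀ m n → N ℕ.≤ m → N ℕ.≤ n → ∣ seq m ℚ.- seq n ∣ℚ ℚ.≤ ε

open ℝ public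

Eventually : (ℕ → Set) → Set
Eventually P = ∃ λ N → ∀ n → N ℕ.≤ n → P n

infix 4 _≈ᴿ_ _≤ᴿ_

_≈ᴿ_ : ℝ → ℝ → Set
x ≈ᴿ y = ∀ ε → .{{Positive ε}} → Eventually λ n → ∣ seq x n ℚ.- seq y n ∣ℚ ℚ.≤ ε

_≤ᴿ_ : ℝ → ℝ → Set
x ≤ᴿ y = ∀ ε → .{{Positive ε}} → Eventually λ n → seq x n ℚ.≤ seq y n ℚ.+ ε

fromℚ : ℚ → ℝ
fromℚ p = mkℝ (λ _ → p) λ ε → 0 , λ _ _ _ _ →
  subst (ℚ._≤ ε) (sym (cong ∣_∣ℚ (ℚ.+-inverseʳ p))) (ℚ.nonNegative⁻¹ ε {{ℚ.pos⇒nonNeg ε}})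

fromℤ : ℤ → ℝ
fromℤ i = fromℚ (i ℚ./ 1)

fromℕ : ℕ → ℝ
fromℕ n = fromℤ (+ n)

private
  ½-sum : ∀ ε → ε ℚ.* ℚ.½ ℚ.+ ε ℚ.* ℚ.½ ≡ ε
  ½-sum ε = trans (sym (ℚ.*-distribˡ-+ ε ℚ.½ ℚ.½)) (ℚ.*-identityʳ ε)

  open CommutativeSemigroupProperties
    (CommutativeMonoid.commutativeSemigroup ℚ.+-0-commutativeMonoid) using (interchange)

  +-cancel : ∀ a b → a ≡ (a ℚ.- b) ℚ.+ b
  +-cancel a b = sym (begin
    (a ℚ.- b) ℚ.+ b      ≡⟨ ℚ.+-assoc a (ℚ.- b) b ⟩
    a ℚ.+ (ℚ.- b ℚ.+ b)  ≡⟨ cong (a ℚ.+_) (ℚ.+-inverseˡ b) ⟩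
    a ℚ.+ 0ℚ             ≡⟨ ℚ.+-identityʳ a ⟩
    a                    ∎)
    where open ≡-Reasoning

  +-rearrange : ∀ a b c d →
    (a ℚ.+ b) ℚ.- (c ℚ.+ d) ≡ (a ℚ.- c) ℚ.+ (b ℚ.- d)
  +-rearrange a b c d = trans
    (cong ((a ℚ.+ b) ℚ.+_) (ℚ.neg-distrib-+ c d))
    (interchange a b (ℚ.- c) (ℚ.- d))

  *-distribˡ-- : ∀ a b c → a ℚ.* (b ℚ.- c) ≡ a ℚ.* b ℚ.- a ℚ.* c
  *-distribˡ-- a b c = trans (ℚ.*-distribˡ-+ a b (ℚ.- c))
    (cong (a ℚ.* b ℚ.+_) (sym (ℚ.neg-distribʳ-* a c)))

  telescope : ∀ a b c → (a ℚ.- b) ℚ.+ (b ℚ.- c) ≡ a ℚ.- c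
  telescope a b c = trans (sym (ℚ.+-assoc (a ℚ.- b) b (ℚ.- c)))
    (cong (ℚ._- c) (sym (+-cancel a b)))

  *-rearrange : ∀ a b c d →
    (a ℚ.* b) ℚ.- (c ℚ.* d) ≡ a ℚ.* (b ℚ.- d) ℚ.+ d ℚ.* (a ℚ.- c)
  *-rearrange a b c d = sym (begin
    a ℚ.* (b ℚ.- d) ℚ.+ d ℚ.* (a ℚ.- c)
      ≡⟨ cong₂ ℚ._+_ (*-distribˡ-- a b d) (*-distribˡ-- d a c) ⟩
    (a ℚ.* b ℚ.- a ℚ.* d) ℚ.+ (d ℚ.* a ℚ.- d ℚ.* c)
      ≡⟨ cong ((a ℚ.* b ℚ.- a ℚ.* d) ℚ.+_) (cong₂ ℚ._-_ (ℚ.*-comm d a) (ℚ.*-comm d c)) ⟩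
    (a ℚ.* b ℚ.- a ℚ.* d) ℚ.+ (a ℚ.* d ℚ.- c ℚ.* d)
      ≡⟨ telescope (a ℚ.* b) (a ℚ.* d) (c ℚ.* d) ⟩
    a ℚ.* b ℚ.- c ℚ.* d ∎)
    where open ≡-Reasoning

  eventuallyBounded : ∀ x → ∃ λ B → Positive B × Eventually λ n → ∣ seq x n ∣ℚ ℚ.≤ B
  eventuallyBounded x with cauchy x 1ℚ
  ... | N , close = 1ℚ ℚ.+ ∣ seq x N ∣ℚ
                  , ℚ.pos+nonNeg⇒pos 1ℚ ∣ seq x N ∣ℚ {{ℚ.∣-∣-nonNeg (seq x N)}}
                  , N , λ n N≤n → begin
    ∣ seq x n ∣ℚ                                ≡⟨ cong ∣_∣ℚ (+-cancel (seq x n) (seq x N)) ⟩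
    ∣ (seq x n ℚ.- seq x N) ℚ.+ seq x N ∣ℚ      ≤⟨ ℚ.∣p+q∣≤∣p∣+∣q∣ (seq x n ℚ.- seq x N) (seq x N) ⟩
    ∣ seq x n ℚ.- seq x N ∣ℚ ℚ.+ ∣ seq x N ∣ℚ   ≤⟨ ℚ.+-monoˡ-≤ ∣ seq x N ∣ℚ (close n N N≤n ℕ.≤-refl) ⟩
    1ℚ ℚ.+ ∣ seq x N ∣ℚ                         ∎
    where open ℚ.≤-Reasoning

  ∣*∣-mono : ∀ {p q B e} → ∣ p ∣ℚ ℚ.≤ B → ∣ q ∣ℚ ℚ.≤ e → .{{Positive B}} →
             ∣ p ℚ.* q ∣ℚ ℚ.≤ B ℚ.* e
  ∣*∣-mono {p} {q} {B} {e} p≤B q≤e = begin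
    ∣ p ℚ.* q ∣ℚ       ≡⟨ ℚ.∣p*q∣≡∣p∣*∣q∣ p q ⟩
    ∣ p ∣ℚ ℚ.* ∣ q ∣ℚ  ≤⟨ ℚ.*-monoʳ-≤-nonNeg ∣ q ∣ℚ {{ℚ.∣-∣-nonNeg q}} p≤B ⟩
    B ℚ.* ∣ q ∣ℚ       ≤⟨ ℚ.*-monoˡ-≤-nonNeg B {{ℚ.pos⇒nonNeg B}} q≤e ⟩
    B ℚ.* e            ∎
    where open ℚ.≤-Reasoning

  sum-cauchy : (x y : ℝ) → ∀ ε → .{{Positive ε}} →
    ∃ λ N → ∀ m n → N ℕ.≤ m → N ℕ.≤ n →
      ∣ (seq x m ℚ.+ seq y m) ℚ.- (seq x n ℚ.+ seq y n) ∣ℚ ℚ.≤ ε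
  sum-cauchy x y ε = M ⊔ N , λ m n m≥ n≥ → begin
    ∣ (seq x m ℚ.+ seq y m) ℚ.- (seq x n ℚ.+ seq y n) ∣ℚ
      ≡⟨ cong ∣_∣ℚ (+-rearrange (seq x m) (seq y m) (seq x n) (seq y n)) ⟩
    ∣ (seq x m ℚ.- seq x n) ℚ.+ (seq y m ℚ.- seq y n) ∣ℚ
      ≤⟨ ℚ.∣p+q∣≤∣p∣+∣q∣ (seq x m ℚ.- seq x n) (seq y m ℚ.- seq y n) ⟩
    ∣ seq x m ℚ.- seq x n ∣ℚ ℚ.+ ∣ seq y m ℚ.- seq y n ∣ℚ
      ≤⟨ ℚ.+-mono-≤
           (proj₂ cx m n (ℕ.m⊔n≤o⇒m≤o M N m≥) (ℕ.m⊔n≤o⇒m≤o M N n≥))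
           (proj₂ cy m n (ℕ.m⊔n≤o⇒n≤o M N m≥) (ℕ.m⊔n≤o⇒n≤o M N n≥)) ⟩
    ε ℚ.* ℚ.½ ℚ.+ ε ℚ.* ℚ.½
      ≡⟨ ½-sum ε ⟩
    ε ∎
    where
    open ℚ.≤-Reasoning
    cx = cauchy x (ε ℚ.* ℚ.½) {{ℚ.pos*pos⇒pos ε ℚ.½}}
    cy = cauchy y (ε ℚ.* ℚ.½) {{ℚ.pos*pos⇒pos ε ℚ.½}}
    M = proj₁ cx
    N = proj₁ cy

  product-cauchy : (x y : ℝ) → ∀ ε → .{{Positive ε}} →
    ∃ λ N → ∀ m n → N ℕ.≤ m → N ℕ.≤ n →
      ∣ (seq x m ℚ.* seq y m) ℚ.- (seq x n ℚ.* seq y n) ∣ℚ ℚ.≤ ε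
  product-cauchy x y ε with eventuallyBounded x | eventuallyBounded y
  ... | B , B>0 , K , x≤B | C , C>0 , L , y≤C = T , λ m n m≥ n≥ → begin
    ∣ (seq x m ℚ.* seq y m) ℚ.- (seq x n ℚ.* seq y n) ∣ℚ
      ≡⟨ cong ∣_∣ℚ (*-rearrange (seq x m) (seq y m) (seq x n) (seq y n)) ⟩
    ∣ seq x m ℚ.* (seq y m ℚ.- seq y n) ℚ.+ seq y n ℚ.* (seq x m ℚ.- seq x n) ∣ℚ
      ≤⟨ ℚ.∣p+q∣≤∣p∣+∣q∣ (seq x m ℚ.* (seq y m ℚ.- seq y n)) (seq y n ℚ.* (seq x m ℚ.- seq x n)) ⟩
    ∣ seq x m ℚ.* (seq y m ℚ.- seq y n) ∣ℚ ℚ.+ ∣ seq y n ℚ.* (seq x m ℚ.- seq x n) ∣ℚ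
      ≤⟨ ℚ.+-mono-≤
           (∣*∣-mono {seq x m} {seq y m ℚ.- seq y n}
             (x≤B m (K≤ m≥)) (proj₂ cy m n (N≤ m≥) (N≤ n≥)) {{B>0}})
           (∣*∣-mono {seq y n} {seq x m ℚ.- seq x n}
             (y≤C n (L≤ n≥)) (proj₂ cx m n (M≤ m≥) (M≤ n≥)) {{C>0}}) ⟩
    B ℚ.* ε′ ℚ.+ C ℚ.* ε′
      ≡⟨ sym (ℚ.*-distribʳ-+ ε′ B C) ⟩
    (B ℚ.+ C) ℚ.* (D⁻¹ ℚ.* ε)
      ≡⟨ sym (ℚ.*-assoc (B ℚ.+ C) D⁻¹ ε) ⟩
    ((B ℚ.+ C) ℚ.* D⁻¹) ℚ.* ε
      ≡⟨ cong (ℚ._* ε) (ℚ.*-inverseʳ (B ℚ.+ C) {{D≢0}}) ⟩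
    1ℚ ℚ.* ε
      ≡⟨ ℚ.*-identityˡ ε ⟩
    ε ∎
    where
    open ℚ.≤-Reasoning
    D>0 : Positive (B ℚ.+ C)
    D>0 = ℚ.pos+pos⇒pos B {{B>0}} C {{C>0}}
    D≢0 : ℚ.NonZero (B ℚ.+ C)
    D≢0 = ℚ.pos⇒nonZero (B ℚ.+ C) {{D>0}}
    D⁻¹ ε′ : ℚ
    D⁻¹ = (1/ (B ℚ.+ C)) {{D≢0}}
    ε′ = D⁻¹ ℚ.* ε
    ε′>0 : Positive ε′
    ε′>0 = ℚ.pos*pos⇒pos D⁻¹ {{ℚ.1/pos⇒pos (B ℚ.+ C) {{D>0}}}} ε
    cx = cauchy x ε′ {{ε′>0}}
    cy = cauchy y ε′ {{ε′>0}}
    M N T : ℕ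
    M = proj₁ cx
    N = proj₁ cy
    T = (K ⊔ L) ⊔ (M ⊔ N)
    K≤ : ∀ {i} → T ℕ.≤ i → K ℕ.≤ i
    K≤ = ℕ.m⊔n≤o⇒m≤o K L ∘ ℕ.m⊔n≤o⇒m≤o (K ⊔ L) (M ⊔ N)
    L≤ : ∀ {i} → T ℕ.≤ i → L ℕ.≤ i
    L≤ = ℕ.m⊔n≤o⇒n≤o K L ∘ ℕ.m⊔n≤o⇒m≤o (K ⊔ L) (M ⊔ N)
    M≤ : ∀ {i} → T ℕ.≤ i → M ℕ.≤ i
    M≤ = ℕ.m⊔n≤o⇒m≤o M N ∘ ℕ.m⊔n≤o⇒n≤o (K ⊔ L) (M ⊔ N)
    N≤ : ∀ {i} → T ℕ.≤ i → N ℕ.≤ i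
    N≤ = ℕ.m⊔n≤o⇒n≤o M N ∘ ℕ.m⊔n≤o⇒n≤o (K ⊔ L) (M ⊔ N)

infixl 6 _+ᴿ_
infixl 7 _*ᴿ_

_+ᴿ_ : ℝ → ℝ → ℝ
x +ᴿ y = mkℝ (λ n → seq x n ℚ.+ seq y n) (sum-cauchy x y)

_*ᴿ_ : ℝ → ℝ → ℝ
x *ᴿ y = mkℝ (λ n → seq x n ℚ.* seq y n) (product-cauchy x y)

0ᴿ : ℝ
0ᴿ = fromℚ 0ℚ

+ᴿ-0-rawMonoid : RawMonoid 0ℓ 0ℓ
+ᴿ-0-rawMonoid = record { Carrier = ℝ ; _≈_ = _≈ᴿ_ ; _∙_ = _+ᴿ_ ; ε = 0ᴿ }

sumᴿ : ∀ {n} → (Fin n → ℝ) → ℝ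
sumᴿ = RawMonoidDefs.sum +ᴿ-0-rawMonoid

Matrix : ℕ → Set
Matrix n = Fin n → Fin n → ℝ

_*ᵥ_ : ∀ {n} → Matrix n → (Fin n → ℝ) → (Fin n → ℝ)
(M *ᵥ x) i = sumᴿ λ j → M i j *ᴿ x j

IsEigenvalue : ∀ {n} → Matrix n → ℝ → Set
IsEigenvalue {n} M μ = ∃ λ (x : Fin n → ℝ) →
  ¬ (∀ i → x i ≈ᴿ 0ᴿ) × (∀ i → (M *ᵥ x) i ≈ᴿ μ *ᴿ x i)

IsLargestEigenvalue : ∀ {n} → Matrix n → ℝ → Set
IsLargestEigenvalue M q = IsEigenvalue M q × (∀ μ → IsEigenvalue M μ → μ ≤ᴿ q)

record Graph (V : Set) : Set₁ where
  field
    Adj        : Rel V 0ℓ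
    adj?       : Decidable Adj
    adj-sym    : Symmetric Adj
    adj-irrefl : ∀ {v} → ¬ Adj v v

open Graph public

neighbours : ∀ {n} → Graph (Fin n) → Fin n → Subset n
neighbours G v = Vec.tabulate λ w → does (adj? G v w)

degree : ∀ {n} → Graph (Fin n) → Fin n → ℕ
degree G v = ∣ neighbours G v ∣

MinDegreeAtLeast : ∀ {n} → ℕ → Graph (Fin n) → Set
MinDegreeAtLeast δ G = ∀ v → δ ℕ.≤ degree G v

adjacencyMatrix : ∀ {n} → Graph (Fin n) → Matrix n
adjacencyMatrix G i j = if does (adj? G i j) then fromℕ 1 else 0ᴿ

degreeMatrix : ∀ {n} → Graph (Fin n) → Matrix n
degreeMatrix G i j = if does (i Fin.≟ j) then fromℕ (degree G i) else 0ᴿ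

signlessLaplacian : ∀ {n} → Graph (Fin n) → Matrix n
signlessLaplacian G i j = degreeMatrix G i j +ᴿ adjacencyMatrix G i j

-- `IsSignlessLaplacianRadius G q` says q = q(G).

IsSignlessLaplacianRadius : ∀ {n} → Graph (Fin n) → ℝ → Set
IsSignlessLaplacianRadius G = IsLargestEigenvalue (signlessLaplacian G)

_≅_ : {V W : Set} → Graph V → Graph W → Set
_≅_ {V} {W} G H = Σ (V ↔ W) λ f → ∀ u v →
  Adj G u v ⇔ Adj H (Inverse.to f u) (Inverse.to f v)

K : ∀ s → Graph (Fin s)
K s = record
  { Adj        = _≢_
  ; adj?       = λ u v → ¬? (u Fin.≟ v)
  ; adj-sym    = λ u≢v v≡u → u≢v (sym v≡u)
  ; adj-irrefl = λ v≢v → v≢v refl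
  }

I : ∀ t → Graph (Fin t)
I t = record
  { Adj        = λ _ _ → ⊥
  ; adj?       = λ _ _ → no λ ()
  ; adj-sym    = λ ()
  ; adj-irrefl = λ ()
  }

infixr 6 _∪_
infixr 5 _∨_

_∪_ : {V W : Set} → Graph V → Graph W → Graph (V ⊎ W)
_∪_ {V} {W} G H = record
  { Adj = R ; adj? = R? ; adj-sym = λ {u} {v} → R-sym u v ; adj-irrefl = λ {v} → R-irrefl v }
  where
  R : Rel (V ⊎ W) 0ℓ
  R (inj₁ u) (inj₁ v) = Adj G u v
  R (inj₁ u) (inj₂ v) = ⊥
  R (inj₂ u) (inj₁ v) = ⊥
  R (inj₂ u) (inj₂ v) = Adj H u v
  R? : Decidable R
  R? (inj₁ u) (inj₁ v) = adj? G u v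
  R? (inj₁ u) (inj₂ v) = no λ ()
  R? (inj₂ u) (inj₁ v) = no λ ()
  R? (inj₂ u) (inj₂ v) = adj? H u v
  R-sym : ∀ u v → R u v → R v u
  R-sym (inj₁ u) (inj₁ v) = adj-sym G
  R-sym (inj₂ u) (inj₂ v) = adj-sym H
  R-irrefl : ∀ v → ¬ R v v
  R-irrefl (inj₁ v) = adj-irrefl G
  R-irrefl (inj₂ v) = adj-irrefl H

_∨_ : {V W : Set} → Graph V → Graph W → Graph (V ⊎ W)
_∨_ {V} {W} G H = record
  { Adj = R ; adj? = R? ; adj-sym = λ {u} {v} → R-sym u v ; adj-irrefl = λ {v} → R-irrefl v }
  where
  R : Rel (V ⊎ W) 0ℓ
  R (inj₁ u) (inj₁ v) = Adj G u v
  R (inj₁ u) (inj₂ v) = ⊤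
  R (inj₂ u) (inj₁ v) = ⊤
  R (inj₂ u) (inj₂ v) = Adj H u v
  R? : Decidable R
  R? (inj₁ u) (inj₁ v) = adj? G u v
  R? (inj₁ u) (inj₂ v) = yes tt
  R? (inj₂ u) (inj₁ v) = yes tt
  R? (inj₂ u) (inj₂ v) = adj? H u v
  R-sym : ∀ u v → R u v → R v u
  R-sym (inj₁ u) (inj₁ v) = adj-sym G
  R-sym (inj₁ u) (inj₂ v) = λ _ → tt
  R-sym (inj₂ u) (inj₁ v) = λ _ → tt
  R-sym (inj₂ u) (inj₂ v) = adj-sym H
  R-irrefl : ∀ v → ¬ R v v
  R-irrefl (inj₁ v) = adj-irrefl G
  R-irrefl (inj₂ v) = adj-irrefl H

module _ {V : Set} (_≟_ : DecidableEquality V) where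

  open DecMembership (Product.≡-dec _≟_ _≟_) using (_∈?_)

  deleteEdges : Graph V → List (V × V) → Graph V
  deleteEdges G E′ = record
    { Adj        = λ u v → Adj G u v × ¬ ((u , v) ∈ E′ ⊎ (v , u) ∈ E′)
    ; adj?       = λ u v → adj? G u v ×-dec ¬? (((u , v) ∈? E′) ⊎-dec ((v , u) ∈? E′))
    ; adj-sym    = λ (a , ∉E′) → adj-sym G a , ∉E′ ∘ swap
    ; adj-irrefl = adj-irrefl G ∘ proj₁
    }

pathLength : {V : Set} → List⁺ V → ℕ
pathLength p = length (tail p)

-- A cycle is listed from an arbitrary starting vertex, which is not repeated
-- at the end.

closeUp : {V : Set} → List⁺ V → List V
closeUp c = toList c ∷ʳ head c

CycleEdge : {V : Set} → List⁺ V → Rel V 0ℓ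
CycleEdge c u v = (u , v) ∈ steps ⊎ (v , u) ∈ steps
  where steps = zip (closeUp c) (drop 1 (closeUp c))

module _ {V : Set} (G : Graph V) where

  IsPath : List⁺ V → Set
  IsPath p = Unique (toList p) × Linked (Adj G) (toList p)

  IsHamiltonCycle : List⁺ V → Set
  IsHamiltonCycle c =
    3 ℕ.≤ List⁺.length c × Unique (toList c) × (∀ v → v ∈ toList c) ×
    Linked (Adj G) (closeUp c)

EdgeHamiltonian : {V : Set} → ℕ → Graph V → Set
EdgeHamiltonian {V} k G =
  (ps : List (List⁺ V)) → All (IsPath G) ps → AllPairs (Disjoint on toList) ps →
  sum (map pathLength ps) ℕ.≤ k →
  ∃ λ c → IsHamiltonCycle G c × All (Linked (CycleEdge c) ∘ toList) ps

-- Both graphs have the shape (graph on Y) ∨ ((graph on Z) ∪ (graph on X)),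
-- so the three summands are Y, Z and X in this order.

Blocks : ℕ → ℕ → ℕ → Set
Blocks y z x = Fin y ⊎ (Fin z ⊎ Fin x)

module _ {y z x : ℕ} where

  _≟ᴮ_ : DecidableEquality (Blocks y z x)
  _≟ᴮ_ = Sum.≡-dec Fin._≟_ (Sum.≡-dec Fin._≟_ Fin._≟_)

  data InY∪Z : Blocks y z x → Set where
    inY : ∀ i → InY∪Z (inj₁ i)
    inZ : ∀ i → InY∪Z (inj₂ (inj₁ i))

  E₁ : Graph (Blocks y z x) → Blocks y z x × Blocks y z x → Set
  E₁ H (u , v) = Adj H u v × InY∪Z u × InY∪Z v

  -- G is H with at most b edges of E₁ H deleted, up to isomorphism. Listing an
  -- edge repeatedly, or in both orientations, only overcounts the deleted
  -- edges, so lists describe the same family of graphs as sets of edges.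

  _∈Deletions[_,_] : ∀ {n} → Graph (Fin n) → Graph (Blocks y z x) → ℕ → Set
  G ∈Deletions[ H , b ] = ∃ λ (E′ : List (Blocks y z x × Blocks y z x)) →
    All (E₁ H) E′ × length E′ ℕ.≤ b × G ≅ deleteEdges _≟ᴮ_ H E′

-- The block sizes are written so that truncated subtraction is exact whenever
-- the integers n - 2δ + k, δ - k and n - δ - 1 are nonnegative.

H⟨_,_,_⟩ : ∀ n k δ → Graph (Blocks δ ((n ℕ.+ k) ∸ 2 ℕ.* δ) (δ ∸ k))
H⟨ n , k , δ ⟩ = K δ ∨ (K ((n ℕ.+ k) ∸ 2 ℕ.* δ) ∪ I (δ ∸ k))

L⟨_,_,_⟩ : ∀ n k δ → Graph (Blocks (k ℕ.+ 1) (n ∸ (δ ℕ.+ 1)) (δ ∸ k))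
L⟨ n , k , δ ⟩ = K (k ℕ.+ 1) ∨ (K (n ∸ (δ ℕ.+ 1)) ∪ K (δ ∸ k))

_∈ℋ¹[_,_] : ∀ {n} → Graph (Fin n) → ℕ → ℕ → Set
_∈ℋ¹[_,_] {n} G k δ = G ∈Deletions[ H⟨ n , k , δ ⟩ , (δ ℕ.* (δ ∸ k)) ℕ./ 4 ]

_∈ℒ¹[_,_] : ∀ {n} → Graph (Fin n) → ℕ → ℕ → Set
_∈ℒ¹[_,_] {n} G k δ = G ∈Deletions[ L⟨ n , k , δ ⟩ , ((k ℕ.+ 1) ℕ.* (δ ∸ k)) ℕ./ 4 ]

{-# OPTIONS --safe #-}

-- Write s = δ - k. By the maximum principle for the degree vector, q(G) ≥ 2(n - s - 1) yields a vertex v with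
-- d(v)² + ∑_{w ~ v} d(w) ≥ 2(n - s - 1) d(v), and hence at most sn missing edges. Adding edges uv with
-- d(u) + d(v) ≥ n + k does not affect k-edge-Hamiltonicity (Bondy and Chvátal), so let G′ be the closure of G.
-- Counting missing edges, all but t ≤ s vertices of G′ form a clique. Unless G′ is complete, t = s, the set X of
-- the s exceptional vertices is completely joined to a part Y of the clique and not joined at all to the rest,
-- and the vertices of X have degree δ, so G′[X] is regular of degree r = δ - |Y| ≤ s - 1.
-- For r = 0 and r = s - 1 the graph G′ is H and L. Otherwise G′ is k-edge-Hamiltonian: extend the given paths to
-- a cover of all vertices by paths, join ends in X by edges of G′[X] as long as possible, after which (unless X has none) more
-- ends lie in Y than in X, and then join the remaining ends in X to ends in Y. The ends are now all in the clique,
-- and the paths can be concatenated to a Hamilton cycle.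
-- In the cases H and L, G is obtained from G′ by deleting edges outside X. If more than |X||Y|/4 edges were deleted,
-- a perturbation of the constant vector on the clique would show q(G) < 2(n - s - 1), again by the maximum principle.

module Submission where

open import Defs
open import Data.Bool.Base using (Bool; true; false; if_then_else_)
open import Data.Empty using (⊥)
open import Data.Fin.Base as Fin using (Fin; zero; suc)
import Data.Fin.Properties as Fin
open import Data.Fin.Subset using (∣_∣)
open import Data.Integer.Base as ℤ using (+_)
import Data.Integer.Properties as ℤ
import Data.Integer.Tactic.RingSolver as ℤ
open import Data.List.Base
  using (List; []; _∷_; _++_; _∷ʳ_; [_]; map; concat; length; allFin; reverse; zip; drop; tabulate;
         filter; take; cartesianProduct)
import Data.List.Properties as List
open import Data.List.Membership.Propositional using (_∈_; _∉_; find)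
import Data.List.Membership.Propositional.Properties as ∈
open import Data.List.Membership.Propositional.Properties.WithK using (unique∧set⇒bag)
import Data.List.Membership.DecPropositional as DecMembership
open import Data.List.NonEmpty.Base using (List⁺; _∷_; toList)
open import Data.List.Relation.Binary.BagAndSetEquality using (∼bag⇒↭)
open import Data.List.Relation.Binary.Disjoint.Propositional using (Disjoint)
open import Data.List.Relation.Binary.Permutation.Propositional as ↭
  using (_↭_; ↭-sym; ↭-trans; ↭-refl; ↭-prep)
import Data.List.Relation.Binary.Permutation.Propositional.Properties as ↭
import Data.List.Relation.Binary.Permutation.Setoid.Properties as ↭ₛ
open import Data.List.Relation.Unary.All as All using (All; []; _∷_)
import Data.List.Relation.Unary.All.Properties as All
open import Data.List.Relation.Unary.AllPairs using (AllPairs; []; _∷_)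
import Data.List.Relation.Unary.AllPairs.Properties as AllPairs
open import Data.List.Relation.Unary.Any as Any using (Any; here; there)
import Data.List.Relation.Unary.Any.Properties as Any
open import Data.List.Relation.Unary.Linked as Linked using (Linked; []; [-]; _∷_)
open import Data.List.Relation.Unary.Unique.Propositional using (Unique)
import Data.List.Relation.Unary.Unique.Propositional.Properties as Unique
open import Data.Nat.Base as ℕ using (ℕ; zero; suc; _+_; _*_; _∸_; _≤_; _<_; z≤n; s≤s)
import Data.Nat.DivMod as ℕ
open import Data.Nat.ListAction using (sum)
open import Data.Nat.ListAction.Properties using (sum-++; sum-↭)
import Data.Nat.Properties as ℕ
open import Data.Nat.Tactic.RingSolver using (solve-∀)
open import Data.Product.Base using (Σ; ∃; ∃₂; _×_; _,_; proj₁; proj₂; uncurry)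
import Data.Product.Properties as Product
open import Data.Rational.Base as ℚ using (ℚ; 0ℚ; 1ℚ; ½) renaming (∣_∣ to ∣_∣ℚ)
import Data.Rational.Properties as ℚ
open import Data.Rational.Solver using (module +-*-Solver)
import Data.Rational.Unnormalised.Base as ℚᵘ
import Data.Rational.Unnormalised.Properties as ℚᵘ
open import Data.Sum.Base using (_⊎_; inj₁; inj₂; swap)
open import Data.Sum.Function.Propositional using (_⊎-↔_)
open import Data.Unit.Base using (⊤)
import Data.Vec.Base as Vec
open import Function.Base using (_∘_; id; _on_)
open import Function.Bundles using (_↔_; mk↔ₛ′; mk⇔; module Inverse)
open import Function.Construct.Composition using (_↔-∘_)
open import Function.Construct.Identity using (↔-id)
open import Relation.Binary.Definitions using (DecidableEquality; tri<; tri≈; tri>)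
open import Relation.Binary.PropositionalEquality
  using (_≡_; _≢_; refl; sym; trans; cong; cong₂; subst; subst₂; setoid; module ≡-Reasoning)
open import Relation.Nullary using (¬_; Dec; yes; no; does; contradiction)
open import Relation.Nullary.Decidable using (¬?; _×-dec_; _⊎-dec_)
open import Algebra.Properties.Semiring.Sum ℕ.+-*-semiring
  using (∑-distrib-+; ∑-comm; sum-cong-≗; *-distribˡ-sum) renaming (sum to ∑)

-- Finite sums

-- All spectral input is one criterion: if `z` is an integer vector with `(Qz)ᵢ < T zᵢ` in every
-- row, then no eigenvalue of `Q` is at least `T`. As both sides are integers, they differ by at
-- least 1, and this gap absorbs the errors of rational approximations, so that order on the reals
-- never has to be decided. The 4 in the bound on deleted edges arises as follows. Relative to a
-- constant vector on the clique of `N = n - s` vertices, a vertex of `Y` is raised by s/N for its s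
-- neighbours in `X`, whose own weight is negligible. A deleted edge lowers both its ends by 2/N
-- each, for the lost degree and the lost neighbour. The sum of the weights moves by (s|Y| -
-- 4|E'|)/N, and a negative value pushes the radius below the bound. The obstacle in the regular
-- case is a count that is tight up to one: if some vertex of `X` is still a one-vertex path, its
-- neighbours only show that at most as many ends lie in `X` as in `Y`. The missing unit is either
-- present from the beginning or produced by the first join inside `X`, and has to be carried along
-- as an invariant.

ind : {P : Set} → Dec P → ℕ
ind d = if does d then 1 else 0

ind-yes : ∀ {P} (d : Dec P) → P → ind d ≡ 1
ind-yes (yes _) _ = refl
ind-yes (no ¬p) p = contradiction p ¬p

ind-no : ∀ {P} (d : Dec P) → ¬ P → ind d ≡ 0
ind-no (yes p) ¬p = contradiction p ¬p
ind-no (no _)  _  = refl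

ind≤1 : ∀ {P} (d : Dec P) → ind d ≤ 1
ind≤1 (yes _) = ℕ.≤-refl
ind≤1 (no _)  = z≤n

ind≤ : ∀ {P} (d : Dec P) {m} → (P → 1 ≤ m) → ind d ≤ m
ind≤ (yes p) h = h p
ind≤ (no _)  h = z≤n

ind-mono : ∀ {P Q} (d : Dec P) (e : Dec Q) → (P → Q) → ind d ≤ ind e
ind-mono (yes p) e f = ℕ.≤-reflexive (sym (ind-yes e (f p)))
ind-mono (no _)  e f = z≤n

ind-cong : ∀ {P Q} (d : Dec P) (e : Dec Q) → (P → Q) → (Q → P) → ind d ≡ ind e
ind-cong d e f g = ℕ.≤-antisym (ind-mono d e f) (ind-mono e d g)

*-ind≤ : ∀ {P} (d : Dec P) {a b} → (P → a ≤ b) → a * ind d ≤ b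
*-ind≤ (yes p) {a} f = ℕ.≤-trans (ℕ.≤-reflexive (ℕ.*-identityʳ a)) (f p)
*-ind≤ (no _)  {a} f = ℕ.≤-trans (ℕ.≤-reflexive (ℕ.*-zeroʳ a)) z≤n

0<ind : ∀ {P} (d : Dec P) → 0 < ind d → P
0<ind (yes p) _ = p
0<ind (no _) ()


∑-mono : ∀ {n} {f g : Fin n → ℕ} → (∀ i → f i ≤ g i) → ∑ f ≤ ∑ g
∑-mono {zero}  h = z≤n
∑-mono {suc n} h = ℕ.+-mono-≤ (h zero) (∑-mono (h ∘ suc))

∑-const : ∀ n c → ∑ {n} (λ _ → c) ≡ n * c
∑-const zero    c = refl
∑-const (suc n) c = cong (λ z → c + z) (∑-const n c)

∑-scale : ∀ {n} a (f : Fin n → ℕ) {c} → ∑ f ≡ c → ∑ (λ i → a * f i) ≡ a * c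
∑-scale a f eq = trans (sym (*-distribˡ-sum a f)) (cong (λ z → a * z) eq)

∑-zero : ∀ n → ∑ {n} (λ _ → 0) ≡ 0
∑-zero n = trans (∑-const n 0) (ℕ.*-zeroʳ n)

f≤∑f : ∀ {n} (f : Fin n → ℕ) i → f i ≤ ∑ f
f≤∑f f zero    = ℕ.m≤m+n _ _
f≤∑f f (suc i) = ℕ.≤-trans (f≤∑f (f ∘ suc) i) (ℕ.m≤n+m _ _)

∑-δ : ∀ {n} (f : Fin n → ℕ) j → ∑ (λ i → ind (i Fin.≟ j) * f i) ≡ f j
∑-δ {suc n} f zero = begin
  1 * f zero + ∑ (λ i → 0 * f (suc i)) ≡⟨ cong₂ _+_ (ℕ.*-identityˡ (f zero)) (∑-zero n) ⟩
  f zero + 0 ≡⟨ ℕ.+-identityʳ _ ⟩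
  f zero ∎
  where open ≡-Reasoning
∑-δ f (suc j) = trans
  (sum-cong-≗ λ i → cong (λ z → z * f (suc i))
    (ind-cong (suc i Fin.≟ suc j) (i Fin.≟ j) Fin.suc-injective (cong suc)))
  (∑-δ (f ∘ suc) j)

∑-δ₁ : ∀ {n} (j : Fin n) → ∑ (λ i → ind (i Fin.≟ j)) ≡ 1
∑-δ₁ j = trans (sum-cong-≗ λ i → sym (ℕ.*-identityʳ (ind (i Fin.≟ j)))) (∑-δ (λ _ → 1) j)

Σˡ : {A : Set} → (A → ℕ) → List A → ℕ
Σˡ f l = sum (map f l)

Σˡ-++ : ∀ {A : Set} (f : A → ℕ) l m → Σˡ f (l ++ m) ≡ Σˡ f l + Σˡ f m
Σˡ-++ f l m = trans (cong sum (List.map-++ f l m)) (sum-++ (map f l) (map f m))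

Σˡ-↭ : ∀ {A : Set} (f : A → ℕ) {l m} → l ↭ m → Σˡ f l ≡ Σˡ f m
Σˡ-↭ f p = sum-↭ (↭.map⁺ f p)

Σˡ-mono : ∀ {A : Set} {f g : A → ℕ} l → (∀ {x} → x ∈ l → f x ≤ g x) → Σˡ f l ≤ Σˡ g l
Σˡ-mono []      h = z≤n
Σˡ-mono (x ∷ l) h = ℕ.+-mono-≤ (h (here refl)) (Σˡ-mono l (h ∘ there))

Σˡ-cong : ∀ {A : Set} {f g : A → ℕ} l → (∀ x → f x ≡ g x) → Σˡ f l ≡ Σˡ g l
Σˡ-cong l h = cong sum (List.map-cong h l)

Σˡ-+ : ∀ {A : Set} (f g : A → ℕ) l → Σˡ (λ x → f x + g x) l ≡ Σˡ f l + Σˡ g l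
Σˡ-+ f g []      = refl
Σˡ-+ f g (x ∷ l) rewrite Σˡ-+ f g l = interchange (f x) (g x) (Σˡ f l) (Σˡ g l)
  where
  interchange : ∀ a b c d → a + b + (c + d) ≡ a + c + (b + d)
  interchange = solve-∀

Σˡ-const : ∀ {A : Set} c (l : List A) → Σˡ (λ _ → c) l ≡ length l * c
Σˡ-const c []      = refl
Σˡ-const c (x ∷ l) = cong (λ z → c + z) (Σˡ-const c l)

f≤Σˡf : ∀ {A : Set} (f : A → ℕ) {x l} → x ∈ l → f x ≤ Σˡ f l
f≤Σˡf f (here refl) = ℕ.m≤m+n _ _
f≤Σˡf f (there i)   = ℕ.≤-trans (f≤Σˡf f i) (ℕ.m≤n+m _ _)

∑-Σˡ-comm : ∀ {n} {A : Set} (g : Fin n → A → ℕ) l →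
  ∑ (λ i → Σˡ (g i) l) ≡ Σˡ (λ x → ∑ (λ i → g i x)) l
∑-Σˡ-comm {n} g [] = ∑-zero n
∑-Σˡ-comm g (x ∷ l) = trans (∑-distrib-+ (λ i → g i x) (λ i → Σˡ (g i) l))
  (cong (λ z → ∑ (λ i → g i x) + z) (∑-Σˡ-comm g l))

Σˡ-Σˡ-comm : ∀ {A B : Set} (g : A → B → ℕ) k l →
  Σˡ (λ a → Σˡ (g a) l) k ≡ Σˡ (λ b → Σˡ (λ a → g a b) k) l
Σˡ-Σˡ-comm g [] l = sym (trans (Σˡ-const 0 l) (ℕ.*-zeroʳ (length l)))
Σˡ-Σˡ-comm g (x ∷ k) l = trans (cong (λ z → Σˡ (g x) l + z) (Σˡ-Σˡ-comm g k l))
  (sym (Σˡ-+ (g x) (λ b → Σˡ (λ a → g a b) k) l))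

Σˡ-tabulate : ∀ {n} {A : Set} (f : A → ℕ) (g : Fin n → A) → Σˡ f (tabulate g) ≡ ∑ (f ∘ g)
Σˡ-tabulate {zero}  f g = refl
Σˡ-tabulate {suc n} f g = cong (λ z → f (g zero) + z) (Σˡ-tabulate f (g ∘ suc))

-- A Hamilton path visits every vertex exactly once. Encoded as a permutation, this gives
-- distinctness and the length, and lets sums over all vertices be evaluated along the list.
Spanning : ∀ {n} → List (Fin n) → Set
Spanning {n} l = l ↭ allFin n

spanning : ∀ {n} {l : List (Fin n)} → Unique l → (∀ v → v ∈ l) → Spanning l
spanning {n} u c = ∼bag⇒↭ (unique∧set⇒bag u (Unique.allFin⁺ n)
  (λ {v} → mk⇔ (λ _ → ∈.∈-allFin v) (λ _ → c v)))

Unique-↭ : ∀ {A : Set} {l m : List A} → l ↭ m → Unique l → Unique m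
Unique-↭ {A} p = ↭ₛ.Unique-resp-↭ (setoid A) (↭.↭⇒↭ₛ p)

spanning-unique : ∀ {n} {l : List (Fin n)} → Spanning l → Unique l
spanning-unique {n} p = Unique-↭ (↭-sym p) (Unique.allFin⁺ n)

spanning-∈ : ∀ {n} {l : List (Fin n)} → Spanning l → ∀ v → v ∈ l
spanning-∈ p v = ↭.∈-resp-↭ (↭-sym p) (∈.∈-allFin v)

Σˡ-spanning : ∀ {n} (f : Fin n → ℕ) {l} → Spanning l → Σˡ f l ≡ ∑ f
Σˡ-spanning f p = trans (Σˡ-↭ f p) (Σˡ-tabulate f id)

spanning-length : ∀ {n} {l : List (Fin n)} → Spanning l → length l ≡ n
spanning-length {n} p = trans (↭.↭-length p) (List.length-tabulate {n = n} id)

∣tabulate∣ : ∀ {n} (f : Fin n → Bool) → ∣ Vec.tabulate f ∣ ≡ ∑ (λ i → if f i then 1 else 0)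
∣tabulate∣ {zero}  f = refl
∣tabulate∣ {suc n} f with f zero
... | true  = cong suc (∣tabulate∣ (f ∘ suc))
... | false = ∣tabulate∣ (f ∘ suc)

adj : ∀ {n} → Graph (Fin n) → Fin n → Fin n → ℕ
adj G v w = ind (adj? G v w)

degree-∑ : ∀ {n} (G : Graph (Fin n)) v → degree G v ≡ ∑ (adj G v)
degree-∑ G v = ∣tabulate∣ (λ w → does (adj? G v w))

-- A search that decides neither alternative: in `saturate-step` success is a whole new cover and
-- failure a statement about the ends of other paths.
∀⊎ : ∀ {n} {A : Set} {B : Fin n → Set} → (∀ i → A ⊎ B i) → A ⊎ (∀ i → B i)
∀⊎ {zero}  f = inj₂ λ ()
∀⊎ {suc n} f with f zero | ∀⊎ (f ∘ suc)
... | inj₁ a | _      = inj₁ a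
... | inj₂ _ | inj₁ a = inj₁ a
... | inj₂ b | inj₂ g = inj₂ λ { zero → b ; (suc i) → g i }

-- Consecutive elements of a list

steps : {A : Set} → List A → List (A × A)
steps l = zip l (drop 1 l)

module _ {A : Set} where

  Consec : List A → A → A → Set
  Consec l a b = (a , b) ∈ steps l

  Neigh : List A → A → A → Set
  Neigh l a b = Consec l a b ⊎ Consec l b a

  consec-≡ : ∀ {k l a b} → k ≡ l → Consec k a b → Consec l a b
  consec-≡ refl c = c

  consec-∷ : ∀ {x a b} l → Consec l a b → Consec (x ∷ l) a b
  consec-∷ (y ∷ l) c = there c

  consec-++ʳ : ∀ k {l a b} → Consec l a b → Consec (k ++ l) a b
  consec-++ʳ []      c = c
  consec-++ʳ (x ∷ k) c = consec-∷ (k ++ _) (consec-++ʳ k c)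

  consec-++ˡ : ∀ k {l a b} → Consec k a b → Consec (k ++ l) a b
  consec-++ˡ (x ∷ y ∷ k) (here e)  = here e
  consec-++ˡ (x ∷ y ∷ k) (there c) = there (consec-++ˡ (y ∷ k) c)

  consec-mid : ∀ k {l a b} → Consec (k ++ a ∷ b ∷ l) a b
  consec-mid k = consec-++ʳ k (here refl)

  -- The pivot is kept in both pieces, so no step is lost at the cut; cycles are rotated and
  -- rerouted by cutting at such pivots.
  consec-pivot : ∀ k {p l a b} → Consec (k ++ p ∷ l) a b →
                 Consec (k ∷ʳ p) a b ⊎ Consec (p ∷ l) a b
  consec-pivot []          c         = inj₂ c
  consec-pivot (x ∷ [])    (here e)  = inj₁ (here e)
  consec-pivot (x ∷ [])    (there c) = inj₂ c
  consec-pivot (x ∷ y ∷ k) (here e)  = inj₁ (here e)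
  consec-pivot (x ∷ y ∷ k) (there c) with consec-pivot (y ∷ k) c
  ... | inj₁ d = inj₁ (there d)
  ... | inj₂ d = inj₂ d

  consec-pivotˡ : ∀ k {p l a b} → Consec (k ∷ʳ p) a b → Consec (k ++ p ∷ l) a b
  consec-pivotˡ k {p} {l} c =
    consec-≡ (List.++-assoc k [ p ] l) (consec-++ˡ (k ∷ʳ p) c)

  consec-reverse : ∀ l {a b} → Consec l a b → Consec (reverse l) b a
  consec-reverse (x ∷ y ∷ l) (here refl) rewrite List.unfold-reverse x (y ∷ l) | List.unfold-reverse y l
    | List.++-assoc (reverse l) [ y ] [ x ] = consec-mid (reverse l)
  consec-reverse (x ∷ y ∷ l) (there c) rewrite List.unfold-reverse x (y ∷ l) =
    consec-++ˡ (reverse (y ∷ l)) (consec-reverse (y ∷ l) c)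

  consec-reverse⁻ : ∀ l {a b} → Consec (reverse l) a b → Consec l b a
  consec-reverse⁻ l c = consec-≡ (List.reverse-involutive l) (consec-reverse (reverse l) c)

  consec-split : ∀ l {a b} → Consec l a b → ∃₂ λ k m → l ≡ k ++ a ∷ b ∷ m
  consec-split (x ∷ y ∷ l) (here refl) = [] , l , refl
  consec-split (x ∷ y ∷ l) (there c) with consec-split (y ∷ l) c
  ... | k , m , e = x ∷ k , m , cong (λ z → x ∷ z) e

  consec-∈₁ : ∀ l {w a b} → Consec (l ∷ʳ w) a b → a ∈ l
  consec-∈₁ (x ∷ [])    (here refl) = here refl
  consec-∈₁ (x ∷ y ∷ l) (here refl) = here refl
  consec-∈₁ (x ∷ y ∷ l) (there c)   = there (consec-∈₁ (y ∷ l) c)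

  consec-∈₂ : ∀ l {w a b} → Consec (w ∷ l) a b → b ∈ l
  consec-∈₂ (x ∷ l) (here refl) = here refl
  consec-∈₂ (x ∷ l) (there c)   = there (consec-∈₂ l c)

  consec-∈ˡ : ∀ l {a b} → Consec l a b → a ∈ l
  consec-∈ˡ (x ∷ y ∷ l) (here refl) = here refl
  consec-∈ˡ (x ∷ y ∷ l) (there c)   = there (consec-∈ˡ (y ∷ l) c)

  consec-∈ʳ : ∀ l {a b} → Consec l a b → b ∈ l
  consec-∈ʳ (x ∷ l) c = there (consec-∈₂ l c)

  linked⇒ : ∀ {R : A → A → Set} {l} → Linked R l → ∀ {a b} → Consec l a b → R a b
  linked⇒ (r ∷ k) (here refl) = r
  linked⇒ (r ∷ k) (there c)   = linked⇒ k c

  ⇒linked : ∀ {R : A → A → Set} l → (∀ {a b} → Consec l a b → R a b) → Linked R l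
  ⇒linked []          h = []
  ⇒linked (x ∷ [])    h = [-]
  ⇒linked (x ∷ y ∷ l) h = h (here refl) ∷ ⇒linked (y ∷ l) (h ∘ there)

  neigh-reverse : ∀ l {a b} → Neigh l a b → Neigh (reverse l) a b
  neigh-reverse l (inj₁ c) = inj₂ (consec-reverse l c)
  neigh-reverse l (inj₂ c) = inj₁ (consec-reverse l c)

  neigh-map : ∀ {k l} → (∀ {a b} → Consec k a b → Consec l a b) → ∀ {a b} → Neigh k a b → Neigh l a b
  neigh-map f (inj₁ c) = inj₁ (f c)
  neigh-map f (inj₂ c) = inj₂ (f c)

  snoc-view : ∀ (x : A) l → ∃₂ λ k y → x ∷ l ≡ k ∷ʳ y
  snoc-view x []      = [] , x , refl
  snoc-view x (y ∷ l) with snoc-view y l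
  ... | k , z , e = x ∷ k , z , cong (λ w → x ∷ w) e

  length-steps : ∀ (x : A) l → length (steps (x ∷ l)) ≡ length l
  length-steps x []      = refl
  length-steps x (y ∷ l) = cong suc (length-steps y l)

  Σˡ-steps₂ : ∀ (f : A → ℕ) x l → Σˡ (f ∘ proj₂) (steps (x ∷ l)) ≡ Σˡ f l
  Σˡ-steps₂ f x []      = refl
  Σˡ-steps₂ f x (y ∷ l) = cong (λ z → f y + z) (Σˡ-steps₂ f y l)

  Σˡ-steps₁ : ∀ (f : A → ℕ) l y → Σˡ (f ∘ proj₁) (steps (l ∷ʳ y)) ≡ Σˡ f l
  Σˡ-steps₁ f []          y = refl
  Σˡ-steps₁ f (x ∷ [])    y = refl
  Σˡ-steps₁ f (x ∷ z ∷ l) y = cong (λ w → f x + w) (Σˡ-steps₁ f (z ∷ l) y)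

  consec-last : ∀ l {v a} → v ∉ l → Consec (l ∷ʳ v) a v → ∃ λ k → l ≡ k ∷ʳ a
  consec-last (x ∷ [])    v∉ (here refl) = [] , refl
  consec-last (x ∷ y ∷ l) v∉ (here refl) = contradiction (there (here refl)) v∉
  consec-last (x ∷ y ∷ l) v∉ (there c) with consec-last (y ∷ l) (v∉ ∘ there) c
  ... | k , e = x ∷ k , cong (λ w → x ∷ w) e

  consec-first : ∀ l {v b} → v ∉ l → Consec (v ∷ l ∷ʳ v) v b → l ≡ [] ⊎ ∃ λ k → l ≡ b ∷ k
  consec-first []      v∉ c           = inj₁ refl
  consec-first (x ∷ l) v∉ (here refl) = inj₂ (l , refl)
  consec-first (x ∷ l) v∉ (there c)   = contradiction (consec-∈₁ (x ∷ l) c) v∉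

unique-∉ : ∀ {A : Set} {x : A} {l} → Unique (x ∷ l) → x ∉ l
unique-∉ = Unique.Unique[x∷xs]⇒x∉xs

-- The closure

∑-mono-< : ∀ {n} {f g : Fin n → ℕ} → (∀ i → f i ≤ g i) → ∀ j → f j < g j → ∑ f < ∑ g
∑-mono-< h zero    l = ℕ.+-mono-<-≤ l (∑-mono (h ∘ suc))
∑-mono-< h (suc j) l = ℕ.+-mono-≤-< (h zero) (∑-mono-< (h ∘ suc) j l)

Edge : ℕ → Set
Edge n = Fin n × Fin n

_≟ᴱ_ : ∀ {n} (e f : Edge n) → Dec (e ≡ f)
_≟ᴱ_ = Product.≡-dec Fin._≟_ Fin._≟_

_∈ᵘ_ : ∀ {n} → Edge n → List (Edge n) → Set
(a , b) ∈ᵘ F = (a , b) ∈ F ⊎ (b , a) ∈ F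

_∈ᵘ?_ : ∀ {n} (e : Edge n) F → Dec (e ∈ᵘ F)
(a , b) ∈ᵘ? F = ((a , b) ∈? F) ⊎-dec ((b , a) ∈? F)
  where open DecMembership _≟ᴱ_ using (_∈?_)

Σˡ-zero : ∀ {A : Set} {f : A → ℕ} l → (∀ {x} → x ∈ l → f x ≡ 0) → Σˡ f l ≡ 0
Σˡ-zero []      h = refl
Σˡ-zero (x ∷ l) h = cong₂ _+_ (h (here refl)) (Σˡ-zero l (h ∘ there))

module _ {n : ℕ} where

  same : Edge n → Edge n → ℕ
  same (a , b) f = ind (((a , b) ≟ᴱ f) ⊎-dec ((b , a) ≟ᴱ f))

  -- If the first step is `f` in either direction, a later occurrence would revisit the first
  -- vertex.
  steps-same≤1 : ∀ {l} → Unique l → ∀ f → Σˡ (λ e → same e f) (steps l) ≤ 1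
  steps-same≤1 {[]}        u f = z≤n
  steps-same≤1 {x ∷ []}    u f = z≤n
  steps-same≤1 {x ∷ y ∷ l} u@(_ ∷ u′) f = split (((x , y) ≟ᴱ f) ⊎-dec ((y , x) ≟ᴱ f))
    where
    absurd : ∀ {a b} → (x , y) ≡ f ⊎ (y , x) ≡ f → Consec (y ∷ l) a b → (a , b) ≡ f ⊎ (b , a) ≡ f → ⊥
    absurd (inj₁ refl) c (inj₁ refl) = unique-∉ u (consec-∈ˡ (y ∷ l) c)
    absurd (inj₁ refl) c (inj₂ refl) = unique-∉ u (consec-∈ʳ (y ∷ l) c)
    absurd (inj₂ refl) c (inj₁ refl) = unique-∉ u (consec-∈ʳ (y ∷ l) c)
    absurd (inj₂ refl) c (inj₂ refl) = unique-∉ u (consec-∈ˡ (y ∷ l) c)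
    split : (d : Dec ((x , y) ≡ f ⊎ (y , x) ≡ f)) → ind d + Σˡ (λ e → same e f) (steps (y ∷ l)) ≤ 1
    split (no _)  = steps-same≤1 u′ f
    split (yes p) = ℕ.≤-reflexive (cong suc (Σˡ-zero (steps (y ∷ l)) λ {(a , b)} e∈ →
      ind-no (((a , b) ≟ᴱ f) ⊎-dec ((b , a) ≟ᴱ f)) (absurd p e∈)))

  ind-∈ᵘ≤ : ∀ e F → ind (e ∈ᵘ? F) ≤ Σˡ (same e) F
  ind-∈ᵘ≤ (a , b) F = ind≤ ((a , b) ∈ᵘ? F) λ where
    (inj₁ p) → ℕ.≤-trans (ℕ.≤-reflexive (sym
      (ind-yes (((a , b) ≟ᴱ (a , b)) ⊎-dec ((b , a) ≟ᴱ (a , b))) (inj₁ refl)))) (f≤Σˡf (same (a , b)) p)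
    (inj₂ p) → ℕ.≤-trans (ℕ.≤-reflexive (sym
      (ind-yes (((a , b) ≟ᴱ (b , a)) ⊎-dec ((b , a) ≟ᴱ (b , a))) (inj₂ refl)))) (f≤Σˡf (same (a , b)) p)

  -- Hence at most `k` steps of a Hamilton path are protected from removal. This is the reason for
  -- `n + k` in the degree condition, where Hamilton cycles alone would need `n`.
  steps-∈ᵘ≤ : ∀ {l} → Unique l → ∀ F → Σˡ (λ e → ind (e ∈ᵘ? F)) (steps l) ≤ length F
  steps-∈ᵘ≤ {l} u F = begin
    Σˡ (λ e → ind (e ∈ᵘ? F)) (steps l) ≤⟨ Σˡ-mono (steps l) (λ {e} _ → ind-∈ᵘ≤ e F) ⟩
    Σˡ (λ e → Σˡ (same e) F) (steps l) ≡⟨ Σˡ-Σˡ-comm same (steps l) F ⟩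
    Σˡ (λ f → Σˡ (λ e → same e f) (steps l)) F ≤⟨ Σˡ-mono F (λ {f} _ → steps-same≤1 u f) ⟩
    Σˡ (λ _ → 1) F ≡⟨ Σˡ-const 1 F ⟩
    length F * 1 ≡⟨ ℕ.*-identityʳ _ ⟩
    length F ∎
    where open ℕ.≤-Reasoning

rotate : ∀ {A : Set} (h : A) t {v} → v ∈ h ∷ t → ∃ λ t′ → (v ∷ t′) ↭ (h ∷ t) ×
  (∀ {a b} → Consec (h ∷ t ∷ʳ h) a b → Consec (v ∷ t′ ∷ʳ v) a b) ×
  (∀ {a b} → Consec (v ∷ t′ ∷ʳ v) a b → Consec (h ∷ t ∷ʳ h) a b)
rotate h t {v} v∈ with ∈.∈-∃++ v∈
... | []    , B , refl = B , ↭-refl , id , id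
... | x ∷ A , B , refl rewrite List.++-assoc A (v ∷ B) [ x ] =
  B ++ x ∷ A , ↭.++-comm (v ∷ B) (x ∷ A) , to , from
  where
  eq : (B ++ x ∷ A) ∷ʳ v ≡ B ++ x ∷ A ∷ʳ v
  eq = List.++-assoc B (x ∷ A) [ v ]
  to : ∀ {a b} → Consec (x ∷ A ++ v ∷ B ∷ʳ x) a b → Consec (v ∷ (B ++ x ∷ A) ∷ʳ v) a b
  to c rewrite eq with consec-pivot (x ∷ A) c
  ... | inj₁ d = consec-++ʳ (v ∷ B) d
  ... | inj₂ d = consec-pivotˡ (v ∷ B) d
  from : ∀ {a b} → Consec (v ∷ (B ++ x ∷ A) ∷ʳ v) a b → Consec (x ∷ A ++ v ∷ B ∷ʳ x) a b
  from c rewrite eq with consec-pivot (v ∷ B) c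
  ... | inj₁ d = consec-++ʳ (x ∷ A) d
  ... | inj₂ d = consec-pivotˡ (x ∷ A) d

module _ {n : ℕ} (G : Graph (Fin n)) where

  -- Replacing the path edge ab by the chords au and bv turns the path from v to u into a cycle;
  -- such an edge outside F exists by counting the neighbours of u and v along the path.
  crossing : ∀ {k} u v t F → Spanning (v ∷ t ∷ʳ u) → 3 ≤ n →
    (∀ {a b} → Consec (v ∷ t ∷ʳ u) a b → Adj G a b) →
    ¬ Adj G u v → n + k ≤ degree G u + degree G v → length F ≤ k →
    ∃ λ c → IsHamiltonCycle G c ×
      (∀ {a b} → Neigh (v ∷ t ∷ʳ u) a b → (a , b) ∈ᵘ F → Neigh (closeUp c) a b)
  crossing {k} u v t F sp 3≤n path u≁v deg F≤k = answer (Any.any? good? (steps P))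
    where
    P : List (Fin n)
    P = v ∷ t ∷ʳ u
    Good : Edge n → Set
    Good (a , b) = (Adj G u a × Adj G v b) × ¬ (a , b) ∈ᵘ F
    good? : ∀ e → Dec (Good e)
    good? (a , b) = (adj? G u a ×-dec adj? G v b) ×-dec ¬? ((a , b) ∈ᵘ? F)

    -- A step that offers both chords counts 2, which the right side permits only inside `F`.
    count : ∀ e → ¬ Good e → adj G u (proj₁ e) + adj G v (proj₂ e) ≤ 1 + ind (e ∈ᵘ? F)
    count (a , b) ¬g = go (adj? G u a) (adj? G v b) ((a , b) ∈ᵘ? F)
      where
      go : (p : Dec (Adj G u a)) (q : Dec (Adj G v b)) (r : Dec ((a , b) ∈ᵘ F)) → ind p + ind q ≤ 1 + ind r
      go (yes p) (yes q) (yes r) = ℕ.≤-refl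
      go (yes p) (yes q) (no ¬r) = contradiction ((p , q) , ¬r) ¬g
      go (yes p) (no _)  _       = s≤s z≤n
      go (no _)  (yes q) _       = s≤s z≤n
      go (no _)  (no _)  _       = z≤n

    -- The first entries of the steps omit only `u`, the second entries only `v`, and neither vertex
    -- is its own neighbour.
    sum-u : Σˡ (adj G u ∘ proj₁) (steps P) ≡ degree G u
    sum-u = begin
      Σˡ (adj G u ∘ proj₁) (steps P) ≡⟨ Σˡ-steps₁ (adj G u) (v ∷ t) u ⟩
      Σˡ (adj G u) (v ∷ t) ≡⟨ ℕ.+-identityʳ _ ⟨
      Σˡ (adj G u) (v ∷ t) + 0 ≡⟨ cong (λ z → Σˡ (adj G u) (v ∷ t) + (z + 0))
                                                 (ind-no (adj? G u u) (adj-irrefl G)) ⟨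
      Σˡ (adj G u) (v ∷ t) + Σˡ (adj G u) [ u ] ≡⟨ Σˡ-++ (adj G u) (v ∷ t) [ u ] ⟨
      Σˡ (adj G u) P ≡⟨ Σˡ-spanning (adj G u) sp ⟩
      ∑ (adj G u) ≡⟨ degree-∑ G u ⟨
      degree G u ∎
      where open ≡-Reasoning

    sum-v : Σˡ (adj G v ∘ proj₂) (steps P) ≡ degree G v
    sum-v = begin
      Σˡ (adj G v ∘ proj₂) (steps P) ≡⟨ Σˡ-steps₂ (adj G v) v (t ∷ʳ u) ⟩
      Σˡ (adj G v) (t ∷ʳ u) ≡⟨ cong (λ z → z + Σˡ (adj G v) (t ∷ʳ u))
                                                 (ind-no (adj? G v v) (adj-irrefl G)) ⟨
      Σˡ (adj G v) P ≡⟨ Σˡ-spanning (adj G v) sp ⟩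
      ∑ (adj G v) ≡⟨ degree-∑ G v ⟨
      degree G v ∎
      where open ≡-Reasoning

    answer : Dec (Any Good (steps P)) → _
    -- The path has `n - 1` steps, so without a good one the degrees add up to at most `n - 1 + k`.
    answer (no none) = contradiction deg (ℕ.<⇒≱ (begin-strict
      degree G u + degree G v
        ≡⟨ cong₂ _+_ sum-u sum-v ⟨
      Σˡ (adj G u ∘ proj₁) (steps P) + Σˡ (adj G v ∘ proj₂) (steps P)
        ≡⟨ Σˡ-+ (adj G u ∘ proj₁) (adj G v ∘ proj₂) (steps P) ⟨
      Σˡ (λ e → adj G u (proj₁ e) + adj G v (proj₂ e)) (steps P)
        ≤⟨ Σˡ-mono (steps P) (λ {e} e∈ → count e (All.lookup (All.¬Any⇒All¬ (steps P) none) e∈)) ⟩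
      Σˡ (λ e → 1 + ind (e ∈ᵘ? F)) (steps P)
        ≡⟨ Σˡ-+ (λ _ → 1) (λ e → ind (e ∈ᵘ? F)) (steps P) ⟩
      Σˡ (λ _ → 1) (steps P) + Σˡ (λ e → ind (e ∈ᵘ? F)) (steps P)
        ≤⟨ ℕ.+-mono-≤ (ℕ.≤-reflexive (trans (Σˡ-const 1 (steps P)) (ℕ.*-identityʳ _)))
             (ℕ.≤-trans (steps-∈ᵘ≤ (spanning-unique sp) F) F≤k) ⟩
      length (steps P) + k
        ≡⟨ cong (λ z → z + k) (length-steps v (t ∷ʳ u)) ⟩
      length (t ∷ʳ u) + k
        <⟨ ℕ.≤-refl ⟩
      length P + k
        ≡⟨ cong (λ z → z + k) (spanning-length sp) ⟩
      n + k ∎))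
      where open ℕ.≤-Reasoning
    answer (yes some) with find some
    ... | (a , b) , c , (u~a , v~b) , ∉F with consec-split P c
    ... | A , B , eq with snoc-view b B
    ... | W , e , eq′ = go A refl
      where
      PW : v ∷ t ∷ʳ u ≡ (A ++ a ∷ W) ∷ʳ e
      PW = trans eq (trans (cong (λ z → A ++ a ∷ z) eq′) (sym (List.++-assoc A (a ∷ W) [ e ])))
      u≡e : u ≡ e
      u≡e = List.∷ʳ-injectiveʳ (v ∷ t) (A ++ a ∷ W) PW
      rev-head : reverse (b ∷ B) ≡ u ∷ reverse W
      rev-head = trans (cong reverse eq′) (trans (List.reverse-++ W [ e ]) (cong (λ z → z ∷ reverse W) (sym u≡e)))

      go : ∀ A″ → A ≡ A″ → ∃ λ c → IsHamiltonCycle G c ×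
        (∀ {x y} → Neigh (v ∷ t ∷ʳ u) x y → (x , y) ∈ᵘ F → Neigh (closeUp c) x y)
      -- With nothing in front of `a`, it is the first vertex `v`, and `u~a` would be the missing
      -- edge.
      go [] refl = contradiction (subst (λ z → Adj G u z) (sym (List.∷-injectiveˡ eq)) u~a) u≁v
      go (x ∷ A₁) refl with List.∷-injectiveˡ eq
      ... | refl = (v ∷ A₁ ++ a ∷ R) , (3≤ , spanning-unique spC , spanning-∈ spC , ⇒linked closed link) , keep
        where
        R = reverse (b ∷ B)
        spC : Spanning (v ∷ A₁ ++ a ∷ R)
        spC = ↭-trans (↭.++⁺ˡ (v ∷ A₁) (↭-prep a (↭.↭-reverse (b ∷ B)))) (subst Spanning eq sp)
        3≤ : 3 ≤ length (v ∷ A₁ ++ a ∷ R)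
        3≤ = ℕ.≤-trans 3≤n (ℕ.≤-reflexive (sym (spanning-length spC)))
        closed = v ∷ (A₁ ++ a ∷ R) ∷ʳ v
        closed≡ : closed ≡ (v ∷ A₁) ++ a ∷ R ∷ʳ v
        closed≡ = List.++-assoc (v ∷ A₁) (a ∷ R) [ v ]
        R∷ʳv : R ∷ʳ v ≡ reverse B ++ b ∷ v ∷ []
        R∷ʳv = trans (cong (λ z → z ∷ʳ v) (List.unfold-reverse b B)) (List.++-assoc (reverse B) [ b ] [ v ])
        link : ∀ {p q} → Consec closed p q → Adj G p q
        link {p} {q} d with consec-pivot (v ∷ A₁) (consec-≡ closed≡ d)
        ... | inj₁ d₁ = path (consec-≡ (sym eq) (consec-pivotˡ (v ∷ A₁) d₁))
        ... | inj₂ d₂ = tail-link d₂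
          where
          R-link : ∀ {p q} → Consec R p q → Adj G p q
          R-link d = adj-sym G (path (consec-≡ (sym eq)
            (consec-++ʳ (v ∷ A₁) (there (consec-reverse⁻ (b ∷ B) d)))))
          R∷ʳv-link : ∀ {p q} → Consec (R ∷ʳ v) p q → Adj G p q
          R∷ʳv-link {p} {q} d with consec-pivot (reverse B) (consec-≡ R∷ʳv d)
          ... | inj₁ d₁ = R-link (consec-≡ (sym (List.unfold-reverse b B)) d₁)
          ... | inj₂ (here refl) = adj-sym G v~b
          tail-link : ∀ {p q} → Consec (a ∷ R ∷ʳ v) p q → Adj G p q
          tail-link {p} {q} d with consec-≡ (cong (λ z → a ∷ z ∷ʳ v) rev-head) d
          ... | here refl = adj-sym G u~a
          ... | there d′ = R∷ʳv-link (consec-≡ (cong (λ z → z ∷ʳ v) (sym rev-head)) d′)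
        back : ∀ {p q} → Consec ((v ∷ A₁) ++ a ∷ R ∷ʳ v) p q → Consec closed p q
        back = consec-≡ (sym closed≡)
        keepC : ∀ {p q} → Consec P p q → (p , q) ∈ᵘ F → Neigh closed p q
        keepC {p} {q} d ∈F with consec-pivot (v ∷ A₁) (consec-≡ eq d)
        ... | inj₁ d₁          = inj₁ (back (consec-pivotˡ (v ∷ A₁) d₁))
        ... | inj₂ (here refl) = contradiction ∈F ∉F
        ... | inj₂ (there d₂)  = inj₂ (back (consec-++ʳ (v ∷ A₁) (consec-∷ (R ∷ʳ v)
                                   (consec-++ˡ R (consec-reverse (b ∷ B) d₂)))))
        keep : ∀ {p q} → Neigh P p q → (p , q) ∈ᵘ F → Neigh closed p q
        keep (inj₁ d) ∈F = keepC d ∈F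
        keep (inj₂ d) ∈F = swap (keepC d (swap ∈F))

-- A cycle contains the given paths as soon as it contains these edges, so the closure argument
-- needs to know only the edges and their number.
edges : ∀ {V : Set} → List (List⁺ V) → List (V × V)
edges ps = concat (map (steps ∘ toList) ps)

length-edges : ∀ {V : Set} (ps : List (List⁺ V)) → length (edges ps) ≡ sum (map pathLength ps)
length-edges []             = refl
length-edges ((x ∷ l) ∷ ps) = trans (List.length-++ (steps (x ∷ l)))
  (cong₂ _+_ (length-steps x l) (length-edges ps))

edges⇒ : ∀ {V : Set} {R : V → V → Set} {ps} → All (Linked R ∘ toList) ps →
         ∀ {a b} → (a , b) ∈ edges ps → R a b
edges⇒ {ps = p ∷ ps} (l ∷ ls) e with ∈.∈-++⁻ (steps (toList p)) e
... | inj₁ i = linked⇒ l i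
... | inj₂ i = edges⇒ ls i

⇒edges : ∀ {V : Set} {R : V → V → Set} ps → (∀ {a b} → (a , b) ∈ edges ps → R a b) →
         All (Linked R ∘ toList) ps
⇒edges []       h = []
⇒edges (p ∷ ps) h = ⇒linked (toList p) (h ∘ ∈.∈-++⁺ˡ) ∷ ⇒edges ps (h ∘ ∈.∈-++⁺ʳ (steps (toList p)))

module _ {n : ℕ} (G : Graph (Fin n)) {u v : Fin n} (u≢v : u ≢ v) where

  addEdge : Graph (Fin n)
  addEdge = record
    { Adj        = λ a b → Adj G a b ⊎ ((a ≡ u × b ≡ v) ⊎ (a ≡ v × b ≡ u))
    ; adj?       = λ a b → adj? G a b ⊎-dec (((a Fin.≟ u) ×-dec (b Fin.≟ v)) ⊎-dec ((a Fin.≟ v) ×-dec (b Fin.≟ u)))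
    ; adj-sym    = λ where
        (inj₁ p)               → inj₁ (adj-sym G p)
        (inj₂ (inj₁ (p , q))) → inj₂ (inj₂ (q , p))
        (inj₂ (inj₂ (p , q))) → inj₂ (inj₁ (q , p))
    ; adj-irrefl = λ where
        (inj₁ p)               → adj-irrefl G p
        (inj₂ (inj₁ (p , q))) → u≢v (trans (sym p) q)
        (inj₂ (inj₂ (p , q))) → u≢v (trans (sym q) p)
    }

  module _ {k : ℕ} (u≁v : ¬ Adj G u v) (deg : n + k ≤ degree G u + degree G v)
           (F : List (Edge n)) (F⊆G : ∀ {a b} → (a , b) ∈ F → Adj G a b) (F≤k : length F ≤ k)
           (3≤n : 3 ≤ n) where

    Extends : Set
    Extends = ∃ λ c → IsHamiltonCycle G c × (∀ {a b} → (a , b) ∈ F → Neigh (closeUp c) a b)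

    -- The added edge closes this cycle. Dropping it leaves a Hamilton path of `G`, which still
    -- contains `F` because `F` lies in `G`.
    last-case : ∀ t → Spanning (v ∷ t ∷ʳ u) →
      (∀ {a b} → Consec (v ∷ t ∷ʳ u ∷ʳ v) a b → Adj addEdge a b) →
      (∀ {a b} → (a , b) ∈ F → Neigh (v ∷ t ∷ʳ u ∷ʳ v) a b) → Extends
    last-case t sp link F⊆ with crossing G u v t F sp 3≤n path u≁v deg F≤k
      where
      uniq = spanning-unique sp
      -- As `n` is at least 3, the added edge is not also the first step of the path.
      no-first : ∀ t′ → Unique (v ∷ t′ ∷ʳ u) → length (v ∷ t′ ∷ʳ u) ≡ n → ∀ m → t′ ∷ʳ u ≢ u ∷ m
      no-first []       _       len m eq = contradiction 3≤n (ℕ.<⇒≱ (ℕ.≤-reflexive (cong suc (sym len))))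
      no-first (y ∷ t′) (_ ∷ z) len m eq with List.∷-injectiveˡ eq
      ... | refl = unique-∉ z (∈.∈-++⁺ʳ t′ (here refl))
      path : ∀ {a b} → Consec (v ∷ t ∷ʳ u) a b → Adj G a b
      path c with link (consec-++ˡ (v ∷ t ∷ʳ u) c)
      ... | inj₁ p                    = p
      ... | inj₂ (inj₁ (refl , refl)) = contradiction (consec-∈₂ (t ∷ʳ u) c) (unique-∉ uniq)
      ... | inj₂ (inj₂ (refl , refl)) with consec-first (t ∷ʳ u) (unique-∉ uniq) (consec-++ˡ (v ∷ t ∷ʳ u) c)
      ...   | inj₁ e       = contradiction (trans (sym (List.length-++-comm t [ u ])) (cong length e)) λ ()
      ...   | inj₂ (m , e) = contradiction e (no-first t uniq (spanning-length sp) m)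
    ... | c , ham , keep = c , ham , λ e → keep (F⊆P e) (inj₁ e)
      where
      pivot : ∀ {a b} → Consec (v ∷ t ∷ʳ u ∷ʳ v) a b → Consec (v ∷ t ∷ʳ u) a b ⊎ (a , b) ≡ (u , v)
      pivot c with consec-pivot (v ∷ t) (consec-≡ (List.++-assoc (v ∷ t) [ u ] [ v ]) c)
      ... | inj₁ d        = inj₁ d
      ... | inj₂ (here e) = inj₂ e
      F⊆P : ∀ {a b} → (a , b) ∈ F → Neigh (v ∷ t ∷ʳ u) a b
      F⊆P e with F⊆ e
      F⊆P e | inj₁ d with pivot d
      ... | inj₁ d′   = inj₁ d′
      ... | inj₂ refl = contradiction (F⊆G e) u≁v
      F⊆P e | inj₂ d with pivot d
      ... | inj₁ d′   = inj₂ d′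
      ... | inj₂ refl = contradiction (adj-sym G (F⊆G e)) u≁v

    any-case : ∀ x t → Spanning (v ∷ x ∷ t) →
      (∀ {a b} → Consec (v ∷ x ∷ t ∷ʳ v) a b → Adj addEdge a b) →
      (∀ {a b} → (a , b) ∈ F → Neigh (v ∷ x ∷ t ∷ʳ v) a b) → Extends
    any-case x t sp link F⊆ with snoc-view x t
    ... | t′ , e , eq with e Fin.≟ u | x Fin.≟ u
    ... | yes refl | _ = last-case t′ (subst (λ z → Spanning (v ∷ z)) eq sp)
            (λ c → link (consec-≡ (cong (λ z → v ∷ z ∷ʳ v) (sym eq)) c))
            (λ f → subst (λ z → Neigh (v ∷ z ∷ʳ v) _ _) eq (F⊆ f))
    ... | no _ | yes refl = last-case (reverse t)
            (↭-trans (↭-prep v (subst (λ z → z ↭ x ∷ t) rev (↭.↭-reverse (x ∷ t)))) sp)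
            (λ c → adj-sym addEdge (link (consec-reverse⁻ _ (consec-≡ (sym closed) c))))
            (λ {a} {b} f → subst (λ z → Neigh z a b) closed (neigh-reverse (v ∷ x ∷ t ∷ʳ v) (F⊆ f)))
      where
      rev : reverse (x ∷ t) ≡ reverse t ∷ʳ x
      rev = List.unfold-reverse x t
      closed : reverse (v ∷ x ∷ t ∷ʳ v) ≡ v ∷ reverse t ∷ʳ x ∷ʳ v
      closed = trans (List.unfold-reverse v (x ∷ t ∷ʳ v))
        (cong (λ z → z ∷ʳ v) (trans (List.reverse-++ (x ∷ t) [ v ]) (cong (λ z → v ∷ z) rev)))
    ... | no e≢u | no x≢u = (v ∷ x ∷ t)
          , (subst (λ z → 3 ≤ z) (sym (spanning-length sp)) 3≤n , uniq , spanning-∈ sp , ⇒linked _ unused) , F⊆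
      where
      uniq = spanning-unique sp
      unused : ∀ {a b} → Consec (v ∷ x ∷ t ∷ʳ v) a b → Adj G a b
      unused c with link c
      ... | inj₁ p = p
      unused (here refl) | inj₂ (inj₁ (refl , refl)) = contradiction refl u≢v
      unused (there c)   | inj₂ (inj₁ (refl , refl)) with consec-last (x ∷ t) (unique-∉ uniq) c
      ... | m , eq″ = contradiction (List.∷ʳ-injectiveʳ t′ m (trans (sym eq) eq″)) e≢u
      unused c | inj₂ (inj₂ (refl , refl)) with consec-first (x ∷ t) (unique-∉ uniq) c
      ... | inj₂ (m , eq″) = contradiction (List.∷-injectiveˡ eq″) x≢u

  closure-step : ∀ {k} → ¬ Adj G u v → n + k ≤ degree G u + degree G v →
                 EdgeHamiltonian k addEdge → EdgeHamiltonian k G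
  closure-step {k} u≁v deg EH ps paths disj len
    with EH ps (All.map (λ (a , b) → a , Linked.map inj₁ b) paths) disj len
  ... | (h ∷ t₀) , (3≤ , uniq , all , link) , contains
    with rotate h t₀ (all v)
  ... | []    , perm , to , from = contradiction 3≤
          (ℕ.<⇒≱ (ℕ.≤-trans (ℕ.≤-reflexive (cong suc (sym (↭.↭-length perm)))) (s≤s (s≤s z≤n))))
  ... | x ∷ t , perm , to , from
    with any-case u≁v deg (edges ps) (edges⇒ (All.map proj₂ paths))
      (subst (λ z → z ≤ k) (sym (length-edges ps)) len)
      (subst (λ z → 3 ≤ z) (spanning-length (spanning uniq all)) 3≤)
      x t (↭-trans perm (spanning uniq all)) (linked⇒ link ∘ from)
      (λ e → neigh-map to (edges⇒ contains e))
  ... | c , ham , keep = c , ham , ⇒edges ps keep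

∑-degree≤ : ∀ {n} (G : Graph (Fin n)) → ∑ (degree G) ≤ n * n
∑-degree≤ {n} G = ℕ.≤-trans (∑-mono λ v → ℕ.≤-trans (ℕ.≤-reflexive (degree-∑ G v))
  (ℕ.≤-trans (∑-mono λ w → ind≤1 (adj? G v w)) (ℕ.≤-reflexive (trans (∑-const n 1) (ℕ.*-identityʳ n)))))
  (ℕ.≤-reflexive (∑-const n n))

Closed : ∀ {n} → ℕ → Graph (Fin n) → Set
Closed {n} k G = ∀ u v → u ≢ v → ¬ Adj G u v → degree G u + degree G v < n + k

closure : ∀ {n} k (G : Graph (Fin n)) → ∃ λ (G′ : Graph (Fin n)) →
  (∀ {u v} → Adj G u v → Adj G′ u v) × (EdgeHamiltonian k G′ → EdgeHamiltonian k G) × Closed k G′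
-- The degree sum is at most `n * n` and grows with every added edge, so the fuel does not run out.
closure {n} k G = go (suc (n * n)) G (ℕ.m≤n+m (suc (n * n)) (∑ (degree G)))
  where
  go : ∀ fuel (G : Graph (Fin n)) → n * n < ∑ (degree G) + fuel → ∃ λ (G′ : Graph (Fin n)) →
    (∀ {u v} → Adj G u v → Adj G′ u v) × (EdgeHamiltonian k G′ → EdgeHamiltonian k G) × Closed k G′
  go zero    G lt = contradiction (∑-degree≤ G) (ℕ.<⇒≱ (subst (λ z → n * n < z) (ℕ.+-identityʳ _) lt))
  go (suc m) G lt with Fin.any? (λ u → Fin.any? (λ v →
    ¬? (u Fin.≟ v) ×-dec ¬? (adj? G u v) ×-dec (n + k ℕ.≤? degree G u + degree G v)))
  ... | no none = G , id , id , λ u v u≢v u≁v → ℕ.≰⇒> (λ deg → none (u , v , u≢v , u≁v , deg))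
  ... | yes (u , v , u≢v , u≁v , deg) with go m (addEdge G u≢v) (ℕ.≤-trans lt (begin
      ∑ (degree G) + suc m ≡⟨ ℕ.+-suc _ m ⟩
      suc (∑ (degree G)) + m ≤⟨ ℕ.+-monoˡ-≤ m (∑-mono-< more u more-u) ⟩
      ∑ (degree (addEdge G u≢v)) + m ∎))
    where
    open ℕ.≤-Reasoning
    H = addEdge G u≢v
    adj≤ : ∀ a b → adj G a b ≤ adj H a b
    adj≤ a b = ind-mono (adj? G a b) (adj? H a b) inj₁
    more : ∀ a → degree G a ≤ degree H a
    more a = subst₂ _≤_ (sym (degree-∑ G a)) (sym (degree-∑ H a)) (∑-mono (adj≤ a))
    more-u : degree G u < degree H u
    more-u = subst₂ _<_ (sym (degree-∑ G u)) (sym (degree-∑ H u)) (∑-mono-< (adj≤ u) v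
      (subst₂ _<_ (sym (ind-no (adj? G u v) u≁v)) (sym (ind-yes (adj? H u v) (inj₂ (inj₁ (refl , refl))))) (s≤s z≤n)))
  ... | G′ , sub , back , closed = G′ , sub ∘ inj₁ , closure-step G u≢v u≁v deg ∘ back , closed

-- Covers by paths

module _ {A : Set} where

  lastOf : A → List A → A
  lastOf x []      = x
  lastOf x (y ∷ l) = lastOf y l

  -- The vertex of a one-vertex path is listed twice.
  ends : List A → List A
  ends []      = []
  ends (x ∷ l) = x ∷ lastOf x l ∷ []

  allEnds : List (List A) → List A
  allEnds qs = concat (map ends qs)

  lastOf-++ : ∀ x l {y m} → lastOf x (l ++ y ∷ m) ≡ lastOf y m
  lastOf-++ x []      = refl
  lastOf-++ x (z ∷ l) = lastOf-++ z l

  lastOf-∈ : ∀ x l → lastOf x l ∈ x ∷ l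
  lastOf-∈ x []      = here refl
  lastOf-∈ x (y ∷ l) = there (lastOf-∈ y l)

  ends-⊆ : ∀ l {e} → e ∈ ends l → e ∈ l
  ends-⊆ (x ∷ l) (here refl)         = here refl
  ends-⊆ (x ∷ l) (there (here refl)) = lastOf-∈ x l

  allEnds-⊆ : ∀ qs {e} → e ∈ allEnds qs → e ∈ concat qs
  allEnds-⊆ (q ∷ qs) i with ∈.∈-++⁻ (ends q) i
  ... | inj₁ j = ∈.∈-++⁺ˡ (ends-⊆ q j)
  ... | inj₂ j = ∈.∈-++⁺ʳ q (allEnds-⊆ qs j)

  reverse-∷ : ∀ x l → ∃ λ m → reverse (x ∷ l) ≡ lastOf x l ∷ m × lastOf (lastOf x l) m ≡ x
  reverse-∷ x []      = [] , refl , refl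
  reverse-∷ x (y ∷ l) with reverse-∷ y l
  ... | m , e , _ = m ∷ʳ x , trans (List.unfold-reverse x (y ∷ l)) (cong (λ z → z ∷ʳ x) e) , lastOf-++ _ m

  ends-reverse : ∀ l → ends (reverse l) ↭ ends l
  ends-reverse []      = ↭-refl
  ends-reverse (x ∷ l) with reverse-∷ x l
  ... | m , e , e′ rewrite e | e′ = ↭.swap _ _ ↭-refl

  consec-++⁻ : ∀ x l {y m a b} → Consec ((x ∷ l) ++ y ∷ m) a b →
               Consec (x ∷ l) a b ⊎ (a ≡ lastOf x l × b ≡ y) ⊎ Consec (y ∷ m) a b
  consec-++⁻ x []      (here refl) = inj₂ (inj₁ (refl , refl))
  consec-++⁻ x []      (there c)   = inj₂ (inj₂ c)
  consec-++⁻ x (z ∷ l) (here refl) = inj₁ (here refl)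
  consec-++⁻ x (z ∷ l) (there c) with consec-++⁻ z l c
  ... | inj₁ d = inj₁ (there d)
  ... | inj₂ d = inj₂ d

  unique-++-≢ : ∀ k {l : List A} → Unique (k ++ l) → ∀ {a b} → a ∈ k → b ∈ l → a ≢ b
  unique-++-≢ (x ∷ k) (x∉ ∷ _) (here refl) j = All.lookup x∉ (∈.∈-++⁺ʳ k j)
  unique-++-≢ (x ∷ k) (_ ∷ u)  (there i)   j = unique-++-≢ k u i j

  neigh-++ʳ : ∀ k {l} {a b : A} → Neigh l a b → Neigh (k ++ l) a b
  neigh-++ʳ k = neigh-map (consec-++ʳ k)

  neigh-++ˡ : ∀ k {l} {a b : A} → Neigh k a b → Neigh (k ++ l) a b
  neigh-++ˡ k = neigh-map (consec-++ˡ k)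

  neigh-concat : ∀ {qs} {a b : A} → Any (λ q → Neigh q a b) qs → Neigh (concat qs) a b
  neigh-concat {q ∷ qs} (here c)  = neigh-++ˡ q c
  neigh-concat {q ∷ qs} (there i) = neigh-++ʳ q (neigh-concat i)

-- A spanning linear forest containing `F`, with isolated vertices as one-vertex paths. An edge of
-- `F` is sought within a single path, which makes `contains` stable under reversing and joining
-- paths.
record Forest {n} (G : Graph (Fin n)) (F : List (Edge n)) (qs : List (List (Fin n))) : Set where
  field
    spans    : Spanning (concat qs)
    links    : All (Linked (Adj G)) qs
    contains : ∀ {a b} → (a , b) ∈ F → Any (λ q → Neigh q a b) qs

open Forest

endSum : ∀ {n} → (Fin n → ℕ) → List (List (Fin n)) → ℕ
endSum f qs = Σˡ f (allEnds qs)

-- For a vertex of a forest this is 2 minus its degree in the forest: 2 on a one-vertex path, 1 at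
-- an end of a longer path, 0 in the interior.
ε : ∀ {n} → List (List (Fin n)) → Fin n → ℕ
ε qs v = endSum (λ e → ind (e Fin.≟ v)) qs

endSum-∷ : ∀ {n} (f : Fin n → ℕ) q qs → endSum f (q ∷ qs) ≡ Σˡ f (ends q) + endSum f qs
endSum-∷ f q qs = Σˡ-++ f (ends q) (allEnds qs)

endSum-++ : ∀ {n} (f : Fin n → ℕ) ps qs → endSum f (ps ++ qs) ≡ endSum f ps + endSum f qs
endSum-++ f []       qs = refl
endSum-++ f (p ∷ ps) qs = begin
  endSum f (p ∷ ps ++ qs) ≡⟨ endSum-∷ f p (ps ++ qs) ⟩
  Σˡ f (ends p) + endSum f (ps ++ qs) ≡⟨ cong (λ z → Σˡ f (ends p) + z) (endSum-++ f ps qs) ⟩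
  Σˡ f (ends p) + (endSum f ps + endSum f qs) ≡⟨ ℕ.+-assoc (Σˡ f (ends p)) _ _ ⟨
  Σˡ f (ends p) + endSum f ps + endSum f qs ≡⟨ cong (λ z → z + endSum f qs) (endSum-∷ f p ps) ⟨
  endSum f (p ∷ ps) + endSum f qs ∎
  where open ≡-Reasoning

endSum-front : ∀ {n} (f : Fin n → ℕ) as q bs → endSum f (as ++ q ∷ bs) ≡ endSum f (q ∷ as ++ bs)
endSum-front f as q bs
  rewrite endSum-++ f as (q ∷ bs) | endSum-∷ f q bs | endSum-∷ f q (as ++ bs) | endSum-++ f as bs
  = move (endSum f as) (Σˡ f (ends q)) (endSum f bs)
  where
  move : ∀ a b c → a + (b + c) ≡ b + (a + c)
  move = solve-∀

endSum-ε : ∀ {n} (f : Fin n → ℕ) qs → endSum f qs ≡ ∑ (λ v → ε qs v * f v)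
endSum-ε f qs = sym (begin
  ∑ (λ v → ε qs v * f v)
    ≡⟨ sum-cong-≗ (λ v → Σˡ-*ʳ (λ e → ind (e Fin.≟ v)) (f v) (allEnds qs)) ⟩
  ∑ (λ v → Σˡ (λ e → ind (e Fin.≟ v) * f v) (allEnds qs))
    ≡⟨ ∑-Σˡ-comm (λ v e → ind (e Fin.≟ v) * f v) (allEnds qs) ⟩
  Σˡ (λ e → ∑ (λ v → ind (e Fin.≟ v) * f v)) (allEnds qs)
    ≡⟨ Σˡ-cong (allEnds qs) (λ e → trans
         (sum-cong-≗ λ v → cong (λ z → z * f v) (ind-cong (e Fin.≟ v) (v Fin.≟ e) sym sym)) (∑-δ f e)) ⟩
  endSum f qs ∎)
  where
  open ≡-Reasoning
  Σˡ-*ʳ : ∀ {A : Set} (g : A → ℕ) c l → Σˡ g l * c ≡ Σˡ (λ x → g x * c) l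
  Σˡ-*ʳ g c []      = refl
  Σˡ-*ʳ g c (x ∷ l) = trans (ℕ.*-distribʳ-+ c (g x) (Σˡ g l)) (cong (λ z → g x * c + z) (Σˡ-*ʳ g c l))

∉⇒ε≡0 : ∀ {n} {qs} {v : Fin n} → v ∉ allEnds qs → ε qs v ≡ 0
∉⇒ε≡0 {qs = qs} {v} v∉ = Σˡ-zero (allEnds qs) λ {e} e∈ → ind-no (e Fin.≟ v) λ { refl → v∉ e∈ }

0<Σˡ : ∀ {A : Set} (f : A → ℕ) l → 0 < Σˡ f l → ∃ λ x → x ∈ l × 0 < f x
0<Σˡ f (x ∷ l) p with f x in eq
... | suc _ = x , here refl , subst (λ z → 0 < z) (sym eq) (s≤s z≤n)
... | zero with 0<Σˡ f l p
... | y , y∈ , q = y , there y∈ , q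

module _ {n : ℕ} {G : Graph (Fin n)} {F : List (Edge n)} where

  forest-front : ∀ as q bs → Forest G F (as ++ q ∷ bs) → Forest G F (q ∷ as ++ bs)
  forest-front as q bs φ = record
    { spans = ↭-trans (↭-sym (subst₂ _↭_ (List.concat-++ as (q ∷ bs))
        (cong (λ z → q ++ z) (List.concat-++ as bs)) (↭.shifts (concat as) q))) (spans φ)
    ; links = All.++⁻ʳ as (links φ) |> λ { (l ∷ ls) → l ∷ All.++⁺ (All.++⁻ˡ as (links φ)) ls }
    ; contains = λ e → front as (contains φ e)
    }
    where
    infixl 1 _|>_
    _|>_ : ∀ {A B : Set} → A → (A → B) → B
    x |> f = f x
    front : ∀ {P : List (Fin n) → Set} as → Any P (as ++ q ∷ bs) → Any P (q ∷ as ++ bs)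
    front as i with Any.++⁻ as i
    ... | inj₁ j         = there (Any.++⁺ˡ j)
    ... | inj₂ (here p)  = here p
    ... | inj₂ (there j) = there (Any.++⁺ʳ as j)

  linked-reverse : ∀ l → Linked (Adj G) l → Linked (Adj G) (reverse l)
  linked-reverse l k = ⇒linked (reverse l) λ c → adj-sym G (linked⇒ k (consec-reverse⁻ l c))

  forest-reverse : ∀ q qs → Forest G F (q ∷ qs) → Forest G F (reverse q ∷ qs)
  forest-reverse q qs φ = record
    { spans    = ↭-trans (↭.++⁺ʳ (concat qs) (↭.↭-reverse q)) (spans φ)
    ; links    = linked-reverse q (All.head (links φ)) ∷ All.tail (links φ)
    ; contains = λ e → flip′ (contains φ e)
    }
    where
    flip′ : ∀ {a b} → Any (λ q → Neigh q a b) (q ∷ qs) → Any (λ q → Neigh q a b) (reverse q ∷ qs)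
    flip′ (here c)  = here (neigh-reverse q c)
    flip′ (there i) = there i

  forest-++ : ∀ x s w t qs → Adj G (lastOf x s) w → Forest G F ((x ∷ s) ∷ (w ∷ t) ∷ qs) →
              Forest G F (((x ∷ s) ++ w ∷ t) ∷ qs)
  forest-++ x s w t qs x~w φ = record
    { spans    = subst Spanning (sym (List.++-assoc (x ∷ s) (w ∷ t) (concat qs))) (spans φ)
    ; links    = ⇒linked _ link ∷ All.tail (All.tail (links φ))
    ; contains = λ e → glue (contains φ e)
    }
    where
    link : ∀ {a b} → Consec ((x ∷ s) ++ w ∷ t) a b → Adj G a b
    link c with consec-++⁻ x s c
    ... | inj₁ d                    = linked⇒ (All.head (links φ)) d
    ... | inj₂ (inj₁ (refl , refl)) = x~w
    ... | inj₂ (inj₂ d)             = linked⇒ (All.head (All.tail (links φ))) d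
    glue : ∀ {a b} → Any (λ q → Neigh q a b) ((x ∷ s) ∷ (w ∷ t) ∷ qs) →
           Any (λ q → Neigh q a b) (((x ∷ s) ++ w ∷ t) ∷ qs)
    glue (here c)          = here (neigh-++ˡ (x ∷ s) c)
    glue (there (here c))  = here (neigh-++ʳ (x ∷ s) c)
    glue (there (there i)) = there i

  forest-disjoint : ∀ {q qs v} → Forest G F (q ∷ qs) → v ∈ q → v ∉ allEnds qs
  forest-disjoint {q} {qs} φ v∈q v∈ = unique-++-≢ q (spanning-unique (spans φ)) v∈q (allEnds-⊆ qs v∈) refl

  -- Prepares a join at `x`: the path ending there is moved to the front and turned so that it
  -- starts with `x`, past the paths `ps` that were pulled before. Statistics of the ends and
  -- properties invariant under reversal survive.
  record Pulled (ps qs : List (List (Fin n))) (x : Fin n) : Set₁ where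
    field
      path      : List (Fin n)
      rest      : List (List (Fin n))
      forest    : Forest G F (ps ++ qs) → Forest G F ((x ∷ path) ∷ ps ++ rest)
      sums      : ∀ f → endSum f qs ≡ Σˡ f (ends (x ∷ path)) + endSum f rest
      size      : length qs ≡ suc (length rest)
      preserves : ∀ {P : List (Fin n) → Set} → (∀ {q} → P (ends q) → P (ends (reverse q))) →
                  All (P ∘ ends) qs → All (P ∘ ends) ((x ∷ path) ∷ rest)

  pull : ∀ ps qs {x} → x ∈ allEnds qs → Pulled ps qs x
  pull ps qs {x} x∈ with ∈.∈-concat⁻′ (map ends qs) x∈
  ... | es , x∈es , es∈ with ∈.∈-map⁻ ends es∈
  ... | q , q∈ , refl with ∈.∈-∃++ q∈
  ... | as , bs , refl = orient q refl x∈es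
    where
    size′ : length (as ++ q ∷ bs) ≡ suc (length (as ++ bs))
    size′ = ↭.↭-length (↭.shift q as bs)
    sums′ : ∀ f → endSum f (as ++ q ∷ bs) ≡ Σˡ f (ends q) + endSum f (as ++ bs)
    sums′ f = trans (endSum-front f as q bs) (endSum-∷ f q (as ++ bs))
    forest′ : Forest G F (ps ++ as ++ q ∷ bs) → Forest G F (q ∷ ps ++ as ++ bs)
    forest′ φ = subst (λ z → Forest G F (q ∷ z)) (List.++-assoc ps as bs)
      (forest-front (ps ++ as) q bs (subst (Forest G F) (sym (List.++-assoc ps as (q ∷ bs))) φ))
    keep : ∀ {P : List (Fin n) → Set} → All P (as ++ q ∷ bs) → All P (q ∷ as ++ bs)
    keep h with All.++⁻ʳ as h
    ... | p ∷ ps = p ∷ All.++⁺ (All.++⁻ˡ as h) ps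
    orient : ∀ q′ → q ≡ q′ → x ∈ ends q′ → Pulled ps (as ++ q ∷ bs) x
    orient (y ∷ t) refl (here refl) = record
      { path = t ; rest = as ++ bs ; forest = forest′ ; sums = sums′ ; size = size′ ; preserves = λ _ → keep }
    orient (y ∷ t) refl (there (here refl)) with reverse-∷ y t
    ... | m , eq , _ = record
      { path      = m
      ; rest      = as ++ bs
      ; forest    = λ φ → subst (λ z → Forest G F (z ∷ ps ++ as ++ bs)) eq
                            (forest-reverse (y ∷ t) (ps ++ as ++ bs) (forest′ φ))
      ; sums      = λ f → trans (sums′ f) (cong (λ z → z + endSum f (as ++ bs))
                            (trans (Σˡ-↭ f (↭-sym (ends-reverse (y ∷ t)))) (cong (Σˡ f ∘ ends) eq)))
      ; size      = size′
      ; preserves = λ {P} inv h → subst (P ∘ ends) eq (inv {y ∷ t} (All.head (keep {P ∘ ends} h)))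
                                  ∷ All.tail (keep {P ∘ ends} h)
      }

  join : ∀ {x s w t qs} → Adj G x w → Forest G F ((w ∷ t) ∷ (x ∷ s) ∷ qs) →
    ∃ λ p → Forest G F (p ∷ qs) × ends p ≡ lastOf w t ∷ lastOf x s ∷ []
  join {x} {s} {w} {t} {qs} x~w φ with reverse-∷ w t
  ... | m , eq , last≡w = (lastOf w t ∷ m) ++ x ∷ s
        , forest-++ (lastOf w t) m x s qs (subst (λ z → Adj G z x) (sym last≡w) (adj-sym G x~w))
            (subst (λ z → Forest G F (z ∷ (x ∷ s) ∷ qs)) eq (forest-reverse (w ∷ t) ((x ∷ s) ∷ qs) φ))
        , cong (λ z → lastOf w t ∷ z ∷ []) (lastOf-++ (lastOf w t) m)

  -- The far ends of the two paths remain ends, so a join costs exactly one occurrence of `x` and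
  -- one of `w`. With indicators for `f` this accounts for every change in the numbers of ends in
  -- `X` and in `Y`.
  join-endSum : ∀ {qs x w} (P : Pulled [] qs x) (Q : Pulled [ x ∷ Pulled.path P ] (Pulled.rest P) w) {p} →
    ends p ≡ lastOf w (Pulled.path Q) ∷ lastOf x (Pulled.path P) ∷ [] →
    ∀ f → endSum f qs ≡ f x + f w + endSum f (p ∷ Pulled.rest Q)
  join-endSum {qs} {x} {w} P Q {p} ends-p f = begin
    endSum f qs ≡⟨ P.sums f ⟩
    f x + (f b + 0) + endSum f P.rest ≡⟨ cong (λ z → f x + (f b + 0) + z) (Q.sums f) ⟩
    f x + (f b + 0) + (f w + (f a + 0) + endSum f Q.rest) ≡⟨ arith (f x) (f b) (f w) (f a) (endSum f Q.rest) ⟩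
    f x + f w + (f a + (f b + 0) + endSum f Q.rest) ≡⟨ cong (λ z → f x + f w + (Σˡ f z + endSum f Q.rest)) ends-p ⟨
    f x + f w + (Σˡ f (ends p) + endSum f Q.rest) ≡⟨ cong (λ z → f x + f w + z) (endSum-∷ f p Q.rest) ⟨
    f x + f w + endSum f (p ∷ Q.rest) ∎
    where
    open ≡-Reasoning
    module P = Pulled P
    module Q = Pulled Q
    a = lastOf w Q.path
    b = lastOf x P.path
    arith : ∀ a b c d e → a + (b + 0) + (c + (d + 0) + e) ≡ (a + c) + (d + (b + 0) + e)
    arith = solve-∀

  ε-∷ : ∀ {x t qs} → Forest G F ((x ∷ t) ∷ qs) → ∀ {v} → v ∈ x ∷ t →
        ε ((x ∷ t) ∷ qs) v ≡ ind (x Fin.≟ v) + ind (lastOf x t Fin.≟ v)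
  ε-∷ {x} {t} {qs} φ {v} v∈ = begin
    ε ((x ∷ t) ∷ qs) v
      ≡⟨ endSum-∷ (λ e → ind (e Fin.≟ v)) (x ∷ t) qs ⟩
    ind (x Fin.≟ v) + (ind (lastOf x t Fin.≟ v) + 0) + ε qs v
      ≡⟨ cong₂ (λ a b → ind (x Fin.≟ v) + a + b) (ℕ.+-identityʳ _) (∉⇒ε≡0 {qs = qs} (forest-disjoint φ v∈)) ⟩
    ind (x Fin.≟ v) + ind (lastOf x t Fin.≟ v) + 0
      ≡⟨ ℕ.+-identityʳ _ ⟩
    ind (x Fin.≟ v) + ind (lastOf x t Fin.≟ v) ∎
    where open ≡-Reasoning

  ε≤2 : ∀ {qs} → Forest G F qs → ∀ v → ε qs v ≤ 2
  ε≤2 {qs} φ v with Any.any? (v Fin.≟_) (allEnds qs)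
  ... | no v∉  = ℕ.≤-trans (ℕ.≤-reflexive (∉⇒ε≡0 {qs = qs} v∉)) z≤n
  ... | yes v∈ = begin
    ε qs v ≡⟨ sums δ ⟩
    Σˡ δ (ends (v ∷ path)) + endSum δ rest ≡⟨ endSum-∷ δ (v ∷ path) rest ⟨
    ε ((v ∷ path) ∷ rest) v ≡⟨ ε-∷ (forest φ) (here refl) ⟩
    ind (v Fin.≟ v) + ind (lastOf v path Fin.≟ v) ≤⟨ ℕ.+-mono-≤ (ind≤1 (v Fin.≟ v)) (ind≤1 (lastOf v path Fin.≟ v)) ⟩
    2 ∎
    where
    open Pulled (pull [] qs v∈)
    open ℕ.≤-Reasoning
    δ = λ e → ind (e Fin.≟ v)

concat-singletons : ∀ {A : Set} (l : List A) → concat (map [_] l) ≡ l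
concat-singletons []      = refl
concat-singletons (x ∷ l) = cong (λ z → x ∷ z) (concat-singletons l)

-- Vertices off the given paths become one-vertex paths. A forest on n vertices with e edges has n -
-- e paths, hence 2n - 2e ends.
initial-forest : ∀ {n} (G : Graph (Fin n)) ps → All (IsPath G) ps → AllPairs (Disjoint on toList) ps →
  ∃ λ qs → Forest G (edges ps) qs × endSum (λ _ → 1) qs + 2 * length (edges ps) ≡ 2 * n
initial-forest {n} G ps paths disj = qs , record
  { spans    = span
  ; links    = All.++⁺ (All.map⁺ (All.map proj₂ paths)) (All.map⁺ (All.tabulate λ _ → [-]))
  ; contains = λ e → Any.++⁺ˡ (covers ps e)
  } , trans (count ps missing) (cong (2 *_) (trans (cong length (sym concat≡)) (spanning-length span)))
  where
  open import Data.List.Membership.DecPropositional (Fin._≟_ {n}) using (_∈?_)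
  covered = concat (map toList ps)
  missing = filter (λ v → ¬? (v ∈? covered)) (allFin n)
  qs = map toList ps ++ map [_] missing
  concat≡ : concat qs ≡ covered ++ missing
  concat≡ = trans (sym (List.concat-++ (map toList ps) (map [_] missing)))
    (cong (λ z → covered ++ z) (concat-singletons missing))
  all : ∀ v → v ∈ covered ++ missing
  all v with v ∈? covered
  ... | yes v∈ = ∈.∈-++⁺ˡ v∈
  ... | no v∉  = ∈.∈-++⁺ʳ covered (∈.∈-filter⁺ (λ v → ¬? (v ∈? covered)) (∈.∈-allFin v) v∉)
  span : Spanning (concat qs)
  span = subst Spanning (sym concat≡) (spanning
    (Unique.++⁺ (Unique.concat⁺ (All.map⁺ (All.map proj₁ paths)) (AllPairs.map⁺ disj))
      (Unique.filter⁺ (λ v → ¬? (v ∈? covered)) (Unique.allFin⁺ n))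
      (λ (i , j) → proj₂ (∈.∈-filter⁻ (λ v → ¬? (v ∈? covered)) {xs = allFin n} j) i))
    all)
  covers : ∀ ps {a b} → (a , b) ∈ edges ps → Any (λ q → Neigh q a b) (map toList ps)
  covers (p ∷ ps) e with ∈.∈-++⁻ (steps (toList p)) e
  ... | inj₁ i = here (inj₁ i)
  ... | inj₂ i = there (covers ps i)
  singles : ∀ (l : List (Fin n)) → endSum (λ _ → 1) (map [_] l) ≡ 2 * length l
  singles []      = refl
  singles (x ∷ l) = trans (cong (λ z → 2 + z) (singles l)) (sym (ℕ.*-suc 2 (length l)))
  count : ∀ ps (l : List (Fin n)) → endSum (λ _ → 1) (map toList ps ++ map [_] l) + 2 * length (edges ps)
          ≡ 2 * length (concat (map toList ps) ++ l)
  count []             l = trans (ℕ.+-identityʳ _) (singles l)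
  count ((x ∷ p) ∷ ps) l = begin
    2 + e + 2 * length (steps (x ∷ p) ++ edges ps)
      ≡⟨ cong (λ z → 2 + e + 2 * z) (trans (List.length-++ (steps (x ∷ p)))
           (cong (λ z → z + length (edges ps)) (length-steps x p))) ⟩
    2 + e + 2 * (length p + length (edges ps))
      ≡⟨ arith e (length p) (length (edges ps)) ⟩
    2 * (1 + length p) + (e + 2 * length (edges ps))
      ≡⟨ cong (λ z → 2 * (1 + length p) + z) (count ps l) ⟩
    2 * (1 + length p) + 2 * length (concat (map toList ps) ++ l)
      ≡⟨ ℕ.*-distribˡ-+ 2 (1 + length p) _ ⟨
    2 * (1 + length p + length (concat (map toList ps) ++ l))
      ≡⟨ cong (2 *_) (trans (cong suc (sym (List.length-++ p)))
           (cong length (sym (List.++-assoc (x ∷ p) (concat (map toList ps)) l)))) ⟩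
    2 * length (((x ∷ p) ++ concat (map toList ps)) ++ l) ∎
    where
    open ≡-Reasoning
    e = endSum (λ _ → 1) (map toList ps ++ map [_] l)
    arith : ∀ e p m → 2 + e + 2 * (p + m) ≡ 2 * (1 + p) + (e + 2 * m)
    arith = solve-∀

-- Ends in the clique: concatenating paths and absorbing ends of X

module _ {n : ℕ} (G : Graph (Fin n)) {F : List (Edge n)} {X : Fin n → Set} (X? : ∀ v → Dec (X v))
         (clique : ∀ {u v} → ¬ X u → ¬ X v → u ≢ v → Adj G u v) where

  endsIn : List (List (Fin n)) → ℕ
  endsIn = endSum (λ v → ind (X? v))

  -- The claim on the ends of the concatenation is what carries the induction: the next path is
  -- linked to the first vertex of the remainder, which must be known to lie in the clique.
  concat-linked : ∀ qs → All (Linked (Adj G)) qs → Unique (concat qs) → (∀ {e} → e ∈ allEnds qs → ¬ X e) →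
    Linked (Adj G) (concat qs) × (∀ {e} → e ∈ ends (concat qs) → ¬ X e)
  concat-linked []       []       u h = [] , λ ()
  concat-linked ([] ∷ qs) (_ ∷ ls) u h = concat-linked qs ls u h
  concat-linked ((x ∷ t) ∷ qs) (l ∷ ls) u h =
    glue (concat qs) u (concat-linked qs ls (drop-unique (x ∷ t) u) (λ e∈ → h (there (there e∈))))
    where
    drop-unique : ∀ k {m : List (Fin n)} → Unique (k ++ m) → Unique m
    drop-unique []      u       = u
    drop-unique (_ ∷ k) (_ ∷ u) = drop-unique k u
    glue : ∀ m → Unique ((x ∷ t) ++ m) → Linked (Adj G) m × (∀ {e} → e ∈ ends m → ¬ X e) →
      Linked (Adj G) ((x ∷ t) ++ m) × (∀ {e} → e ∈ ends ((x ∷ t) ++ m) → ¬ X e)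
    glue []      u _ rewrite List.++-identityʳ t = l , λ where
      (here refl)         → h (here refl)
      (there (here refl)) → h (there (here refl))
    glue (y ∷ m) u (l′ , h′) = ⇒linked _ link , λ where
        (here refl)         → h (here refl)
        (there (here refl)) → subst (λ z → ¬ X z) (sym (lastOf-++ x t)) (h′ (there (here refl)))
      where
      link : ∀ {a b} → Consec ((x ∷ t) ++ y ∷ m) a b → Adj G a b
      link c with consec-++⁻ x t c
      ... | inj₁ d                    = linked⇒ l d
      ... | inj₂ (inj₂ d)             = linked⇒ l′ d
      ... | inj₂ (inj₁ (refl , refl)) = clique (h (there (here refl))) (h′ (here refl))
              (unique-++-≢ (x ∷ t) u (lastOf-∈ x t) (here refl))

  close-up : ∀ qs → Forest G F qs → 3 ≤ n → (∀ {e} → e ∈ allEnds qs → ¬ X e) →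
    ∃ λ c → IsHamiltonCycle G c × (∀ {a b} → (a , b) ∈ F → Neigh (closeUp c) a b)
  close-up qs φ 3≤n h = go (concat qs) refl (concat-linked qs (links φ) (spanning-unique (spans φ)) h)
    where
    go : ∀ l → concat qs ≡ l → Linked (Adj G) (concat qs) × (∀ {e} → e ∈ ends (concat qs) → ¬ X e) →
      ∃ λ c → IsHamiltonCycle G c × (∀ {a b} → (a , b) ∈ F → Neigh (closeUp c) a b)
    go l eq _ with subst (λ z → 3 ≤ z) (trans (sym (spanning-length (spans φ))) (cong length eq)) 3≤n
    go (x ∷ [])    eq _       | s≤s ()
    go (x ∷ y ∷ l) eq (k , e) | 3≤ rewrite eq = (x ∷ y ∷ l)
      , (3≤ , uniq , spanning-∈ sp , ⇒linked _ link)
      , λ f → neigh-++ˡ (x ∷ y ∷ l) (subst (λ z → Neigh z _ _) eq (neigh-concat (contains φ f)))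
      where
      sp : Spanning (x ∷ y ∷ l)
      sp = subst Spanning eq (spans φ)
      uniq = spanning-unique sp
      link : ∀ {a b} → Consec (x ∷ y ∷ l ∷ʳ x) a b → Adj G a b
      link c with consec-++⁻ x (y ∷ l) c
      ... | inj₁ d                    = linked⇒ k d
      ... | inj₂ (inj₁ (refl , refl)) = clique (e (there (here refl))) (e (here refl))
              (λ eq → unique-∉ uniq (subst (λ z → z ∈ y ∷ l) eq (lastOf-∈ y l)))
      ... | inj₂ (inj₂ ())

  endsIn≡0 : ∀ {qs} → endsIn qs ≡ 0 → ∀ {e} → e ∈ allEnds qs → ¬ X e
  endsIn≡0 eq {e} e∈ Xe = contradiction (ℕ.≤-trans (f≤Σˡf (λ v → ind (X? v)) e∈) (ℕ.≤-reflexive eq))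
    (ℕ.<⇒≱ (ℕ.≤-reflexive (sym (ind-yes (X? e) Xe))))

  module _ {Y : Fin n → Set} (Y? : ∀ v → Dec (Y v)) (Y∩X : ∀ {v} → Y v → ¬ X v)
           (X-Y : ∀ {x y} → X x → Y y → Adj G x y) where

    endsInY : List (List (Fin n)) → ℕ
    endsInY = endSum (λ v → ind (Y? v))

    -- While more ends lie in Y than in X, an end in X can always be joined to an end in Y
    -- of another path: the path of that X-end has only one further end.
    absorb : ∀ fuel qs → length qs ≤ fuel → Forest G F qs → endsIn qs < endsInY qs →
      ∃ λ qs′ → Forest G F qs′ × endsIn qs′ ≡ 0
    absorb fuel qs len φ lt with endsIn qs in eq
    ... | zero  = qs , φ , eq
    ... | suc d with 0<Σˡ (λ v → ind (X? v)) (allEnds qs) (subst (λ z → 0 < z) (sym eq) (s≤s z≤n))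
    ... | x , x∈ , 0<Xx with 0<Σˡ (λ v → ind (Y? v)) (allEnds rest) 0<rest
      where
      open Pulled (pull {G = G} {F = F} [] qs x∈)
      y = λ v → ind (Y? v)
      z = lastOf x path
      0<rest : 0 < endSum y rest
      0<rest = ℕ.+-cancelˡ-≤ 1 1 (endSum y rest) (begin
        2 ≤⟨ ℕ.≤-trans (s≤s (s≤s z≤n)) lt ⟩
        endSum y qs ≡⟨ sums y ⟩
        y x + (y z + 0) + endSum y rest ≡⟨ cong (λ w → w + (y z + 0) + endSum y rest)
                                                     (ind-no (Y? x) λ Yx → Y∩X Yx (0<ind (X? x) 0<Xx)) ⟩
        (y z + 0) + endSum y rest ≤⟨ ℕ.+-monoˡ-≤ (endSum y rest)
                                                     (ℕ.≤-trans (ℕ.≤-reflexive (ℕ.+-identityʳ (y z))) (ind≤1 (Y? z))) ⟩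
        1 + endSum y rest ∎)
        where open ℕ.≤-Reasoning
    absorb zero    [] len φ lt | suc d | x , () , _ | _
    absorb (suc m) qs len φ lt | suc d | x , x∈ , 0<Xx | y , y∈ , 0<Yy =
      absorb m qs′ len′ (proj₁ (proj₂ joined)) lt′
      where
      Xx = 0<ind (X? x) 0<Xx
      Yy = 0<ind (Y? y) 0<Yy
      P = pull {G = G} {F = F} [] qs x∈
      module P = Pulled P
      Q = pull {G = G} {F = F} [ x ∷ P.path ] P.rest y∈
      module Q = Pulled Q
      joined : ∃ λ p → Forest G F (p ∷ Q.rest) × ends p ≡ lastOf y Q.path ∷ lastOf x P.path ∷ []
      joined = join (X-Y Xx Yy) (Q.forest (P.forest φ))
      qs′ = proj₁ joined ∷ Q.rest
      len′ : length qs′ ≤ m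
      len′ = ℕ.s≤s⁻¹ (ℕ.≤-trans (ℕ.≤-reflexive (sym (trans P.size (cong suc Q.size)))) len)
      balance : ∀ f → endSum f qs ≡ f x + f y + endSum f qs′
      balance = join-endSum P Q {proj₁ joined} (proj₂ (proj₂ joined))
      lt′ : endsIn qs′ < endsInY qs′
      lt′ = ℕ.+-cancelˡ-< 1 (endsIn qs′) (endsInY qs′) (subst₂ _<_
        (trans (sym eq) (trans (balance (λ v → ind (X? v))) (cong₂ (λ a b → a + b + endsIn qs′)
          (ind-yes (X? x) Xx) (ind-no (X? y) (Y∩X Yy)))))
        (trans (balance (λ v → ind (Y? v))) (cong₂ (λ a b → a + b + endsInY qs′)
          (ind-no (Y? x) λ Yx → Y∩X Yx Xx) (ind-yes (Y? y) Yy)))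
        lt)

-- Joining ends inside X and counting what remains

0<∑ : ∀ {n} (f : Fin n → ℕ) → 0 < ∑ f → ∃ λ i → 0 < f i
0<∑ {suc n} f p with f zero in eq
... | suc _ = zero , subst (λ z → 0 < z) (sym eq) (s≤s z≤n)
... | zero with 0<∑ (f ∘ suc) p
... | i , q = suc i , q

module _ {n : ℕ} (G : Graph (Fin n)) {F : List (Edge n)} {X : Fin n → Set} (X? : ∀ v → Dec (X v))
         {Y : Fin n → Set} (Y? : ∀ v → Dec (Y v)) (Y∩X : ∀ {v} → Y v → ¬ X v) where

  private
    𝟙X 𝟙Y : Fin n → ℕ
    𝟙X v = ind (X? v)
    𝟙Y v = ind (Y? v)

  Homogeneous : List (Fin n) → Set
  Homogeneous es = All X es ⊎ All (¬_ ∘ X) es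

  -- The invariant for the case that all of `X` starts as one-vertex paths. Either every vertex of
  -- `X` is still an end, or a join inside `X` has left some `h` that is an end exactly once.
  -- Homogeneity guarantees that a join at ends in `X` leaves two ends in `X`.
  Marked : List (List (Fin n)) → Set
  Marked qs = All (Homogeneous ∘ ends) qs ×
    ((∀ v → X v → 1 ≤ ε qs v) ⊎ ∃ λ h → X h × ε qs h ≡ 1)

  -- Only ends in `rest` are excluded: the other end of the path of `x` may be a neighbour of `x`,
  -- but joining them would close a cycle.
  StuckAt : List (List (Fin n)) → Fin n → Set
  StuckAt qs x = X x → x ∈ allEnds qs → ∃₂ λ t rest → Forest G F ((x ∷ t) ∷ rest) ×
    (∀ f → endSum f qs ≡ endSum f ((x ∷ t) ∷ rest)) × (∀ w → X w → Adj G x w → w ∉ allEnds rest)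

  Stuck : List (List (Fin n)) → Set
  Stuck qs = ∀ x → StuckAt qs x

  homogeneous-reverse : ∀ {q : List (Fin n)} → Homogeneous (ends q) → Homogeneous (ends (reverse q))
  homogeneous-reverse {q} (inj₁ h) = inj₁ (↭.All-resp-↭ (↭-sym (ends-reverse q)) h)
  homogeneous-reverse {q} (inj₂ h) = inj₂ (↭.All-resp-↭ (↭-sym (ends-reverse q)) h)

  -- `A` will be the statement that the initial forest has fewer than `2 * s` ends in `X`; as it
  -- does not mention the current forest, it persists. The number of ends in `Y` is unchanged
  -- because both joined ends lie in `X`.
  saturate-step : ∀ {A : Set} qs → Forest G F qs → A ⊎ Marked qs →
    (∃ λ qs′ → Forest G F qs′ × length qs′ < length qs × (A ⊎ Marked qs′) × endSum 𝟙Y qs′ ≡ endSum 𝟙Y qs)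
    ⊎ Stuck qs
  saturate-step {A} qs φ good with ∀⊎ try
    where
    Better : Set
    Better = ∃ λ qs′ → Forest G F qs′ × length qs′ < length qs × (A ⊎ Marked qs′) × endSum 𝟙Y qs′ ≡ endSum 𝟙Y qs
    try : ∀ x → Better ⊎ StuckAt qs x
    try x with X? x | Any.any? (x Fin.≟_) (allEnds qs)
    ... | no ¬Xx | _      = inj₂ λ Xx → contradiction Xx ¬Xx
    ... | yes _  | no x∉  = inj₂ λ _ x∈ → contradiction x∈ x∉
    ... | yes Xx | yes x∈ with ∀⊎ second
      where
      P = pull {G = G} {F = F} [] qs x∈
      module P = Pulled P
      second : ∀ w → Better ⊎ (X w → Adj G x w → w ∉ allEnds P.rest)
      second w with X? w | adj? G x w | Any.any? (w Fin.≟_) (allEnds P.rest)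
      ... | no ¬Xw | _       | _      = inj₂ λ Xw → contradiction Xw ¬Xw
      ... | yes _  | no x≁w  | _      = inj₂ λ _ x~w → contradiction x~w x≁w
      ... | yes _  | yes _   | no w∉  = inj₂ λ _ _ → w∉
      ... | yes Xw | yes x~w | yes w∈ = inj₁ (p ∷ Q.rest , ψ , len , marked good , y-sum)
        where
        Q = pull {G = G} {F = F} [ x ∷ P.path ] P.rest w∈
        module Q = Pulled Q
        pair : Forest G F ((w ∷ Q.path) ∷ (x ∷ P.path) ∷ Q.rest)
        pair = Q.forest (P.forest φ)
        joined : ∃ λ p → Forest G F (p ∷ Q.rest) × ends p ≡ lastOf w Q.path ∷ lastOf x P.path ∷ []
        joined = join x~w pair
        p = proj₁ joined
        ψ = proj₁ (proj₂ joined)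
        ends-p = proj₂ (proj₂ joined)
        a b : Fin n
        a = lastOf w Q.path
        b = lastOf x P.path
        len : length (p ∷ Q.rest) < length qs
        len = ℕ.≤-reflexive (sym (trans P.size (cong suc Q.size)))
        y-sum : endSum 𝟙Y (p ∷ Q.rest) ≡ endSum 𝟙Y qs
        y-sum = sym (trans (join-endSum P Q {p} ends-p 𝟙Y) (cong₂ (λ c d → c + d + endSum 𝟙Y (p ∷ Q.rest))
          (ind-no (Y? x) λ Yx → Y∩X Yx Xx) (ind-no (Y? w) λ Yw → Y∩X Yw Xw)))
        marked : A ⊎ Marked qs → A ⊎ Marked (p ∷ Q.rest)
        marked (inj₁ z)       = inj₁ z
        -- By homogeneity both far ends `a` and `b` lie in `X`. They come from disjoint paths, hence
        -- differ, and `a` is an end exactly once.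
        marked (inj₂ (hs , _)) = inj₂ (inj₁ (subst (All X) (sym ends-p) (Xa ∷ Xb ∷ [])) ∷ All.tail ws
                                      , inj₂ (a , Xa , ε-a))
          where
          xs : All (Homogeneous ∘ ends) ((x ∷ P.path) ∷ P.rest)
          xs = P.preserves {Homogeneous} (λ {q} → homogeneous-reverse {q}) hs
          ws : All (Homogeneous ∘ ends) ((w ∷ Q.path) ∷ Q.rest)
          ws = Q.preserves {Homogeneous} (λ {q} → homogeneous-reverse {q}) (All.tail xs)
          other : ∀ {u} t → X u → Homogeneous (ends (u ∷ t)) → X (lastOf u t)
          other t Xu (inj₁ (_ ∷ Xl ∷ [])) = Xl
          other t Xu (inj₂ (¬Xu ∷ _))     = contradiction Xu ¬Xu
          Xa : X a
          Xa = other Q.path Xw (All.head ws)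
          Xb : X b
          Xb = other P.path Xx (All.head xs)
          δ : Fin n → ℕ
          δ e = ind (e Fin.≟ a)
          a∈p : a ∈ p
          a∈p = ends-⊆ p (subst (λ z → a ∈ z) (sym ends-p) (here refl))
          a≢b : a ≢ b
          a≢b = unique-++-≢ (w ∷ Q.path) (spanning-unique (spans pair)) (lastOf-∈ w Q.path)
                  (∈.∈-++⁺ˡ (lastOf-∈ x P.path))
          ε-a : ε (p ∷ Q.rest) a ≡ 1
          ε-a = begin
            ε (p ∷ Q.rest) a ≡⟨ endSum-∷ δ p Q.rest ⟩
            Σˡ δ (ends p) + ε Q.rest a ≡⟨ cong₂ _+_ (cong (Σˡ δ) ends-p)
                                                       (∉⇒ε≡0 {qs = Q.rest} (forest-disjoint ψ a∈p)) ⟩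
            δ a + (δ b + 0) + 0 ≡⟨ cong₂ (λ c d → c + (d + 0) + 0)
                                                       (ind-yes (a Fin.≟ a) refl) (ind-no (b Fin.≟ a) (a≢b ∘ sym)) ⟩
            1 ∎
            where open ≡-Reasoning
    ... | inj₁ better = inj₁ better
    ... | inj₂ stuck  = inj₂ λ _ _ → P.path , P.rest , P.forest φ
            , (λ f → trans (P.sums f) (sym (endSum-∷ f (x ∷ P.path) P.rest))) , stuck
      where module P = Pulled (pull {G = G} {F = F} [] qs x∈)
  ... | inj₁ better = inj₁ better
  ... | inj₂ stuck  = inj₂ stuck

  saturate : ∀ {A : Set} fuel qs → length qs ≤ fuel → Forest G F qs → A ⊎ Marked qs →
    ∃ λ qs′ → Forest G F qs′ × (A ⊎ Marked qs′) × endSum 𝟙Y qs′ ≡ endSum 𝟙Y qs × Stuck qs′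
  saturate fuel qs len φ good with saturate-step qs φ good
  ... | inj₂ stuck = qs , φ , good , refl , stuck
  saturate zero    []  len φ good | inj₁ (_ , _ , () , _)
  saturate (suc m) qs len φ good | inj₁ (qs′ , φ′ , lt , good′ , y-sum)
    with saturate m qs′ (ℕ.s≤s⁻¹ (ℕ.≤-trans lt len)) φ′ good′
  ... | qs″ , φ″ , good″ , y-sum′ , stuck = qs″ , φ″ , good″ , trans y-sum′ y-sum , stuck

  module _ {s r : ℕ} (∣X∣ : ∑ 𝟙X ≡ s) (regular : ∀ {x} → X x → ∑ (λ w → 𝟙X w * adj G x w) ≡ r)
           (1≤r : 1 ≤ r) (r+2≤s : r + 2 ≤ s) where

    endSum-X≤ : ∀ {qs} → Forest G F qs → endSum 𝟙X qs ≤ 2 * s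
    endSum-X≤ {qs} φ = begin
      endSum 𝟙X qs ≡⟨ endSum-ε 𝟙X qs ⟩
      ∑ (λ v → ε qs v * 𝟙X v) ≤⟨ ∑-mono (λ v → ℕ.*-monoˡ-≤ (𝟙X v) (ε≤2 φ v)) ⟩
      ∑ (λ v → 2 * 𝟙X v) ≡⟨ ∑-scale 2 𝟙X ∣X∣ ⟩
      2 * s ∎
      where open ℕ.≤-Reasoning

    -- An end of a path with more than one vertex is counted once. If all vertices of `X` are
    -- counted twice, each is thus a path by itself, and longer paths end outside `X`.
    initially-marked : ∀ {qs} → Forest G F qs → endSum 𝟙X qs < 2 * s ⊎ Marked qs
    initially-marked {qs} φ with Fin.any? (λ v → X? v ×-dec (ε qs v ℕ.<? 2))
    ... | yes (v , Xv , lt) = inj₁ (begin-strict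
      endSum 𝟙X qs ≡⟨ endSum-ε 𝟙X qs ⟩
      ∑ (λ v → ε qs v * 𝟙X v) <⟨ ∑-mono-< (λ v → ℕ.*-monoˡ-≤ (𝟙X v) (ε≤2 φ v)) v
                                      (subst (λ z → ε qs v * z < 2 * z) (sym (ind-yes (X? v) Xv))
                                        (ℕ.*-monoˡ-< 1 lt)) ⟩
      ∑ (λ v → 2 * 𝟙X v) ≡⟨ ∑-scale 2 𝟙X ∣X∣ ⟩
      2 * s ∎)
      where open ℕ.≤-Reasoning
    ... | no none = inj₂ (All.tabulate homogeneous , inj₁ λ v Xv → ℕ.≤-trans (s≤s z≤n) (double v Xv))
      where
      double : ∀ v → X v → 2 ≤ ε qs v
      double v Xv = ℕ.≮⇒≥ λ lt → none (v , Xv , lt)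
      homogeneous : ∀ {q} → q ∈ qs → Homogeneous (ends q)
      homogeneous {[]}        q∈ = inj₂ []
      homogeneous {x ∷ []}    q∈ with X? x
      ... | yes Xx = inj₁ (Xx ∷ Xx ∷ [])
      ... | no ¬Xx = inj₂ (¬Xx ∷ ¬Xx ∷ [])
      homogeneous {x ∷ y ∷ t} q∈ with ∈.∈-∃++ q∈
      ... | as , bs , refl = inj₂ (single (here refl) (ℕ.≤-reflexive (cong₂ _+_ (ind-yes (x Fin.≟ x) refl)
                                    (ind-no (l Fin.≟ x) (l≢x))))
                                 ∷ single (lastOf-∈ x (y ∷ t)) (ℕ.≤-reflexive (cong₂ _+_ (ind-no (x Fin.≟ l) (l≢x ∘ sym))
                                    (ind-yes (l Fin.≟ l) refl)))
                                 ∷ [])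
        where
        l = lastOf y t
        ψ : Forest G F ((x ∷ y ∷ t) ∷ as ++ bs)
        ψ = forest-front as (x ∷ y ∷ t) bs φ
        l≢x : l ≢ x
        l≢x eq = unique-++-≢ [ x ] (spanning-unique (spans ψ)) (here refl)
          (∈.∈-++⁺ˡ (lastOf-∈ y t)) (sym eq)
        single : ∀ {v} → v ∈ x ∷ y ∷ t → ind (x Fin.≟ v) + ind (l Fin.≟ v) ≤ 1 → ¬ X v
        single {v} v∈ le Xv = ℕ.<⇒≱ (s≤s le) (ℕ.≤-trans (double v Xv) (ℕ.≤-reflexive
          (trans (endSum-front (λ e → ind (e Fin.≟ v)) as (x ∷ y ∷ t) bs) (ε-∷ ψ v∈))))

    -- `D` stands for the number of ends in `X` before saturation. With E and R ends in `X` and `Y`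
    -- afterwards, `bound` reduces the claim E < R to E + 1 + 2r + D ≤ 4s, which is `main`; the
    -- cases depend on whether `X` still contains a one-vertex path.
    stuck-count : ∀ {D qs} → Forest G F qs → D ≤ 2 * s → D < 2 * s ⊎ Marked qs → Stuck qs →
      4 * s ≤ endSum 𝟙Y qs + D + 2 * r → endSum 𝟙X qs ≡ 0 ⊎ endSum 𝟙X qs < endSum 𝟙Y qs
    stuck-count {D} {qs} φ D≤2s good stuck bound with endSum 𝟙X qs in eq
    ... | zero  = inj₁ refl
    ... | suc d = inj₂ (subst (λ z → z < endSum 𝟙Y qs) eq (conclude main))
      where
      E = endSum 𝟙X qs
      R = endSum 𝟙Y qs
      conclude : suc E + 2 * r + D ≤ 4 * s → E < R
      conclude le = ℕ.+-cancelʳ-≤ (2 * r + D) (suc E) R (begin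
        suc E + (2 * r + D) ≡⟨ ℕ.+-assoc (suc E) (2 * r) D ⟨
        suc E + 2 * r + D ≤⟨ ℕ.≤-trans le bound ⟩
        R + D + 2 * r ≡⟨ arith R D (2 * r) ⟩
        R + (2 * r + D) ∎)
        where
        open ℕ.≤-Reasoning
        arith : ∀ a b c → a + b + c ≡ a + (c + b)
        arith = solve-∀
      4s≡ : 2 * s + 2 * s ≡ 4 * s
      4s≡ = sym (ℕ.*-distribʳ-+ s 2 2)
      E≡ : E ≡ ∑ (λ v → ε qs v * 𝟙X v)
      E≡ = endSum-ε 𝟙X qs

      module _ {x} (Xx : X x) where
        nb : Fin n → ℕ
        nb w = 𝟙X w * adj G x w
        -- The neighbours of x in X that are still ends are among the exceptional vertices counted by z.
        pointwise : ∀ c (z : Fin n → ℕ) → (∀ w → X w → ε qs w ≤ c + z w) →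
          (∀ w → X w → Adj G x w → ε qs w + 1 ≤ c + z w) →
          ∀ w → ε qs w * 𝟙X w + nb w ≤ c * 𝟙X w + z w
        pointwise c z far near w with X? w | adj? G x w
        ... | no _   | _       = ℕ.≤-trans (ℕ.≤-reflexive (trans (ℕ.+-identityʳ _) (ℕ.*-zeroʳ (ε qs w)))) z≤n
        ... | yes Xw | no _    = subst₂ _≤_ (sym (trans (ℕ.+-identityʳ _) (ℕ.*-identityʳ _)))
                                   (cong (λ a → a + z w) (sym (ℕ.*-identityʳ c))) (far w Xw)
        ... | yes Xw | yes x~w = subst₂ _≤_ (cong (λ a → a + 1) (sym (ℕ.*-identityʳ _)))
                                   (cong (λ a → a + z w) (sym (ℕ.*-identityʳ c))) (near w Xw x~w)

      -- Of the `s` vertices of `X`, the `r` neighbours of `x` are no longer ends, except perhaps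
      -- the other end of the path of `x`. That exception is the 1 on the right.
      single-end : ∀ {x} → X x → x ∈ allEnds qs → (∀ w → X w → ε qs w ≤ 1) → E + r ≤ s + 1
      single-end {x} Xx x∈ ≤1 with stuck x Xx x∈
      ... | t , rest , ψ , sums , no-end = begin
        E + r
          ≡⟨ cong₂ _+_ E≡ (sym (regular Xx)) ⟩
        ∑ (λ w → ε qs w * 𝟙X w) + ∑ (nb Xx)
          ≡⟨ ∑-distrib-+ (λ w → ε qs w * 𝟙X w) (nb Xx) ⟨
        ∑ (λ w → ε qs w * 𝟙X w + nb Xx w)
          ≤⟨ ∑-mono (pointwise Xx 1 (λ w → ind (w Fin.≟ z)) (λ w Xw → ℕ.m≤n⇒m≤n+o _ (≤1 w Xw)) near) ⟩
        ∑ (λ w → 1 * 𝟙X w + ind (w Fin.≟ z))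
          ≡⟨ ∑-distrib-+ (λ w → 1 * 𝟙X w) (λ w → ind (w Fin.≟ z)) ⟩
        ∑ (λ w → 1 * 𝟙X w) + ∑ (λ w → ind (w Fin.≟ z))
          ≡⟨ cong₂ _+_ (trans (sum-cong-≗ λ w → ℕ.*-identityˡ (𝟙X w)) ∣X∣) (∑-δ₁ z) ⟩
        s + 1 ∎
        where
        open ℕ.≤-Reasoning
        z = lastOf x t
        near : ∀ w → X w → Adj G x w → ε qs w + 1 ≤ 1 + ind (w Fin.≟ z)
        near w Xw x~w with w Fin.≟ z
        ... | yes _  = ℕ.+-monoˡ-≤ 1 (≤1 w Xw)
        ... | no w≢z = ℕ.≤-reflexive (cong (λ a → a + 1) (trans (sums (λ e → ind (e Fin.≟ w)))
              (∉⇒ε≡0 {qs = (x ∷ t) ∷ rest} λ where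
                (here refl)         → adj-irrefl G x~w
                (there (here refl)) → w≢z refl
                (there (there i))   → no-end w Xw x~w i)))

      -- Being counted twice, `x` is a path by itself, so no neighbour is excused as the other end
      -- of that path.
      double-end : ∀ {x} → X x → 2 ≤ ε qs x → ∀ {w} → X w → Adj G x w → ε qs w ≡ 0
      double-end {x} Xx 2≤ε {w} Xw x~w with Any.any? (x Fin.≟_) (allEnds qs)
      ... | no x∉ = contradiction (subst (λ z → 2 ≤ z) (∉⇒ε≡0 {qs = qs} x∉) 2≤ε) λ ()
      ... | yes x∈ with stuck x Xx x∈
      ... | [] , rest , ψ , sums , no-end = trans (sums (λ e → ind (e Fin.≟ w)))
              (∉⇒ε≡0 {qs = [ x ] ∷ rest} λ where
                (here refl)         → adj-irrefl G x~w
                (there (here refl)) → adj-irrefl G x~w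
                (there (there i))   → no-end w Xw x~w i)
      ... | y ∷ t , rest , ψ , sums , no-end = contradiction 2≤ε (ℕ.<⇒≱ (s≤s (ℕ.≤-reflexive
              (trans (sums (λ e → ind (e Fin.≟ x))) (trans (ε-∷ ψ (here refl))
                (cong₂ _+_ (ind-yes (x Fin.≟ x) refl) (ind-no (lastOf y t Fin.≟ x) λ eq →
                  unique-++-≢ [ x ] (spanning-unique (spans ψ)) (here refl) (∈.∈-++⁺ˡ (lastOf-∈ y t)) (sym eq))))))))

      -- `z` records a further deficit at vertices of `X` not adjacent to `x`. It is zero or the
      -- indicator of the marked vertex `h`.
      double-count : ∀ {x} → X x → 2 ≤ ε qs x → ∀ (z : Fin n → ℕ) → (∀ w → X w → ε qs w + z w ≤ 2) →
        (∀ w → X w → Adj G x w → z w ≡ 0) → (∀ w → ¬ X w → z w ≡ 0) → E + 2 * r + ∑ z ≤ 2 * s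
      double-count {x} Xx 2≤ε z far near off = begin
        E + 2 * r + ∑ z
          ≡⟨ cong₂ (λ a b → a + b + ∑ z) E≡ (trans (cong (2 *_) (sym (regular Xx))) (*-distribˡ-sum 2 (nb Xx))) ⟩
        ∑ (λ w → ε qs w * 𝟙X w) + ∑ (λ w → 2 * nb Xx w) + ∑ z
          ≡⟨ cong (λ a → a + ∑ z) (∑-distrib-+ (λ w → ε qs w * 𝟙X w) (λ w → 2 * nb Xx w)) ⟨
        ∑ (λ w → ε qs w * 𝟙X w + 2 * nb Xx w) + ∑ z
          ≡⟨ ∑-distrib-+ (λ w → ε qs w * 𝟙X w + 2 * nb Xx w) z ⟨
        ∑ (λ w → ε qs w * 𝟙X w + 2 * nb Xx w + z w)
          ≤⟨ ∑-mono point ⟩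
        ∑ (λ w → 2 * 𝟙X w)
          ≡⟨ ∑-scale 2 𝟙X ∣X∣ ⟩
        2 * s ∎
        where
        open ℕ.≤-Reasoning
        point : ∀ w → ε qs w * 𝟙X w + 2 * nb Xx w + z w ≤ 2 * 𝟙X w
        point w with X? w | adj? G x w
        ... | no ¬Xw | _       = ℕ.≤-reflexive (cong₂ _+_ (trans (ℕ.+-identityʳ _) (ℕ.*-zeroʳ (ε qs w))) (off w ¬Xw))
        ... | yes Xw | no _    = subst (λ a → a + z w ≤ 2) (sym (trans (ℕ.+-identityʳ _) (ℕ.*-identityʳ _))) (far w Xw)
        ... | yes Xw | yes x~w = ℕ.≤-reflexive (cong₂ (λ a b → a * 1 + 2 + b) (double-end Xx 2≤ε Xw x~w) (near w Xw x~w))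

      main : suc E + 2 * r + D ≤ 4 * s
      main with Fin.any? (λ v → X? v ×-dec (2 ℕ.≤? ε qs v))
      -- Without one-vertex paths in `X` the bound E ≤ s + 1 - r suffices, since `r + 2 ≤ s`.
      ... | no none with 0<Σˡ 𝟙X (allEnds qs) (subst (λ z → 0 < z) (sym eq) (s≤s z≤n))
      ... | x , x∈ , 0<X = begin
        suc E + 2 * r + D ≤⟨ ℕ.+-monoʳ-≤ (suc E + 2 * r) D≤2s ⟩
        suc E + 2 * r + 2 * s ≡⟨ arith E r s ⟩
        (E + r) + (r + 1 + 2 * s) ≤⟨ ℕ.+-monoˡ-≤ _ (single-end (0<ind (X? x) 0<X) x∈ λ w Xw →
                                   ℕ.s≤s⁻¹ (ℕ.≰⇒> λ le → none (w , Xw , le))) ⟩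
        (s + 1) + (r + 1 + 2 * s) ≡⟨ arith′ s r ⟩
        (r + 2) + 3 * s ≤⟨ ℕ.+-monoˡ-≤ (3 * s) r+2≤s ⟩
        4 * s ∎
        where
        open ℕ.≤-Reasoning
        arith : ∀ e r s → suc e + 2 * r + 2 * s ≡ (e + r) + (r + 1 + 2 * s)
        arith = solve-∀
        arith′ : ∀ s r → (s + 1) + (r + 1 + 2 * s) ≡ (r + 2) + 3 * s
        arith′ = solve-∀
      main | yes (x , Xx , 2≤ε) = by-mark good
        where
        open ℕ.≤-Reasoning
        by-mark : D < 2 * s ⊎ Marked qs → suc E + 2 * r + D ≤ 4 * s
        by-mark (inj₁ lt) = begin
          suc E + 2 * r + D ≡⟨ arith E (2 * r) D ⟩
          (E + 2 * r + 0) + suc D ≤⟨ ℕ.+-mono-≤ (subst (λ z → E + 2 * r + z ≤ 2 * s) (∑-zero n)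
                                       (double-count Xx 2≤ε (λ _ → 0)
                                       (λ w _ → ℕ.≤-trans (ℕ.≤-reflexive (ℕ.+-identityʳ _)) (ε≤2 φ w)) (λ _ _ _ → refl) (λ _ _ → refl))) lt ⟩
          2 * s + 2 * s ≡⟨ 4s≡ ⟩
          4 * s ∎
          where
          arith : ∀ a b c → suc a + b + c ≡ (a + b + 0) + suc c
          arith = solve-∀
        -- Since `r` is positive, `x` has a neighbour in `X`, which is no longer an end.
        by-mark (inj₂ (_ , inj₁ no-full))
          with 0<∑ (nb Xx) (subst (λ z → 0 < z) (sym (regular Xx)) 1≤r)
        ... | w , 0<nb with X? w in Xw | adj? G x w in xw
        ... | yes Xw | yes x~w = contradiction (no-full w Xw) (ℕ.<⇒≱ (s≤s (ℕ.≤-reflexive (double-end Xx 2≤ε Xw x~w))))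
        -- `h` is an end once instead of twice and is not a neighbour of `x`, which supplies the
        -- missing unit.
        by-mark (inj₂ (_ , inj₂ (h , Xh , ε≡1))) = begin
          suc E + 2 * r + D ≤⟨ ℕ.+-monoʳ-≤ (suc E + 2 * r) D≤2s ⟩
          suc E + 2 * r + 2 * s ≡⟨ cong (λ z → z + 2 * s) (ℕ.+-comm 1 (E + 2 * r)) ⟩
          E + 2 * r + 1 + 2 * s ≤⟨ ℕ.+-monoˡ-≤ (2 * s) (subst (λ z → E + 2 * r + z ≤ 2 * s) (∑-δ₁ h)
                                     (double-count Xx 2≤ε (λ w → ind (w Fin.≟ h)) far near off)) ⟩
          2 * s + 2 * s ≡⟨ 4s≡ ⟩
          4 * s ∎
          where
          far : ∀ w → X w → ε qs w + ind (w Fin.≟ h) ≤ 2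
          far w Xw with w Fin.≟ h
          ... | yes refl = ℕ.≤-reflexive (cong (λ z → z + 1) ε≡1)
          ... | no _     = ℕ.≤-trans (ℕ.≤-reflexive (ℕ.+-identityʳ _)) (ε≤2 φ w)
          near : ∀ w → X w → Adj G x w → ind (w Fin.≟ h) ≡ 0
          near w Xw x~w = ind-no (w Fin.≟ h) λ { refl →
            contradiction (trans (sym ε≡1) (double-end Xx 2≤ε Xw x~w)) λ () }
          off : ∀ w → ¬ X w → ind (w Fin.≟ h) ≡ 0
          off w ¬Xw = ind-no (w Fin.≟ h) λ { refl → ¬Xw Xh }

-- Edge-Hamiltonicity of the complete and the regular case

complete-edgeHamiltonian : ∀ {n k} (G : Graph (Fin n)) → 3 ≤ n → (∀ {u v} → u ≢ v → Adj G u v) → EdgeHamiltonian k G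
complete-edgeHamiltonian G 3≤n complete ps paths disj _ with initial-forest G ps paths disj
... | qs , φ , _ with close-up G {X = λ _ → ⊥} (λ _ → no id) (λ _ _ → complete) qs φ 3≤n (λ _ → id)
... | c , ham , keep = c , ham , ⇒edges ps keep

module _ {n : ℕ} {X Y : Fin n → Set} (X? : ∀ v → Dec (X v)) (Y? : ∀ v → Dec (Y v)) (Y∩X : ∀ {v} → Y v → ¬ X v) where

  private
    Z? : ∀ v → Dec (¬ X v × ¬ Y v)
    Z? v = ¬? (X? v) ×-dec ¬? (Y? v)
    𝟙X 𝟙Y 𝟙Z : Fin n → ℕ
    𝟙X v = ind (X? v)
    𝟙Y v = ind (Y? v)
    𝟙Z v = ind (Z? v)

  partition : ∀ v → 1 ≡ 𝟙X v + 𝟙Y v + 𝟙Z v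
  partition v with X? v | Y? v
  ... | yes Xv | yes Yv = contradiction Xv (Y∩X Yv)
  ... | yes _  | no _   = refl
  ... | no _   | yes _  = refl
  ... | no _   | no _   = refl

  partition-∑ : n ≡ ∑ 𝟙X + ∑ 𝟙Y + ∑ 𝟙Z
  partition-∑ = begin
    n ≡⟨ trans (∑-const n 1) (ℕ.*-identityʳ n) ⟨
    ∑ (λ (v : Fin n) → 1) ≡⟨ sum-cong-≗ partition ⟩
    ∑ (λ v → 𝟙X v + 𝟙Y v + 𝟙Z v) ≡⟨ ∑-distrib-+ (λ v → 𝟙X v + 𝟙Y v) 𝟙Z ⟩
    ∑ (λ v → 𝟙X v + 𝟙Y v) + ∑ 𝟙Z ≡⟨ cong (λ z → z + ∑ 𝟙Z)
                                                                  (∑-distrib-+ 𝟙X 𝟙Y) ⟩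
    ∑ 𝟙X + ∑ 𝟙Y + ∑ 𝟙Z ∎
    where open ≡-Reasoning

  partition-endSum : ∀ qs → endSum (λ _ → 1) qs ≡
    endSum 𝟙X qs + endSum 𝟙Y qs + endSum 𝟙Z qs
  partition-endSum qs = begin
    Σˡ (λ _ → 1) l ≡⟨ Σˡ-cong l partition ⟩
    Σˡ (λ v → 𝟙X v + 𝟙Y v + 𝟙Z v) l ≡⟨ Σˡ-+ (λ v → 𝟙X v + 𝟙Y v) 𝟙Z l ⟩
    Σˡ (λ v → 𝟙X v + 𝟙Y v) l + Σˡ 𝟙Z l ≡⟨ cong (λ z → z + Σˡ 𝟙Z l)
                                                                          (Σˡ-+ 𝟙X 𝟙Y l) ⟩
    Σˡ 𝟙X l + Σˡ 𝟙Y l + Σˡ 𝟙Z l ∎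
    where
    open ≡-Reasoning
    l = allEnds qs

  module _ {G : Graph (Fin n)} {F : List (Edge n)} where

    -- At least 2n - 2k ends exist, and at most two for each vertex outside `X` and `Y`. This leaves
    -- 2(s + y - k) for `X` and `Y`, which is 4s - 2r because `y + r` is the common degree `k + s`.
    endSum-bound : ∀ {k s y r qs} → ∑ 𝟙X ≡ s → ∑ 𝟙Y ≡ y → y + r ≡ k + s →
      Forest G F qs → length F ≤ k → endSum (λ _ → 1) qs + 2 * length F ≡ 2 * n →
      4 * s ≤ endSum 𝟙Y qs + endSum 𝟙X qs + 2 * r
    endSum-bound {k} {s} {y} {r} {qs} ∣X∣ ∣Y∣ y+r≡k+s φ F≤k total =
      ℕ.+-cancelʳ-≤ (2 * z + 2 * k) (4 * s) (eY + eX + 2 * r) (begin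
        4 * s + (2 * z + 2 * k)
          ≡⟨ lhs s z k ⟩
        2 * (s + z) + 2 * (k + s)
          ≡⟨ cong (λ a → 2 * (s + z) + 2 * a) y+r≡k+s ⟨
        2 * (s + z) + 2 * (y + r)
          ≡⟨ mid s z y r ⟩
        2 * (s + y + z) + 2 * r
          ≡⟨ cong (λ a → 2 * a + 2 * r) (trans (cong₂ (λ a b → a + b + z) (sym ∣X∣) (sym ∣Y∣)) (sym partition-∑)) ⟩
        2 * n + 2 * r
          ≡⟨ cong (λ a → a + 2 * r) total ⟨
        endSum (λ _ → 1) qs + 2 * length F + 2 * r
          ≤⟨ ℕ.+-monoˡ-≤ (2 * r) (ℕ.+-mono-≤ (ℕ.≤-reflexive (partition-endSum qs)) (ℕ.*-monoʳ-≤ 2 F≤k)) ⟩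
        eX + eY + eZ + 2 * k + 2 * r
          ≤⟨ ℕ.+-monoˡ-≤ (2 * r) (ℕ.+-monoˡ-≤ (2 * k) (ℕ.+-monoʳ-≤ (eX + eY) eZ≤)) ⟩
        eX + eY + 2 * z + 2 * k + 2 * r
          ≡⟨ rhs eX eY z k r ⟩
        eY + eX + 2 * r + (2 * z + 2 * k) ∎)
      where
      open ℕ.≤-Reasoning
      z eX eY eZ : ℕ
      z = ∑ 𝟙Z
      eX = endSum 𝟙X qs
      eY = endSum 𝟙Y qs
      eZ = endSum 𝟙Z qs
      eZ≤ : eZ ≤ 2 * z
      eZ≤ = begin
        eZ ≡⟨ endSum-ε 𝟙Z qs ⟩
        ∑ (λ v → ε qs v * 𝟙Z v) ≤⟨ ∑-mono (λ v → ℕ.*-monoˡ-≤ (𝟙Z v) (ε≤2 φ v)) ⟩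
        ∑ (λ v → 2 * 𝟙Z v) ≡⟨ *-distribˡ-sum 2 𝟙Z ⟨
        2 * z ∎
      lhs : ∀ s z k → 4 * s + (2 * z + 2 * k) ≡ 2 * (s + z) + 2 * (k + s)
      lhs = solve-∀
      mid : ∀ s z y r → 2 * (s + z) + 2 * (y + r) ≡ 2 * (s + y + z) + 2 * r
      mid = solve-∀
      rhs : ∀ a b z k r → a + b + 2 * z + 2 * k + 2 * r ≡ b + a + 2 * r + (2 * z + 2 * k)
      rhs = solve-∀

  regular-edgeHamiltonian : ∀ {k s y r} (G : Graph (Fin n)) → 3 ≤ n →
    ∑ 𝟙X ≡ s → ∑ 𝟙Y ≡ y → y + r ≡ k + s → 1 ≤ r → r + 2 ≤ s →
    (∀ {x} → X x → ∑ (λ w → ind (X? w) * adj G x w) ≡ r) →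
    (∀ {u v} → ¬ X u → ¬ X v → u ≢ v → Adj G u v) → (∀ {x y} → X x → Y y → Adj G x y) →
    EdgeHamiltonian k G
  regular-edgeHamiltonian {k} {s} {y} {r} G 3≤n ∣X∣ ∣Y∣ y+r≡k+s 1≤r r+2≤s regular clique X-Y ps paths disj len
    with initial-forest G ps paths disj
  ... | qs , φ , total
    with saturate G X? Y? Y∩X (length qs) qs ℕ.≤-refl φ (initially-marked G X? Y? Y∩X ∣X∣ regular 1≤r r+2≤s φ)
  -- The count is made before saturation. Saturation preserves the ends in `Y` but not those in `X`,
  -- so the latter enter `stuck-count` with their initial number.
  ... | qs′ , φ′ , good , y-sum , stuck = finish (cover (stuck-count G X? Y? Y∩X ∣X∣ regular 1≤r r+2≤s φ′
          (endSum-X≤ G X? Y? Y∩X ∣X∣ regular 1≤r r+2≤s φ) good stuck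
          (subst (λ a → 4 * s ≤ a + endSum 𝟙X qs + 2 * r) (sym y-sum)
            (endSum-bound ∣X∣ ∣Y∣ y+r≡k+s φ (subst (λ a → a ≤ k) (sym (length-edges ps)) len) total))))
    where
    cover : endSum 𝟙X qs′ ≡ 0 ⊎ endSum 𝟙X qs′ < endSum 𝟙Y qs′ →
      ∃ λ qs″ → Forest G (edges ps) qs″ × endSum 𝟙X qs″ ≡ 0
    cover (inj₁ eq) = qs′ , φ′ , eq
    cover (inj₂ lt) = absorb G X? clique Y? Y∩X X-Y (length qs′) qs′ ℕ.≤-refl φ′ lt
    finish : (∃ λ qs″ → Forest G (edges ps) qs″ × endSum 𝟙X qs″ ≡ 0) →
      ∃ λ c → IsHamiltonCycle G c × All (Linked (CycleEdge c) ∘ toList) ps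
    finish (qs″ , φ″ , eq) with close-up G X? clique qs″ φ″ 3≤n (endsIn≡0 G {F = edges ps} X? clique {qs = qs″} eq)
    ... | c , ham , keep = c , ham , ⇒edges ps keep

-- The structure of closed graphs

∑-mono-≡ : ∀ {n} {f g : Fin n → ℕ} → (∀ i → f i ≤ g i) → ∑ g ≤ ∑ f → ∀ i → f i ≡ g i
∑-mono-≡ h ge i = ℕ.≤-antisym (h i) (ℕ.≮⇒≥ λ lt → contradiction ge (ℕ.<⇒≱ (∑-mono-< h i lt)))

NonAdj : ∀ {n} → Graph (Fin n) → Fin n → Fin n → Set
NonAdj G v w = v ≢ w × ¬ Adj G v w

nonAdj? : ∀ {n} (G : Graph (Fin n)) v w → Dec (NonAdj G v w)
nonAdj? G v w = ¬? (v Fin.≟ w) ×-dec ¬? (adj? G v w)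

codegree : ∀ {n} → Graph (Fin n) → Fin n → ℕ
codegree G v = ∑ λ w → ind (nonAdj? G v w)

adj+nonAdj : ∀ {n} (G : Graph (Fin n)) v w → adj G v w + ind (nonAdj? G v w) + ind (w Fin.≟ v) ≡ 1
adj+nonAdj G v w with v Fin.≟ w | adj? G v w
... | yes refl | yes vv = contradiction vv (adj-irrefl G)
... | yes refl | no _   = ind-yes (v Fin.≟ v) refl
... | no v≢w   | yes _  = cong suc (ind-no (w Fin.≟ v) (v≢w ∘ sym))
... | no v≢w   | no _   = cong suc (ind-no (w Fin.≟ v) (v≢w ∘ sym))

degree+codegree : ∀ {n} (G : Graph (Fin n)) v → degree G v + codegree G v + 1 ≡ n
degree+codegree {n} G v = begin
  degree G v + codegree G v + 1
    ≡⟨ cong₂ (λ a b → a + codegree G v + b) (degree-∑ G v) (sym (∑-δ₁ v)) ⟩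
  ∑ (adj G v) + ∑ (λ w → ind (nonAdj? G v w)) + ∑ (λ w → ind (w Fin.≟ v))
    ≡⟨ cong (λ a → a + ∑ (λ w → ind (w Fin.≟ v))) (∑-distrib-+ (adj G v) (λ w → ind (nonAdj? G v w))) ⟨
  ∑ (λ w → adj G v w + ind (nonAdj? G v w)) + ∑ (λ w → ind (w Fin.≟ v))
    ≡⟨ ∑-distrib-+ (λ w → adj G v w + ind (nonAdj? G v w)) (λ w → ind (w Fin.≟ v)) ⟨
  ∑ (λ w → adj G v w + ind (nonAdj? G v w) + ind (w Fin.≟ v))
    ≡⟨ sum-cong-≗ (adj+nonAdj G v) ⟩
  ∑ {n} (λ _ → 1)
    ≡⟨ trans (∑-const n 1) (ℕ.*-identityʳ n) ⟩
  n ∎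
  where open ≡-Reasoning

nonAdj-sym : ∀ {n} {G : Graph (Fin n)} {v w} → NonAdj G v w → NonAdj G w v
nonAdj-sym {G = G} (v≢w , v≁w) = v≢w ∘ sym , v≁w ∘ adj-sym G

-- P is ⊥ for the family ℋ, where X is independent, and ⊤ for ℒ, where X is a clique.
record Structure {n} (G : Graph (Fin n)) (P : Set) (s y : ℕ) : Set₁ where
  field
    X Y : Fin n → Set
    X?  : ∀ v → Dec (X v)
    Y?  : ∀ v → Dec (Y v)
    Y∩X : ∀ {v} → Y v → ¬ X v
    ∣X∣ : ∑ (λ v → ind (X? v)) ≡ s
    ∣Y∣ : ∑ (λ v → ind (Y? v)) ≡ y
    X-Y : ∀ {u v} → X u → Y v → Adj G u v
    X-Z : ∀ {u v} → X u → ¬ X v → ¬ Y v → ¬ Adj G u v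
    X-X : ∀ {u v} → X u → X v → u ≢ v → (P → Adj G u v) × (Adj G u v → P)

module _ {n k s m : ℕ} (n≡ : n ≡ k + 1 + m) (h₁ : 4 * s * (k + 1) < m) (h₂ : 8 * s < m)
         (h₃ : s * (k + 1) + 24 * s * s < m) (3≤n : 3 ≤ n)
         (G : Graph (Fin n)) (closed : Closed k G) (δ≤ : MinDegreeAtLeast (k + s) G)
         (sparse : ∑ (codegree G) ≤ 2 * s * n) where

  private
    c = codegree G

  -- Closedness for complementary degrees, with m = n - k - 1: nonadjacent degrees sum to at most n
  -- + k - 1 out of 2n - 2.
  codegrees : ∀ {u v} → NonAdj G u v → m ≤ c u + c v
  codegrees {u} {v} (u≢v , u≁v) = ℕ.+-cancelˡ-≤ (degree G u + degree G v + 2 + k) m (c u + c v) (begin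
    degree G u + degree G v + 2 + k + m ≡⟨ arith₁ (degree G u + degree G v) k m ⟩
    suc (degree G u + degree G v) + (k + 1 + m) ≡⟨ cong (λ z → suc (degree G u + degree G v) + z) n≡ ⟨
    suc (degree G u + degree G v) + n ≤⟨ ℕ.+-monoˡ-≤ n (closed u v u≢v u≁v) ⟩
    n + k + n ≡⟨ cong₂ (λ a b → a + k + b) (degree+codegree G u) (degree+codegree G v) ⟨
    (degree G u + c u + 1) + k + (degree G v + c v + 1) ≡⟨ arith₂ (degree G u) (c u) k (degree G v) (c v) ⟩
    degree G u + degree G v + 2 + k + (c u + c v) ∎)
    where
    open ℕ.≤-Reasoning
    arith₁ : ∀ d k m → d + 2 + k + m ≡ suc d + (k + 1 + m)
    arith₁ = solve-∀
    arith₂ : ∀ a b k d e → (a + b + 1) + k + (d + e + 1) ≡ a + d + 2 + k + (b + e)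
    arith₂ = solve-∀

  -- The cut at m/2 prevents two nonadjacent vertices from both being high.
  Low : Fin n → Set
  Low v = m ≤ 2 * c v

  low? : ∀ v → Dec (Low v)
  low? v = m ℕ.≤? 2 * c v

  private
    𝟙 : Fin n → ℕ
    𝟙 v = ind (low? v)
    t = ∑ 𝟙

  high-clique : ∀ {u v} → ¬ Low u → ¬ Low v → u ≢ v → Adj G u v
  high-clique {u} {v} ¬u ¬v u≢v with adj? G u v
  ... | yes p  = p
  ... | no u≁v = contradiction (ℕ.+-mono-≤ (codegrees (u≢v , u≁v)) (codegrees (u≢v , u≁v))) (ℕ.<⇒≱ (begin-strict
    c u + c v + (c u + c v) ≡⟨ arith (c u) (c v) ⟩
    2 * c u + 2 * c v <⟨ ℕ.+-mono-< (ℕ.≰⇒> ¬u) (ℕ.≰⇒> ¬v) ⟩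
    m + m ∎))
    where
    open ℕ.≤-Reasoning
    arith : ∀ a b → a + b + (a + b) ≡ 2 * a + 2 * b
    arith = solve-∀

  -- A crude bound from the cut at m/2. What matters is that it does not depend on `n`: it lets
  -- `low-codegree` improve m/2 to almost m, from which the sharp bound follows.
  t≤4s : t ≤ 4 * s
  t≤4s = ℕ.≮⇒≥ λ lt → contradiction (begin-strict
    suc (4 * s) * m ≤⟨ ℕ.*-monoˡ-≤ m lt ⟩
    t * m ≡⟨ ℕ.*-comm t m ⟩
    m * t ≡⟨ *-distribˡ-sum m 𝟙 ⟩
    ∑ (λ v → m * 𝟙 v) ≤⟨ ∑-mono point ⟩
    ∑ (λ v → 2 * c v) ≡⟨ *-distribˡ-sum 2 c ⟨
    2 * ∑ c ≤⟨ ℕ.*-monoʳ-≤ 2 sparse ⟩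
    2 * (2 * s * n) ≡⟨ cong (λ z → 2 * (2 * s * z)) n≡ ⟩
    2 * (2 * s * (k + 1 + m)) ≡⟨ arith s k m ⟩
    4 * s * (k + 1) + 4 * s * m <⟨ ℕ.+-monoˡ-< (4 * s * m) h₁ ⟩
    suc (4 * s) * m ∎) (ℕ.<-irrefl refl)
    where
    open ℕ.≤-Reasoning
    arith : ∀ s k m → 2 * (2 * s * (k + 1 + m)) ≡ 4 * s * (k + 1) + 4 * s * m
    arith = solve-∀
    point : ∀ v → m * 𝟙 v ≤ 2 * c v
    point v = *-ind≤ (low? v) id

  nonAdj-low : ∀ {v} → (∀ {w} → NonAdj G v w → Low w) → c v ≤ t
  nonAdj-low {v} h = ∑-mono λ w → ind-mono (nonAdj? G v w) (low? w) h

  high-codegree : ∀ {v} → ¬ Low v → c v ≤ t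
  high-codegree {v} ¬v = nonAdj-low λ {w} (v≢w , v≁w) → high-low w v≢w v≁w
    where
    high-low : ∀ w → v ≢ w → ¬ Adj G v w → Low w
    high-low w v≢w v≁w with low? w
    ... | yes p = p
    ... | no ¬w = contradiction (high-clique ¬v ¬w v≢w) v≁w

  ¬low : ∀ {v} → c v ≤ t → ¬ Low v
  ¬low {v} le low = contradiction low (ℕ.<⇒≱ (begin-strict
    2 * c v ≤⟨ ℕ.*-monoʳ-≤ 2 (ℕ.≤-trans le t≤4s) ⟩
    2 * (4 * s) ≡⟨ ℕ.*-assoc 2 4 s ⟨
    8 * s <⟨ h₂ ⟩
    m ∎))
    where open ℕ.≤-Reasoning

  -- A high non-neighbour misses at most `4 * s` vertices, so below this bound it would violate
  -- `codegrees`. All non-neighbours would then be low, and too few for `v` to be low itself.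
  low-codegree : ∀ {v} → Low v → m ≤ c v + 4 * s
  low-codegree {v} low = ℕ.≮⇒≥ λ lt → ¬low (nonAdj-low λ {w} na → to-low lt w na) low
    where
    to-low : c v + 4 * s < m → ∀ w → NonAdj G v w → Low w
    to-low lt w na with low? w
    ... | yes p = p
    ... | no ¬w = contradiction (ℕ.≤-trans (codegrees na) (ℕ.+-monoʳ-≤ (c v) (ℕ.≤-trans (high-codegree ¬w) t≤4s))) (ℕ.<⇒≱ lt)

  -- Both sides of the non-edges between low and high vertices are counted by ∑ c.
  low-pairs : 2 * ∑ (λ v → 𝟙 v * c v) ≤ ∑ c + t * t
  low-pairs = begin
    2 * L
      ≡⟨ cong (λ z → L + z) (ℕ.+-identityʳ L) ⟩
    L + L
      ≡⟨ cong₂ _+_ row col ⟩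
    ∑ (λ v → ∑ λ w → 𝟙 v * na v w) + ∑ (λ v → ∑ λ w → 𝟙 w * na v w)
      ≡⟨ ∑-distrib-+ (λ v → ∑ λ w → 𝟙 v * na v w) (λ v → ∑ λ w → 𝟙 w * na v w) ⟨
    ∑ (λ v → ∑ (λ w → 𝟙 v * na v w) + ∑ (λ w → 𝟙 w * na v w))
      ≤⟨ ∑-mono per-row ⟩
    ∑ (λ v → c v + 𝟙 v * t)
      ≡⟨ ∑-distrib-+ c (λ v → 𝟙 v * t) ⟩
    ∑ c + ∑ (λ v → 𝟙 v * t)
      ≡⟨ cong (λ z → ∑ c + z) (trans (sum-cong-≗ λ v → ℕ.*-comm (𝟙 v) t) (sym (*-distribˡ-sum t 𝟙))) ⟩
    ∑ c + t * t ∎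
    where
    open ℕ.≤-Reasoning
    L = ∑ (λ v → 𝟙 v * c v)
    na : Fin n → Fin n → ℕ
    na v w = ind (nonAdj? G v w)
    row : L ≡ ∑ (λ v → ∑ λ w → 𝟙 v * na v w)
    row = sum-cong-≗ λ v → *-distribˡ-sum (𝟙 v) (na v)
    col : L ≡ ∑ (λ v → ∑ λ w → 𝟙 w * na v w)
    col = trans row (trans (∑-comm (λ v w → 𝟙 v * na v w)) (sum-cong-≗ λ v → sum-cong-≗ λ w →
      cong (λ z → 𝟙 w * z) (ind-cong (nonAdj? G w v) (nonAdj? G v w) (nonAdj-sym {G = G}) (nonAdj-sym {G = G}))))
    point : ∀ {A B C : Set} (a : Dec A) (b : Dec B) (d : Dec C) →
      ind a * ind d + ind b * ind d ≤ ind d + ind a * ind b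
    point (yes _) (yes _) (yes _) = ℕ.≤-refl
    point (yes _) (no _)  (yes _) = ℕ.≤-refl
    point (no _)  (yes _) (yes _) = ℕ.≤-refl
    point (no _)  (no _)  (yes _) = z≤n
    point (yes _) (yes _) (no _)  = z≤n
    point (yes _) (no _)  (no _)  = z≤n
    point (no _)  (yes _) (no _)  = z≤n
    point (no _)  (no _)  (no _)  = z≤n
    per-row : ∀ v → ∑ (λ w → 𝟙 v * na v w) + ∑ (λ w → 𝟙 w * na v w) ≤ c v + 𝟙 v * t
    per-row v = begin
      ∑ (λ w → 𝟙 v * na v w) + ∑ (λ w → 𝟙 w * na v w) ≡⟨ ∑-distrib-+ (λ w → 𝟙 v * na v w) (λ w → 𝟙 w * na v w) ⟨
      ∑ (λ w → 𝟙 v * na v w + 𝟙 w * na v w) ≤⟨ ∑-mono (λ w → point (low? v) (low? w) (nonAdj? G v w)) ⟩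
      ∑ (λ w → na v w + 𝟙 v * 𝟙 w) ≡⟨ ∑-distrib-+ (na v) (λ w → 𝟙 v * 𝟙 w) ⟩
      c v + ∑ (λ w → 𝟙 v * 𝟙 w) ≡⟨ cong (λ z → c v + z) (*-distribˡ-sum (𝟙 v) 𝟙) ⟨
      c v + 𝟙 v * t ∎

  -- Each low vertex misses almost m vertices and almost all of these pairs join low to high, so ∑ c
  -- is at least 2tm up to a constant. Compared with 2sn, a value t ≥ s + 1 leaves an excess that
  -- `h₃` forbids.
  t≤s : t ≤ s
  t≤s = ℕ.≮⇒≥ λ lt → contradiction (ℕ.*-cancelˡ-≤ 2 (ℕ.+-cancelʳ-≤ (2 * s * m) (2 * m) (2 * (s * (k + 1) + 24 * s * s)) (begin
    2 * m + 2 * s * m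
      ≡⟨ arith₁ m s ⟩
    2 * (suc s * m)
      ≤⟨ ℕ.*-monoʳ-≤ 2 (ℕ.*-monoˡ-≤ m lt) ⟩
    2 * (t * m)
      ≡⟨ cong (2 *_) (trans (ℕ.*-comm t m) (*-distribˡ-sum m 𝟙)) ⟩
    2 * ∑ (λ v → m * 𝟙 v)
      ≤⟨ ℕ.*-monoʳ-≤ 2 (∑-mono point) ⟩
    2 * ∑ (λ v → 𝟙 v * c v + (4 * s) * 𝟙 v)
      ≡⟨ cong (2 *_) (trans (∑-distrib-+ (λ v → 𝟙 v * c v) (λ v → (4 * s) * 𝟙 v))
           (cong (λ z → ∑ (λ v → 𝟙 v * c v) + z) (sym (*-distribˡ-sum (4 * s) 𝟙)))) ⟩
    2 * (∑ (λ v → 𝟙 v * c v) + (4 * s) * t)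
      ≡⟨ ℕ.*-distribˡ-+ 2 (∑ (λ v → 𝟙 v * c v)) _ ⟩
    2 * ∑ (λ v → 𝟙 v * c v) + 2 * ((4 * s) * t)
      ≤⟨ ℕ.+-monoˡ-≤ _ low-pairs ⟩
    ∑ c + t * t + 2 * ((4 * s) * t)
      -- The squares add up to 48s², the origin of the 24 in `h₃`.
      ≤⟨ ℕ.+-mono-≤ (ℕ.+-mono-≤ sparse (ℕ.*-mono-≤ t≤4s t≤4s)) (ℕ.*-monoʳ-≤ 2 (ℕ.*-monoʳ-≤ (4 * s) t≤4s)) ⟩
    2 * s * n + (4 * s) * (4 * s) + 2 * ((4 * s) * (4 * s))
      ≡⟨ cong (λ z → 2 * s * z + (4 * s) * (4 * s) + 2 * ((4 * s) * (4 * s))) n≡ ⟩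
    2 * s * (k + 1 + m) + (4 * s) * (4 * s) + 2 * ((4 * s) * (4 * s))
      ≡⟨ arith₂ s k m ⟩
    2 * (s * (k + 1) + 24 * s * s) + 2 * s * m ∎))) (ℕ.<⇒≱ h₃)
    where
    open ℕ.≤-Reasoning
    arith₁ : ∀ m s → 2 * m + 2 * s * m ≡ 2 * (suc s * m)
    arith₁ = solve-∀
    arith₂ : ∀ s k m → 2 * s * (k + 1 + m) + (4 * s) * (4 * s) + 2 * ((4 * s) * (4 * s))
                     ≡ 2 * (s * (k + 1) + 24 * s * s) + 2 * s * m
    arith₂ = solve-∀
    point : ∀ v → m * 𝟙 v ≤ 𝟙 v * c v + (4 * s) * 𝟙 v
    point v = *-ind≤ (low? v) λ low → ℕ.≤-trans (low-codegree low) (ℕ.≤-reflexive (sym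
      (cong₂ _+_ (trans (cong (λ z → z * c v) (ind-yes (low? v) low)) (ℕ.*-identityˡ (c v)))
                 (trans (cong (λ z → 4 * s * z) (ind-yes (low? v) low)) (ℕ.*-identityʳ (4 * s))))))

  c+s≤m : ∀ v → c v + s ≤ m
  c+s≤m v = ℕ.+-cancelˡ-≤ (k + 1) (c v + s) m (begin
    k + 1 + (c v + s) ≡⟨ arith k (c v) s ⟩
    (k + s) + c v + 1 ≤⟨ ℕ.+-monoˡ-≤ 1 (ℕ.+-monoˡ-≤ (c v) (δ≤ v)) ⟩
    degree G v + c v + 1 ≡⟨ trans (degree+codegree G v) n≡ ⟩
    k + 1 + m ∎)
    where
    open ℕ.≤-Reasoning
    arith : ∀ k c s → k + 1 + (c + s) ≡ (k + s) + c + 1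
    arith = solve-∀

  closed-structure : EdgeHamiltonian k G ⊎
    ∃₂ λ (P : Set) y → Σ (Structure G P s y) λ S →
      (∀ {x} → Structure.X S x → degree G x ≡ k + s) × ((P ≡ ⊥ × y ≡ k + s) ⊎ (P ≡ ⊤ × y ≡ k + 1))
  closed-structure with Fin.any? (λ x → Fin.any? (λ v → low? x ×-dec ¬? (low? v) ×-dec ¬? (adj? G x v)))
  -- A low vertex adjacent to all high ones misses only low vertices, too few to be low. So no
  -- vertex is low.
  ... | no none = inj₁ (complete-edgeHamiltonian G 3≤n λ u≢v → high-clique (¬Low _) (¬Low _) u≢v)
    where
    ¬Low : ∀ x → ¬ Low x
    ¬Low x low = ¬low (nonAdj-low λ {w} (_ , x≁w) → to-low w x≁w) low
      where
      to-low : ∀ w → ¬ Adj G x w → Low w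
      to-low w x≁w with low? w
      ... | yes p = p
      ... | no ¬w = contradiction (x , w , low , ¬w , x≁w) none
  ... | yes (x₀ , v₀ , Xx₀ , ¬Xv₀ , x₀≁v₀) = by-r r refl
    where
    distinct : ∀ {x v} → Low x → ¬ Low v → x ≢ v
    distinct Xx ¬Xv refl = ¬Xv Xx
    -- The minimum degree lets `x` miss at most `m - s` vertices, and `v` has to make up for the
    -- rest of `m`.
    s≤c : ∀ {x v} → Low x → ¬ Low v → ¬ Adj G x v → s ≤ c v
    s≤c {x} {v} Xx ¬Xv x≁v = ℕ.+-cancelˡ-≤ (c x) s (c v)
      (ℕ.≤-trans (c+s≤m x) (codegrees (distinct Xx ¬Xv , x≁v)))
    t≡s : t ≡ s
    t≡s = ℕ.≤-antisym t≤s (ℕ.≤-trans (s≤c Xx₀ ¬Xv₀ x₀≁v₀) (high-codegree ¬Xv₀))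
    -- `v` misses at least `s` vertices, all of them low, and there are no more low ones. Missing
    -- one low vertex it misses all.
    none : ∀ {x v} → Low x → ¬ Low v → ¬ Adj G x v → ∀ {w} → Low w → ¬ Adj G w v
    none {x} {v} Xx ¬Xv x≁v {w} Xw w~v = contradiction
      (trans (sym (ind-no (nonAdj? G v w) λ (_ , v≁w) → v≁w (adj-sym G w~v)))
        (trans (∑-mono-≡ (λ u → ind-mono (nonAdj? G v u) (low? u) (to-low u))
          (ℕ.≤-trans t≤s (s≤c Xx ¬Xv x≁v)) w) (ind-yes (low? w) Xw))) λ ()
      where
      to-low : ∀ u → NonAdj G v u → Low u
      to-low u (v≢u , v≁u) with low? u
      ... | yes p = p
      ... | no ¬u = contradiction (high-clique ¬Xv ¬u v≢u) v≁u
    Y : Fin n → Set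
    Y v = ¬ Low v × Adj G x₀ v
    Y? : ∀ v → Dec (Y v)
    Y? v = ¬? (low? v) ×-dec adj? G x₀ v
    X-Y : ∀ {x v} → Low x → Y v → Adj G x v
    X-Y {x} {v} Xx (¬Xv , x₀~v) with adj? G x v
    ... | yes p  = p
    ... | no x≁v = contradiction x₀~v (none Xx ¬Xv x≁v Xx₀)
    X-Z : ∀ {x v} → Low x → ¬ Low v → ¬ Y v → ¬ Adj G x v
    X-Z Xx ¬Xv ¬Yv = none Xx₀ ¬Xv (λ x₀~v → ¬Yv (¬Xv , x₀~v)) Xx
    -- `v₀` misses at most `s` vertices, so `x` misses at least `m - s`, which caps its degree at
    -- the minimum.
    degree-X : ∀ {x} → Low x → degree G x ≡ k + s
    degree-X {x} Xx = ℕ.≤-antisym (ℕ.+-cancelʳ-≤ (c x + 1) (degree G x) (k + s) (begin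
      degree G x + (c x + 1) ≡⟨ ℕ.+-assoc (degree G x) (c x) 1 ⟨
      degree G x + c x + 1 ≡⟨ trans (degree+codegree G x) n≡ ⟩
      k + 1 + m ≤⟨ ℕ.+-monoʳ-≤ (k + 1) (ℕ.≤-trans (codegrees (distinct Xx ¬Xv₀ , none Xx₀ ¬Xv₀ x₀≁v₀ Xx))
                                    (ℕ.+-monoʳ-≤ (c x) (ℕ.≤-trans (high-codegree ¬Xv₀) t≤s))) ⟩
      k + 1 + (c x + s) ≡⟨ arith k (c x) s ⟩
      k + s + (c x + 1) ∎)) (δ≤ x)
      where
      open ℕ.≤-Reasoning
      arith : ∀ k c s → k + 1 + (c + s) ≡ k + s + (c + 1)
      arith = solve-∀
    y = ∑ (λ v → ind (Y? v))
    inner : Fin n → ℕ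
    inner x = ∑ (λ w → 𝟙 w * adj G x w)
    inner+y : ∀ {x} → Low x → inner x + y ≡ k + s
    inner+y {x} Xx = begin
      inner x + y ≡⟨ ∑-distrib-+ (λ w → 𝟙 w * adj G x w) (λ v → ind (Y? v)) ⟨
      ∑ (λ w → 𝟙 w * adj G x w + ind (Y? w)) ≡⟨ sum-cong-≗ point ⟩
      ∑ (adj G x) ≡⟨ degree-∑ G x ⟨
      degree G x ≡⟨ degree-X Xx ⟩
      k + s ∎
      where
      open ≡-Reasoning
      point : ∀ w → 𝟙 w * adj G x w + ind (Y? w) ≡ adj G x w
      point w = go (low? w) (Y? w) (adj? G x w)
        where
        go : (a : Dec (Low w)) (b : Dec (Y w)) (d : Dec (Adj G x w)) → ind a * ind d + ind b ≡ ind d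
        go (yes Xw) (yes Yw) _         = contradiction Xw (proj₁ Yw)
        go (yes Xw) (no _)   (yes _)   = refl
        go (yes Xw) (no _)   (no _)    = refl
        go (no _)   (yes _)  (yes _)   = refl
        go (no _)   (yes Yw) (no x≁w)  = contradiction (X-Y Xx Yw) x≁w
        go (no ¬Xw) (no ¬Yw) (yes x~w) = contradiction x~w (X-Z Xx ¬Xw ¬Yw)
        go (no _)   (no _)   (no _)    = refl
    r = inner x₀
    regular : ∀ {x} → Low x → inner x ≡ r
    regular {x} Xx = ℕ.+-cancelʳ-≡ y (inner x) r (trans (inner+y Xx) (sym (inner+y Xx₀)))
    inner<s : ∀ {x} → Low x → (∀ w → 𝟙 w * adj G x w + ind (w Fin.≟ x) ≤ 𝟙 w)
    inner<s {x} Xx w with w Fin.≟ x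
    ... | yes refl = ℕ.≤-reflexive (trans (cong₂ (λ a b → a * b + 1) (ind-yes (low? x) Xx)
                       (ind-no (adj? G x x) (adj-irrefl G))) (sym (ind-yes (low? x) Xx)))
    ... | no _ = ℕ.≤-trans (ℕ.≤-reflexive (ℕ.+-identityʳ _))
                   (ℕ.≤-trans (ℕ.*-monoʳ-≤ (𝟙 w) (ind≤1 (adj? G x w))) (ℕ.≤-reflexive (ℕ.*-identityʳ (𝟙 w))))
    inner+1 : ∀ x → ∑ (λ w → 𝟙 w * adj G x w + ind (w Fin.≟ x)) ≡ inner x + 1
    inner+1 x = trans (∑-distrib-+ (λ w → 𝟙 w * adj G x w) (λ w → ind (w Fin.≟ x)))
      (cong (λ z → inner x + z) (∑-δ₁ x))
    r<s : r + 1 ≤ s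
    r<s = ℕ.≤-trans (ℕ.≤-reflexive (sym (inner+1 x₀))) (ℕ.≤-trans (∑-mono (inner<s Xx₀)) (ℕ.≤-reflexive t≡s))
    structure : (P : Set) → (∀ {u v} → Low u → Low v → u ≢ v → (P → Adj G u v) × (Adj G u v → P)) → Structure G P s y
    structure P X-X = record
      { X = Low ; Y = Y ; X? = low? ; Y? = Y? ; Y∩X = proj₁ ; ∣X∣ = t≡s ; ∣Y∣ = refl
      ; X-Y = X-Y ; X-Z = X-Z ; X-X = X-X }
    by-r : ∀ r′ → r′ ≡ r → EdgeHamiltonian k G ⊎
      ∃₂ λ (P : Set) y → Σ (Structure G P s y) λ S →
        (∀ {x} → Structure.X S x → degree G x ≡ k + s) × ((P ≡ ⊥ × y ≡ k + s) ⊎ (P ≡ ⊤ × y ≡ k + 1))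
    by-r zero 0≡r = inj₂ (⊥ , y , structure ⊥ independent , degree-X
                      , inj₁ (refl , trans (cong (λ z → z + y) 0≡r) (inner+y Xx₀)))
      where
      independent : ∀ {u v} → Low u → Low v → u ≢ v → (⊥ → Adj G u v) × (Adj G u v → ⊥)
      independent {u} {v} Xu Xv _ = (λ ()) , λ u~v → contradiction
        (ℕ.≤-trans (f≤∑f (λ w → 𝟙 w * adj G u w) v) (ℕ.≤-reflexive (trans (regular Xu) (sym 0≡r))))
        (ℕ.<⇒≱ (ℕ.≤-reflexive (sym (cong₂ _*_ (ind-yes (low? v) Xv) (ind-yes (adj? G u v) u~v)))))
    by-r (suc r′) r≡ with r + 2 ℕ.≤? s
    ... | yes r+2≤s = inj₁ (regular-edgeHamiltonian low? Y? proj₁ G 3≤n t≡s refl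
            (trans (ℕ.+-comm y r) (inner+y Xx₀)) (subst (λ z → 1 ≤ z) r≡ (s≤s z≤n)) r+2≤s regular high-clique X-Y)
    ... | no r+2≰s = inj₂ (⊤ , y , structure ⊤ full , degree-X , inj₂ (refl ,
            ℕ.+-cancelˡ-≡ r y (k + 1) (trans (inner+y Xx₀) (trans (cong (λ z → k + z) (sym r+1≡s)) (arith k r)))))
      where
      arith : ∀ k r → k + (r + 1) ≡ r + (k + 1)
      arith = solve-∀
      r+1≡s : r + 1 ≡ s
      r+1≡s = ℕ.≤-antisym r<s (ℕ.s≤s⁻¹ (ℕ.≤-trans (ℕ.≰⇒> r+2≰s) (ℕ.≤-reflexive (ℕ.+-suc r 1))))
      full : ∀ {u v} → Low u → Low v → u ≢ v → (⊤ → Adj G u v) × (Adj G u v → ⊤)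
      full {u} {v} Xu Xv u≢v = (λ _ → 0<ind (adj? G u v) (subst (λ z → 0 < z) (sym eq) (s≤s z≤n))) , _
        where
        tight : ∑ 𝟙 ≤ ∑ (λ w → 𝟙 w * adj G u w + ind (w Fin.≟ u))
        tight = ℕ.≤-reflexive (trans t≡s (trans (sym r+1≡s) (trans (cong (λ z → z + 1) (sym (regular Xu))) (sym (inner+1 u)))))
        eq : adj G u v ≡ 1
        eq = begin
          adj G u v ≡⟨ arith′ (adj G u v) ⟩
          1 * adj G u v + 0 ≡⟨ cong₂ (λ a b → a * adj G u v + b) (ind-yes (low? v) Xv)
                                                             (ind-no (v Fin.≟ u) (u≢v ∘ sym)) ⟨
          𝟙 v * adj G u v + ind (v Fin.≟ u) ≡⟨ ∑-mono-≡ (inner<s Xu) tight v ⟩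
          𝟙 v ≡⟨ ind-yes (low? v) Xv ⟩
          1 ∎
          where
          open ≡-Reasoning
          arith′ : ∀ a → a ≡ 1 * a + 0
          arith′ = solve-∀

-- The maximum principle

-- Abstract, since ι n would otherwise unfold to a gcd computation from which n cannot be inferred.
abstract

  ι : ℕ → ℚ
  ι n = + n ℚ./ 1

  ι-def : ∀ n → + n ℚ./ 1 ≡ ι n
  ι-def n = refl

  ι-homo-+ : ∀ a b → ι (a + b) ≡ ι a ℚ.+ ι b
  ι-homo-+ a b = ℚ.toℚᵘ-injective (begin
    ℚ.toℚᵘ (ι (a + b)) ≈⟨ ℚ.toℚᵘ-fromℚᵘ (ℚᵘ.mkℚᵘ (+ (a + b)) 0) ⟩
    ℚᵘ.mkℚᵘ (+ (a + b)) 0 ≈⟨ ℚᵘ.*≡* (cong (λ z → z ℤ.* + 1)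
                                                     (sym (cong₂ ℤ._+_ (ℤ.*-identityʳ (+ a)) (ℤ.*-identityʳ (+ b))))) ⟩
    ℚᵘ.mkℚᵘ (+ a) 0 ℚᵘ.+ ℚᵘ.mkℚᵘ (+ b) 0 ≈⟨ ℚᵘ.+-cong (ℚ.toℚᵘ-fromℚᵘ (ℚᵘ.mkℚᵘ (+ a) 0)) (ℚ.toℚᵘ-fromℚᵘ (ℚᵘ.mkℚᵘ (+ b) 0)) ⟨
    ℚ.toℚᵘ (ι a) ℚᵘ.+ ℚ.toℚᵘ (ι b) ≈⟨ ℚ.toℚᵘ-homo-+ (ι a) (ι b) ⟨
    ℚ.toℚᵘ (ι a ℚ.+ ι b) ∎)
    where open import Relation.Binary.Reasoning.Setoid ℚᵘ.≃-setoid

  ι-homo-* : ∀ a b → ι (a * b) ≡ ι a ℚ.* ι b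
  ι-homo-* a b = ℚ.toℚᵘ-injective (begin
    ℚ.toℚᵘ (ι (a * b)) ≈⟨ ℚ.toℚᵘ-fromℚᵘ (ℚᵘ.mkℚᵘ (+ (a * b)) 0) ⟩
    ℚᵘ.mkℚᵘ (+ (a * b)) 0 ≈⟨ ℚᵘ.*≡* (cong (λ z → z ℤ.* + 1) (ℤ.pos-* a b)) ⟩
    ℚᵘ.mkℚᵘ (+ a) 0 ℚᵘ.* ℚᵘ.mkℚᵘ (+ b) 0 ≈⟨ ℚᵘ.*-cong (ℚ.toℚᵘ-fromℚᵘ (ℚᵘ.mkℚᵘ (+ a) 0)) (ℚ.toℚᵘ-fromℚᵘ (ℚᵘ.mkℚᵘ (+ b) 0)) ⟨
    ℚ.toℚᵘ (ι a) ℚᵘ.* ℚ.toℚᵘ (ι b) ≈⟨ ℚ.toℚᵘ-homo-* (ι a) (ι b) ⟨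
    ℚ.toℚᵘ (ι a ℚ.* ι b) ∎)
    where open import Relation.Binary.Reasoning.Setoid ℚᵘ.≃-setoid

  ι-nonNeg : ∀ n → ℚ.NonNegative (ι n)
  ι-nonNeg n = ℚ.normalize-nonNeg n 1

  ι-pos : ∀ {n} → 0 < n → ℚ.Positive (ι n)
  ι-pos {suc n} _ = ℚ.normalize-pos (suc n) 1

ι-mono : ∀ {a b} → a ≤ b → ι a ℚ.≤ ι b
ι-mono {a} {b} a≤b = begin
  ι a ≡⟨ ℚ.+-identityʳ (ι a) ⟨
  ι a ℚ.+ 0ℚ ≤⟨ ℚ.+-monoʳ-≤ (ι a) (ℚ.nonNegative⁻¹ (ι (b ∸ a)) {{ι-nonNeg (b ∸ a)}}) ⟩
  ι a ℚ.+ ι (b ∸ a) ≡⟨ ι-homo-+ a (b ∸ a) ⟨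
  ι (a + (b ∸ a)) ≡⟨ cong ι (ℕ.m+[n∸m]≡n a≤b) ⟩
  ι b ∎
  where open ℚ.≤-Reasoning

∑ℚ : ∀ {n} → (Fin n → ℚ) → ℚ
∑ℚ {zero}  f = 0ℚ
∑ℚ {suc n} f = f zero ℚ.+ ∑ℚ (f ∘ suc)

∑ℚ-cong : ∀ {n} {f g : Fin n → ℚ} → (∀ i → f i ≡ g i) → ∑ℚ f ≡ ∑ℚ g
∑ℚ-cong {zero}  h = refl
∑ℚ-cong {suc n} h = cong₂ ℚ._+_ (h zero) (∑ℚ-cong (h ∘ suc))

∑ℚ-+ : ∀ {n} (f g : Fin n → ℚ) → ∑ℚ (λ i → f i ℚ.+ g i) ≡ ∑ℚ f ℚ.+ ∑ℚ g
∑ℚ-+ {zero}  f g = refl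
∑ℚ-+ {suc n} f g = trans (cong (λ z → f zero ℚ.+ g zero ℚ.+ z) (∑ℚ-+ (f ∘ suc) (g ∘ suc)))
  (interchange (f zero) (g zero) (∑ℚ (f ∘ suc)) (∑ℚ (g ∘ suc)))
  where
  open +-*-Solver
  interchange : ∀ a b c d → a ℚ.+ b ℚ.+ (c ℚ.+ d) ≡ a ℚ.+ c ℚ.+ (b ℚ.+ d)
  interchange = solve 4 (λ a b c d → a :+ b :+ (c :+ d) := a :+ c :+ (b :+ d)) refl

∑ℚ-* : ∀ {n} (f : Fin n → ℚ) c → ∑ℚ f ℚ.* c ≡ ∑ℚ (λ i → f i ℚ.* c)
∑ℚ-* {zero}  f c = ℚ.*-zeroˡ c
∑ℚ-* {suc n} f c = trans (ℚ.*-distribʳ-+ c (f zero) (∑ℚ (f ∘ suc)))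
  (cong (λ z → f zero ℚ.* c ℚ.+ z) (∑ℚ-* (f ∘ suc) c))

∑ℚ-ι : ∀ {n} (f : Fin n → ℕ) → ∑ℚ (ι ∘ f) ≡ ι (∑ f)
∑ℚ-ι {zero}  f = ι-def 0
∑ℚ-ι {suc n} f = trans (cong (λ z → ι (f zero) ℚ.+ z) (∑ℚ-ι (f ∘ suc))) (sym (ι-homo-+ (f zero) (∑ (f ∘ suc))))

∑ℚ-δ : ∀ {n} c (f : Fin n → ℚ) i → ∑ℚ (λ j → (if does (i Fin.≟ j) then c else 0ℚ) ℚ.* f j) ≡ c ℚ.* f i
∑ℚ-δ {suc n} c f zero = begin
  c ℚ.* f zero ℚ.+ ∑ℚ (λ j → 0ℚ ℚ.* f (suc j)) ≡⟨ cong (λ z → c ℚ.* f zero ℚ.+ z) (zeros (f ∘ suc)) ⟩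
  c ℚ.* f zero ℚ.+ 0ℚ ≡⟨ ℚ.+-identityʳ _ ⟩
  c ℚ.* f zero ∎
  where
  open ≡-Reasoning
  zeros : ∀ {m} (g : Fin m → ℚ) → ∑ℚ (λ j → 0ℚ ℚ.* g j) ≡ 0ℚ
  zeros {zero}  g = refl
  zeros {suc m} g = cong₂ ℚ._+_ (ℚ.*-zeroˡ (g zero)) (zeros (g ∘ suc))
∑ℚ-δ c f (suc i) = trans (cong₂ ℚ._+_ (ℚ.*-zeroˡ (f zero)) (∑ℚ-δ c (f ∘ suc) i)) (ℚ.+-identityˡ _)

∣∑ℚ∣≤ : ∀ {n} {f g : Fin n → ℚ} → (∀ i → ∣ f i ∣ℚ ℚ.≤ g i) → ∣ ∑ℚ f ∣ℚ ℚ.≤ ∑ℚ g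
∣∑ℚ∣≤ {zero}  h = ℚ.≤-refl
∣∑ℚ∣≤ {suc n} {f} h = ℚ.≤-trans (ℚ.∣p+q∣≤∣p∣+∣q∣ (f zero) (∑ℚ (f ∘ suc)))
  (ℚ.+-mono-≤ (h zero) (∣∑ℚ∣≤ (h ∘ suc)))

p≤∣p∣ : ∀ p → p ℚ.≤ ∣ p ∣ℚ
p≤∣p∣ p with ℚ.≤-total 0ℚ p
... | inj₁ 0≤p = ℚ.≤-reflexive (sym (ℚ.0≤p⇒∣p∣≡p 0≤p))
... | inj₂ p≤0 = ℚ.≤-trans p≤0 (ℚ.0≤∣p∣ p)

argmax : ∀ {n} (f : Fin (suc n) → ℚ) → ∃ λ i → ∀ j → f j ℚ.≤ f i
argmax {zero}  f = zero , λ { zero → ℚ.≤-refl }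
argmax {suc n} f with argmax (f ∘ suc)
... | i , h with ℚ.≤-total (f zero) (f (suc i))
... | inj₁ le = suc i , λ { zero → le ; (suc j) → h j }
... | inj₂ ge = zero , λ { zero → ℚ.≤-refl ; (suc j) → ℚ.≤-trans (h j) ge }

eventually-∀ : ∀ {n} {P : Fin n → ℕ → Set} → (∀ i → Eventually (P i)) → Eventually (λ m → ∀ i → P i m)
eventually-∀ {zero}  h = 0 , λ m _ ()
eventually-∀ {suc n} h with h zero | eventually-∀ (h ∘ suc)
... | M , p | N , q = M ℕ.⊔ N , λ m le → λ where
  zero    → p m (ℕ.m⊔n≤o⇒m≤o M N le)
  (suc i) → q m (ℕ.m⊔n≤o⇒n≤o M N le) i

seq-sumᴿ : ∀ {n} (f : Fin n → ℝ) m → seq (sumᴿ f) m ≡ ∑ℚ (λ j → seq (f j) m)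
seq-sumᴿ {zero}  f m = refl
seq-sumᴿ {suc n} f m = cong (λ z → seq (f zero) m ℚ.+ z) (seq-sumᴿ (f ∘ suc) m)

module _ {n : ℕ} (G : Graph (Fin n)) where

  seq-adjacency : ∀ i j m → seq (adjacencyMatrix G i j) m ≡ ι (adj G i j)
  seq-adjacency i j m = entry (adj? G i j)
    where
    entry : ∀ {P} (d : Dec P) → seq (if does d then fromℕ 1 else 0ᴿ) m ≡ ι (ind d)
    entry (yes _) = ι-def 1
    entry (no _)  = ι-def 0

  seq-degree : ∀ i j m → seq (degreeMatrix G i j) m ≡ (if does (i Fin.≟ j) then ι (degree G i) else 0ℚ)
  seq-degree i j m = entry (i Fin.≟ j) (degree G i)
    where
    entry : ∀ {P} (d : Dec P) c → seq (if does d then fromℕ c else 0ᴿ) m ≡ (if does d then ι c else 0ℚ)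
    entry (yes _) c = ι-def c
    entry (no _)  c = refl

  seq-signlessLaplacian : ∀ (x : Fin n → ℝ) i m → seq ((signlessLaplacian G *ᵥ x) i) m ≡
    ∑ℚ (λ j → ι (adj G i j) ℚ.* (seq (x i) m ℚ.+ seq (x j) m))
  seq-signlessLaplacian x i m = begin
    seq (sumᴿ λ j → signlessLaplacian G i j *ᴿ x j) m
      ≡⟨ seq-sumᴿ (λ j → signlessLaplacian G i j *ᴿ x j) m ⟩
    ∑ℚ (λ j → (seq (degreeMatrix G i j) m ℚ.+ seq (adjacencyMatrix G i j) m) ℚ.* X j)
      ≡⟨ ∑ℚ-cong (λ j → trans (cong₂ (λ a b → (a ℚ.+ b) ℚ.* X j) (seq-degree i j m) (seq-adjacency i j m))
           (ℚ.*-distribʳ-+ (X j) (d j) (a j))) ⟩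
    ∑ℚ (λ j → d j ℚ.* X j ℚ.+ a j ℚ.* X j)
      ≡⟨ ∑ℚ-+ (λ j → d j ℚ.* X j) (λ j → a j ℚ.* X j) ⟩
    ∑ℚ (λ j → d j ℚ.* X j) ℚ.+ ∑ℚ (λ j → a j ℚ.* X j)
      ≡⟨ cong (λ z → z ℚ.+ ∑ℚ (λ j → a j ℚ.* X j)) (trans (∑ℚ-δ (ι (degree G i)) X i)
           (trans (cong (λ z → z ℚ.* X i) (trans (cong ι (degree-∑ G i)) (sym (∑ℚ-ι (adj G i))))) (∑ℚ-* a (X i)))) ⟩
    ∑ℚ (λ j → a j ℚ.* X i) ℚ.+ ∑ℚ (λ j → a j ℚ.* X j)
      ≡⟨ ∑ℚ-+ (λ j → a j ℚ.* X i) (λ j → a j ℚ.* X j) ⟨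
    ∑ℚ (λ j → a j ℚ.* X i ℚ.+ a j ℚ.* X j)
      ≡⟨ ∑ℚ-cong (λ j → sym (ℚ.*-distribˡ-+ (a j) (X i) (X j))) ⟩
    ∑ℚ (λ j → a j ℚ.* (X i ℚ.+ X j)) ∎
    where
    open ≡-Reasoning
    X d a : Fin n → ℚ
    X j = seq (x j) m
    d j = if does (i Fin.≟ j) then ι (degree G i) else 0ℚ
    a j = ι (adj G i j)

-- The maximum principle applied at a vertex maximising |xᵢ| / zᵢ.
collatz-wielandt : ∀ {n} (G : Graph (Fin n)) (z : Fin n → ℕ) (T : ℕ) →
  (∀ i → ∑ (λ w → adj G i w * (z i + z w)) < T * z i) →
  ∀ q → IsEigenvalue (signlessLaplacian G) q → ¬ (fromℕ T ≤ᴿ q)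
collatz-wielandt {zero}  G z T rows q (x , x≉0 , _)     T≤q = x≉0 λ ()
collatz-wielandt {suc n} G z T rows q (x , x≉0 , eigen) T≤q = x≉0 λ i ε → vanish ε i
  where
  V = Fin (suc n)
  0<z : ∀ i → 0 < z i
  0<z i = ℕ.n≢0⇒n>0 λ z≡0 → ℕ.n≮0 (ℕ.<-≤-trans (rows i)
    (ℕ.≤-reflexive (trans (cong (T *_) z≡0) (ℕ.*-zeroʳ T))))
  ζ : V → ℚ
  ζ i = ι (z i)
  ζ>0 : ∀ i → ℚ.Positive (ζ i)
  ζ>0 i = ι-pos (0<z i)
  ζ≠0 : ∀ i → ℚ.NonZero (ζ i)
  ζ≠0 i = ℚ.pos⇒nonZero (ζ i) {{ζ>0 i}}
  0<Z : 0 < ∑ z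
  0<Z = ℕ.≤-trans (0<z zero) (f≤∑f z zero)
  Z≠0 : ℚ.NonZero (ι (∑ z))
  Z≠0 = ℚ.pos⇒nonZero (ι (∑ z)) {{ι-pos 0<Z}}
  w : ℚ
  w = (ℚ.1/ ι (∑ z)) {{Z≠0}}
  w>0 : ℚ.Positive w
  w>0 = ℚ.1/pos⇒pos (ι (∑ z)) {{ι-pos 0<Z}}
  ζw≤1 : ∀ i → ζ i ℚ.* w ℚ.≤ 1ℚ
  ζw≤1 i = ℚ.≤-trans (ℚ.*-monoʳ-≤-nonNeg w {{ℚ.pos⇒nonNeg w {{w>0}}}} (ι-mono (f≤∑f z i)))
    (ℚ.≤-reflexive (ℚ.*-inverseʳ (ι (∑ z)) {{Z≠0}}))
  -- Strictness of the rows yields a surplus b, the maximal ratio |xᵢ|/zᵢ. As `κ * zᵢ ≤ ½`,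
  -- replacing T by q costs at most half of it, and the other half is bounded by the eigenvalue
  -- error `ε * κ`, so that `b ≤ ε * w`.
  κ : ℚ
  κ = ½ ℚ.* w
  κ>0 : ℚ.Positive κ
  κ>0 = ℚ.pos*pos⇒pos ½ w {{w>0}}

  module _ (ε : ℚ) (ε>0 : ℚ.Positive ε) (m : ℕ)
           (close : ∀ i → ∣ seq ((signlessLaplacian G *ᵥ x) i) m ℚ.- seq q m ℚ.* seq (x i) m ∣ℚ ℚ.≤ ε ℚ.* κ)
           (large : ι T ℚ.≤ seq q m ℚ.+ κ) where
    open ℚ.≤-Reasoning
    X A B : V → ℚ
    X j = seq (x j) m
    A j = ∣ X j ∣ℚ
    B j = A j ℚ.* (ℚ.1/ ζ j) {{ζ≠0 j}}
    -- The vertex is chosen among rational numbers at the index `m` and may change with `m`; the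
    -- resulting estimate is for that index alone.
    i : V
    i = proj₁ (argmax B)
    b μ row σ : ℚ
    b = B i
    μ = seq q m
    row = seq ((signlessLaplacian G *ᵥ x) i) m
    σ = ι (∑ (λ j → adj G i j * (z i + z j)))
    A≡ : ∀ j → A j ≡ ζ j ℚ.* B j
    A≡ j = sym (begin-equality
      ζ j ℚ.* (A j ℚ.* u) ≡⟨ shuffle (ζ j) (A j) u ⟩
      A j ℚ.* (ζ j ℚ.* u) ≡⟨ cong (A j ℚ.*_) (ℚ.*-inverseʳ (ζ j) {{ζ≠0 j}}) ⟩
      A j ℚ.* 1ℚ ≡⟨ ℚ.*-identityʳ (A j) ⟩
      A j ∎)
      where
      u = (ℚ.1/ ζ j) {{ζ≠0 j}}
      open +-*-Solver
      shuffle : ∀ a b c → a ℚ.* (b ℚ.* c) ≡ b ℚ.* (a ℚ.* c)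
      shuffle = solve 3 (λ a b c → a :* (b :* c) := b :* (a :* c)) refl
    A≤ : ∀ j → A j ℚ.≤ ζ j ℚ.* b
    A≤ j = ℚ.≤-trans (ℚ.≤-reflexive (A≡ j))
      (ℚ.*-monoˡ-≤-nonNeg (ζ j) {{ι-nonNeg (z j)}} (proj₂ (argmax B) j))
    b≥0 : ℚ.NonNegative b
    b≥0 = ℚ.nonNegative (ℚ.≤-trans (ℚ.≤-reflexive (sym (ℚ.*-zeroˡ u)))
      (ℚ.*-monoʳ-≤-nonNeg u {{ℚ.pos⇒nonNeg u {{ℚ.1/pos⇒pos (ζ i) {{ζ>0 i}}}}}} (ℚ.0≤∣p∣ (X i))))
      where u = (ℚ.1/ ζ i) {{ζ≠0 i}}
    term : ∀ j → ∣ ι (adj G i j) ℚ.* (X i ℚ.+ X j) ∣ℚ ℚ.≤ ι (adj G i j * (z i + z j)) ℚ.* b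
    term j = begin
      ∣ a ℚ.* (X i ℚ.+ X j) ∣ℚ ≡⟨ ℚ.∣p*q∣≡∣p∣*∣q∣ a (X i ℚ.+ X j) ⟩
      ∣ a ∣ℚ ℚ.* ∣ X i ℚ.+ X j ∣ℚ ≡⟨ cong (ℚ._* ∣ X i ℚ.+ X j ∣ℚ)
                                                    (ℚ.0≤p⇒∣p∣≡p (ℚ.nonNegative⁻¹ a {{ι-nonNeg (adj G i j)}})) ⟩
      a ℚ.* ∣ X i ℚ.+ X j ∣ℚ ≤⟨ ℚ.*-monoˡ-≤-nonNeg a {{ι-nonNeg (adj G i j)}}
                                                    (ℚ.≤-trans (ℚ.∣p+q∣≤∣p∣+∣q∣ (X i) (X j)) (ℚ.+-mono-≤ (A≤ i) (A≤ j))) ⟩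
      a ℚ.* (ζ i ℚ.* b ℚ.+ ζ j ℚ.* b) ≡⟨ collect a (ζ i) (ζ j) b ⟩
      a ℚ.* (ζ i ℚ.+ ζ j) ℚ.* b ≡⟨ cong (ℚ._* b) (trans (cong (a ℚ.*_) (sym (ι-homo-+ (z i) (z j))))
                                                    (sym (ι-homo-* (adj G i j) (z i + z j)))) ⟩
      ι (adj G i j * (z i + z j)) ℚ.* b ∎
      where
      a = ι (adj G i j)
      open +-*-Solver
      collect : ∀ a s t b → a ℚ.* (s ℚ.* b ℚ.+ t ℚ.* b) ≡ a ℚ.* (s ℚ.+ t) ℚ.* b
      collect = solve 4 (λ a s t b → a :* (s :* b :+ t :* b) := a :* (s :+ t) :* b) refl
    row≤ : ∣ row ∣ℚ ℚ.≤ σ ℚ.* b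
    row≤ = begin
      ∣ row ∣ℚ ≡⟨ cong ∣_∣ℚ (seq-signlessLaplacian G x i m) ⟩
      ∣ ∑ℚ (λ j → ι (adj G i j) ℚ.* (X i ℚ.+ X j)) ∣ℚ ≤⟨ ∣∑ℚ∣≤ term ⟩
      ∑ℚ (λ j → ι (adj G i j * (z i + z j)) ℚ.* b) ≡⟨ ∑ℚ-* (λ j → ι (adj G i j * (z i + z j))) b ⟨
      ∑ℚ (λ j → ι (adj G i j * (z i + z j))) ℚ.* b ≡⟨ cong (ℚ._* b) (∑ℚ-ι (λ j → adj G i j * (z i + z j))) ⟩
      σ ℚ.* b ∎
    μA≤ : μ ℚ.* A i ℚ.≤ σ ℚ.* b ℚ.+ ε ℚ.* κ
    μA≤ = begin
      μ ℚ.* A i ≤⟨ ℚ.*-monoʳ-≤-nonNeg (A i) {{ℚ.∣-∣-nonNeg (X i)}} (p≤∣p∣ μ) ⟩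
      ∣ μ ∣ℚ ℚ.* A i ≡⟨ ℚ.∣p*q∣≡∣p∣*∣q∣ μ (X i) ⟨
      ∣ μ ℚ.* X i ∣ℚ ≡⟨ cong ∣_∣ℚ (twice row (μ ℚ.* X i)) ⟩
      ∣ row ℚ.- (row ℚ.- μ ℚ.* X i) ∣ℚ ≤⟨ ℚ.∣p-q∣≤∣p∣+∣q∣ row (row ℚ.- μ ℚ.* X i) ⟩
      ∣ row ∣ℚ ℚ.+ ∣ row ℚ.- μ ℚ.* X i ∣ℚ ≤⟨ ℚ.+-mono-≤ row≤ (close i) ⟩
      σ ℚ.* b ℚ.+ ε ℚ.* κ ∎
      where
      open +-*-Solver
      twice : ∀ r p → p ≡ r ℚ.- (r ℚ.- p)
      twice = solve 2 (λ r p → p := r :- (r :- p)) refl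
    strict-row : σ ℚ.* b ℚ.+ b ℚ.≤ ι T ℚ.* A i
    strict-row = begin
      σ ℚ.* b ℚ.+ b ≡⟨ trans (factor σ b) (cong (λ u → (u ℚ.+ σ) ℚ.* b) (ι-def 1)) ⟩
      (ι 1 ℚ.+ σ) ℚ.* b ≡⟨ cong (ℚ._* b) (ι-homo-+ 1 _) ⟨
      ι (suc (∑ (λ j → adj G i j * (z i + z j)))) ℚ.* b
                                     ≤⟨ ℚ.*-monoʳ-≤-nonNeg b {{b≥0}} (ι-mono (rows i)) ⟩
      ι (T * z i) ℚ.* b ≡⟨ cong (ℚ._* b) (ι-homo-* T (z i)) ⟩
      ι T ℚ.* ζ i ℚ.* b ≡⟨ ℚ.*-assoc (ι T) (ζ i) b ⟩
      ι T ℚ.* (ζ i ℚ.* b) ≡⟨ cong (ι T ℚ.*_) (A≡ i) ⟨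
      ι T ℚ.* A i ∎
      where
      open +-*-Solver
      factor : ∀ s b → s ℚ.* b ℚ.+ b ≡ (1ℚ ℚ.+ s) ℚ.* b
      factor = solve 2 (λ s b → s :* b :+ b := (con 1ℚ :+ s) :* b) refl
    b≤ : ½ ℚ.* b ℚ.≤ ½ ℚ.* (ε ℚ.* w)
    b≤ = begin
      ½ ℚ.* b ≡⟨ lhs σ b ⟩
      (σ ℚ.* b ℚ.+ b) ℚ.- (σ ℚ.* b ℚ.+ ½ ℚ.* b) ≤⟨ ℚ.+-monoˡ-≤ (ℚ.- (σ ℚ.* b ℚ.+ ½ ℚ.* b)) (begin
        σ ℚ.* b ℚ.+ b ≤⟨ strict-row ⟩
        ι T ℚ.* A i ≤⟨ ℚ.*-monoʳ-≤-nonNeg (A i) {{ℚ.∣-∣-nonNeg (X i)}} large ⟩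
        (μ ℚ.+ κ) ℚ.* A i ≡⟨ ℚ.*-distribʳ-+ (A i) μ κ ⟩
        μ ℚ.* A i ℚ.+ κ ℚ.* A i ≤⟨ ℚ.+-mono-≤ μA≤ κA≤ ⟩
        (σ ℚ.* b ℚ.+ ε ℚ.* κ) ℚ.+ ½ ℚ.* b ∎) ⟩
      ((σ ℚ.* b ℚ.+ ε ℚ.* κ) ℚ.+ ½ ℚ.* b) ℚ.- (σ ℚ.* b ℚ.+ ½ ℚ.* b) ≡⟨ rhs σ b ε w ⟩
      ½ ℚ.* (ε ℚ.* w) ∎
      where
      open +-*-Solver
      lhs : ∀ s b → ½ ℚ.* b ≡ (s ℚ.* b ℚ.+ b) ℚ.- (s ℚ.* b ℚ.+ ½ ℚ.* b)
      lhs = solve 2 (λ s b → con ½ :* b := (s :* b :+ b) :- (s :* b :+ con ½ :* b)) refl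
      rhs : ∀ s b e w → ((s ℚ.* b ℚ.+ e ℚ.* (½ ℚ.* w)) ℚ.+ ½ ℚ.* b) ℚ.- (s ℚ.* b ℚ.+ ½ ℚ.* b) ≡ ½ ℚ.* (e ℚ.* w)
      rhs = solve 4 (λ s b e w → ((s :* b :+ e :* (con ½ :* w)) :+ con ½ :* b) :- (s :* b :+ con ½ :* b)
                                  := con ½ :* (e :* w)) refl
      reorder : ∀ w a b → ½ ℚ.* w ℚ.* (a ℚ.* b) ≡ ½ ℚ.* ((a ℚ.* w) ℚ.* b)
      reorder = solve 3 (λ w a b → con ½ :* w :* (a :* b) := con ½ :* ((a :* w) :* b)) refl
      κA≤ : κ ℚ.* A i ℚ.≤ ½ ℚ.* b
      κA≤ = begin
        κ ℚ.* A i ≡⟨ cong (κ ℚ.*_) (A≡ i) ⟩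
        κ ℚ.* (ζ i ℚ.* b) ≡⟨ reorder w (ζ i) b ⟩
        ½ ℚ.* ((ζ i ℚ.* w) ℚ.* b) ≤⟨ ℚ.*-monoˡ-≤-nonNeg ½ (ℚ.*-monoʳ-≤-nonNeg b {{b≥0}} (ζw≤1 i)) ⟩
        ½ ℚ.* (1ℚ ℚ.* b) ≡⟨ cong (½ ℚ.*_) (ℚ.*-identityˡ b) ⟩
        ½ ℚ.* b ∎
    small : ∀ j → A j ℚ.≤ ε
    small j = begin
      A j ≤⟨ A≤ j ⟩
      ζ j ℚ.* b ≤⟨ ℚ.*-monoˡ-≤-nonNeg (ζ j) {{ι-nonNeg (z j)}} (ℚ.*-cancelˡ-≤-pos ½ b≤) ⟩
      ζ j ℚ.* (ε ℚ.* w) ≡⟨ reorder (ζ j) ε w ⟩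
      ε ℚ.* (ζ j ℚ.* w) ≤⟨ ℚ.*-monoˡ-≤-nonNeg ε {{ℚ.pos⇒nonNeg ε {{ε>0}}}} (ζw≤1 j) ⟩
      ε ℚ.* 1ℚ ≡⟨ ℚ.*-identityʳ ε ⟩
      ε ∎
      where
      open +-*-Solver
      reorder : ∀ a b c → a ℚ.* (b ℚ.* c) ≡ b ℚ.* (a ℚ.* c)
      reorder = solve 3 (λ a b c → a :* (b :* c) := b :* (a :* c)) refl

  vanish : ∀ ε → .{{ε>0 : ℚ.Positive ε}} → ∀ i → Eventually λ m → ∣ seq (x i) m ℚ.- 0ℚ ∣ℚ ℚ.≤ ε
  vanish ε i = proj₁ close ℕ.⊔ proj₁ large , λ m le →
    subst (λ a → ∣ a ∣ℚ ℚ.≤ ε) (sym (ℚ.+-identityʳ (seq (x i) m)))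
      (small ε (ℚ.positive (ℚ.positive⁻¹ ε)) m
        (proj₂ close m (ℕ.m⊔n≤o⇒m≤o (proj₁ close) (proj₁ large) le))
        (subst (λ a → a ℚ.≤ seq q m ℚ.+ κ) (ι-def T)
          (proj₂ large m (ℕ.m⊔n≤o⇒n≤o (proj₁ close) (proj₁ large) le))) i)
    where
    close : Eventually λ m → ∀ i → ∣ seq ((signlessLaplacian G *ᵥ x) i) m ℚ.- seq q m ℚ.* seq (x i) m ∣ℚ ℚ.≤ ε ℚ.* κ
    close = eventually-∀ λ i → eigen i (ε ℚ.* κ) {{ℚ.pos*pos⇒pos ε κ {{κ>0}}}}
    large : Eventually λ m → + T ℚ./ 1 ℚ.≤ seq q m ℚ.+ κ
    large = T≤q κ {{κ>0}}

-- Few missing edges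

-- A vertex violating the row condition for the degree vector has few non-neighbours,
-- and its neighbours have few non-neighbours on average.
sparse : ∀ {n s N} (G : Graph (Fin n)) → n ≡ s + 1 + N → ∀ v → 1 ≤ degree G v →
  2 * N * degree G v ≤ ∑ (λ w → adj G v w * (degree G v + degree G w)) → ∑ (codegree G) ≤ 2 * s * n
sparse {n} {s} {N} G n≡ v 1≤d row = begin
  ∑ (codegree G) ≤⟨ total ⟩
  C₁ + c * n ≡⟨ cong (λ z → C₁ + c * z) (sym (degree+codegree G v)) ⟩
  C₁ + c * (d + c + 1) ≡⟨ arith₁ C₁ c d ⟩
  (C₁ + c * d) + c * (c + 1) ≤⟨ ℕ.+-mono-≤ average (ℕ.*-monoˡ-≤ (c + 1) c≤2s) ⟩
  2 * s * d + 2 * s * (c + 1) ≡⟨ ℕ.*-distribˡ-+ (2 * s) d (c + 1) ⟨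
  2 * s * (d + (c + 1)) ≡⟨ cong (λ z → 2 * s * z) (trans (sym (ℕ.+-assoc d c 1)) (degree+codegree G v)) ⟩
  2 * s * n ∎
  where
  open ℕ.≤-Reasoning
  d c C₁ S₁ : ℕ
  d = degree G v
  c = codegree G v
  C₁ = ∑ (λ w → adj G v w * codegree G w)
  S₁ = ∑ (λ w → adj G v w * degree G w)
  na : Fin n → ℕ
  na w = ind (nonAdj? G v w)
  arith₁ : ∀ a c d → a + c * (d + c + 1) ≡ (a + c * d) + c * (c + 1)
  arith₁ = solve-∀
  adj-const : ∀ a → ∑ (λ w → adj G v w * a) ≡ a * d
  adj-const a = trans (sum-cong-≗ λ w → ℕ.*-comm (adj G v w) a)
    (trans (sym (*-distribˡ-sum a (adj G v))) (cong (a *_) (sym (degree-∑ G v))))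
  C₁+S₁ : C₁ + S₁ + d ≡ n * d
  C₁+S₁ = begin-equality
    C₁ + S₁ + d
      ≡⟨ cong₂ _+_ (sym (∑-distrib-+ (λ w → adj G v w * codegree G w) (λ w → adj G v w * degree G w))) (degree-∑ G v) ⟩
    ∑ (λ w → adj G v w * codegree G w + adj G v w * degree G w) + ∑ (adj G v)
      ≡⟨ ∑-distrib-+ (λ w → adj G v w * codegree G w + adj G v w * degree G w) (adj G v) ⟨
    ∑ (λ w → adj G v w * codegree G w + adj G v w * degree G w + adj G v w)
      ≡⟨ sum-cong-≗ (λ w → trans (factor (adj G v w) (codegree G w) (degree G w))
           (cong (adj G v w *_) (degree+codegree G w))) ⟩
    ∑ (λ w → adj G v w * n)
      ≡⟨ adj-const n ⟩
    n * d ∎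
    where
    factor : ∀ a b c → a * b + a * c + a ≡ a * (c + b + 1)
    factor = solve-∀
  row′ : 2 * N * d ≤ d * d + S₁
  row′ = ℕ.≤-trans row (ℕ.≤-reflexive (trans
    (sum-cong-≗ λ w → ℕ.*-distribˡ-+ (adj G v w) d (degree G w))
    (trans (∑-distrib-+ (λ w → adj G v w * d) (λ w → adj G v w * degree G w)) (cong (λ z → z + S₁) (adj-const d)))))
  -- Put `d = n - 1 - c` and replace each neighbour's degree by n - 1 minus its codegree: the row
  -- then says that C₁ + cd is at most 2(n - 1 - N)d.
  average : C₁ + c * d ≤ 2 * s * d
  average = ℕ.+-cancelʳ-≤ (d * d + S₁ + d + 2 * N * d + d) (C₁ + c * d) (2 * s * d) (begin
    C₁ + c * d + (d * d + S₁ + d + 2 * N * d + d) ≡⟨ arith₂ C₁ c d S₁ N ⟩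
    (C₁ + S₁ + d) + (d + c + 1) * d + 2 * N * d ≡⟨ cong₂ (λ a b → a + b * d + 2 * N * d) C₁+S₁ (degree+codegree G v) ⟩
    n * d + n * d + 2 * N * d ≤⟨ ℕ.+-monoʳ-≤ (n * d + n * d) row′ ⟩
    n * d + n * d + (d * d + S₁) ≡⟨ cong (λ z → z * d + z * d + (d * d + S₁)) n≡ ⟩
    (s + 1 + N) * d + (s + 1 + N) * d + (d * d + S₁) ≡⟨ arith₃ s N d S₁ ⟩
    2 * s * d + (d * d + S₁ + d + 2 * N * d + d) ∎)
    where
    arith₂ : ∀ a c d e N → a + c * d + (d * d + e + d + 2 * N * d + d) ≡ (a + e + d) + (d + c + 1) * d + 2 * N * d
    arith₂ = solve-∀
    arith₃ : ∀ s N d e → (s + 1 + N) * d + (s + 1 + N) * d + (d * d + e) ≡ 2 * s * d + (d * d + e + d + 2 * N * d + d)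
    arith₃ = solve-∀
  c≤2s : c ≤ 2 * s
  c≤2s = ℕ.*-cancelʳ-≤ c (2 * s) d {{ℕ.>-nonZero 1≤d}} (ℕ.≤-trans (ℕ.m≤n+m (c * d) C₁) average)
  -- Each of the c non-neighbours of `v` contributes at most n - 1, and `v` itself contributes c.
  total : ∑ (codegree G) ≤ C₁ + c * n
  total = begin
    ∑ (codegree G)
      ≡⟨ sum-cong-≗ (λ w → trans (sym (ℕ.*-identityˡ (codegree G w))) (trans
           (cong (λ z → z * codegree G w) (sym (adj+nonAdj G v w)))
           (split (adj G v w) (na w) (ind (w Fin.≟ v)) (codegree G w)))) ⟩
    ∑ (λ w → adj G v w * codegree G w + na w * codegree G w + ind (w Fin.≟ v) * codegree G w)
      ≡⟨ ∑-distrib-+ (λ w → adj G v w * codegree G w + na w * codegree G w) (λ w → ind (w Fin.≟ v) * codegree G w) ⟩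
    ∑ (λ w → adj G v w * codegree G w + na w * codegree G w) + ∑ (λ w → ind (w Fin.≟ v) * codegree G w)
      ≡⟨ cong₂ _+_ (∑-distrib-+ (λ w → adj G v w * codegree G w) (λ w → na w * codegree G w)) (∑-δ (codegree G) v) ⟩
    C₁ + ∑ (λ w → na w * codegree G w) + c
      ≡⟨ ℕ.+-assoc C₁ _ c ⟩
    C₁ + (∑ (λ w → na w * codegree G w) + c)
      ≡⟨ cong (λ z → C₁ + z) (∑-distrib-+ (λ w → na w * codegree G w) na) ⟨
    C₁ + ∑ (λ w → na w * codegree G w + na w)
      ≤⟨ ℕ.+-monoʳ-≤ C₁ (∑-mono λ w → ℕ.≤-trans (ℕ.≤-reflexive (suc-out (na w) (codegree G w)))
           (ℕ.*-monoʳ-≤ (na w) (ℕ.≤-trans (ℕ.m≤n+m (codegree G w + 1) (degree G w))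
             (ℕ.≤-reflexive (trans (sym (ℕ.+-assoc (degree G w) (codegree G w) 1)) (degree+codegree G w)))))) ⟩
    C₁ + ∑ (λ w → na w * n)
      ≡⟨ cong (λ z → C₁ + z) (trans (sum-cong-≗ λ w → ℕ.*-comm (na w) n)
           (trans (sym (*-distribˡ-sum n na)) (ℕ.*-comm n c))) ⟩
    C₁ + c * n ∎
    where
    split : ∀ a b d e → (a + b + d) * e ≡ a * e + b * e + d * e
    split = solve-∀
    suc-out : ∀ a b → a * b + a ≡ a * (b + 1)
    suc-out = solve-∀

-- Edge lists as matrices

module _ {n : ℕ} where

  hit : Fin n → Fin n → Edge n → ℕ
  hit v w (a , b) = ind (v Fin.≟ a) * ind (w Fin.≟ b) + ind (v Fin.≟ b) * ind (w Fin.≟ a)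

  hit-cases : ∀ v w {a b} → a ≢ b → hit v w (a , b) ≡ 0 ⊎
    (hit v w (a , b) ≤ 1 × ((a , b) ≡ (v , w) ⊎ (a , b) ≡ (w , v)))
  hit-cases v w {a} {b} a≢b = go (v Fin.≟ a) (w Fin.≟ b) (v Fin.≟ b) (w Fin.≟ a)
    where
    go : (p : Dec (v ≡ a)) (q : Dec (w ≡ b)) (r : Dec (v ≡ b)) (t : Dec (w ≡ a)) →
      ind p * ind q + ind r * ind t ≡ 0 ⊎ (ind p * ind q + ind r * ind t ≤ 1 × ((a , b) ≡ (v , w) ⊎ (a , b) ≡ (w , v)))
    go (yes refl) _          (yes refl) _          = contradiction refl a≢b
    go (yes refl) (yes refl) (no _)     _          = inj₂ (ℕ.≤-refl , inj₁ refl)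
    go (yes refl) (no _)     (no _)     _          = inj₁ refl
    go (no _)     _          (yes refl) (yes refl) = inj₂ (ℕ.≤-refl , inj₂ refl)
    go (no _)     _          (yes refl) (no _)     = inj₁ refl
    go (no _)     _          (no _)     _          = inj₁ refl

  Different : Edge n → Edge n → Set
  Different (a , b) (c , d) = (a , b) ≢ (c , d) × (a , b) ≢ (d , c)

  -- For pairwise different edges this is the adjacency matrix of the graph with edge list `es`, and
  -- its row sums are the degrees there.
  multiplicity : List (Edge n) → Fin n → Fin n → ℕ
  multiplicity es v w = Σˡ (hit v w) es

  -- Two listed edges that hit the same pair `v`, `w` would coincide up to orientation, so at most
  -- one does.
  multiplicity≤ : ∀ {P : Fin n → Fin n → Set} (P? : ∀ v w → Dec (P v w)) (P-sym : ∀ {v w} → P v w → P w v)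
    (P-irrefl : ∀ {v w} → P v w → v ≢ w) es → All (uncurry P) es → AllPairs Different es →
    ∀ v w → multiplicity es v w ≤ ind (P? v w)
  multiplicity≤ P? P-sym P-irrefl []       _        _        v w = z≤n
  multiplicity≤ {P} P? P-sym P-irrefl ((a , b) ∷ es) (p ∷ ps) (d ∷ ds) v w with hit-cases v w (P-irrefl p)
  ... | inj₁ eq = ℕ.≤-trans (ℕ.+-monoˡ-≤ _ (ℕ.≤-reflexive eq)) (multiplicity≤ P? P-sym P-irrefl es ps ds v w)
  ... | inj₂ (le , vw) = ℕ.≤-trans (ℕ.+-mono-≤ le (ℕ.≤-reflexive (Σˡ-zero es λ {f} f∈ →
            miss vw (All.lookup ps f∈) (All.lookup d f∈))))
          (ℕ.≤-reflexive (sym (ind-yes (P? v w) (P-vw vw))))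
    where
    P-vw : (a , b) ≡ (v , w) ⊎ (a , b) ≡ (w , v) → P v w
    P-vw (inj₁ refl) = p
    P-vw (inj₂ refl) = P-sym p
    miss : (a , b) ≡ (v , w) ⊎ (a , b) ≡ (w , v) → ∀ {f} → uncurry P f → Different (a , b) f → hit v w f ≡ 0
    miss vw {f} q (d₁ , d₂) with hit-cases v w (P-irrefl q)
    ... | inj₁ eq = eq
    miss (inj₁ refl) q (d₁ , d₂) | inj₂ (_ , inj₁ refl) = contradiction refl d₁
    miss (inj₁ refl) q (d₁ , d₂) | inj₂ (_ , inj₂ refl) = contradiction refl d₂
    miss (inj₂ refl) q (d₁ , d₂) | inj₂ (_ , inj₁ refl) = contradiction refl d₂
    miss (inj₂ refl) q (d₁ , d₂) | inj₂ (_ , inj₂ refl) = contradiction refl d₁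

  multiplicity-total : ∀ es → ∑ (λ v → ∑ (multiplicity es v)) ≡ 2 * length es
  multiplicity-total es = begin
    ∑ (λ v → ∑ (multiplicity es v)) ≡⟨ sum-cong-≗ (λ v → ∑-Σˡ-comm (hit v) es) ⟩
    ∑ (λ v → Σˡ (λ e → ∑ (λ w → hit v w e)) es) ≡⟨ sum-cong-≗ (λ v → Σˡ-cong es (λ e → row v e)) ⟩
    ∑ (λ v → Σˡ (λ (a , b) → ind (v Fin.≟ a) + ind (v Fin.≟ b)) es)
      ≡⟨ ∑-Σˡ-comm (λ v (a , b) → ind (v Fin.≟ a) + ind (v Fin.≟ b)) es ⟩
    Σˡ (λ (a , b) → ∑ (λ v → ind (v Fin.≟ a) + ind (v Fin.≟ b))) es
      ≡⟨ Σˡ-cong es (λ (a , b) → trans (∑-distrib-+ (λ v → ind (v Fin.≟ a)) (λ v → ind (v Fin.≟ b)))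
           (cong₂ _+_ (∑-δ₁ a) (∑-δ₁ b))) ⟩
    Σˡ (λ _ → 2) es ≡⟨ trans (Σˡ-const 2 es) (ℕ.*-comm (length es) 2) ⟩
    2 * length es ∎
    where
    open ≡-Reasoning
    row : ∀ v e → ∑ (λ w → hit v w e) ≡ ind (v Fin.≟ proj₁ e) + ind (v Fin.≟ proj₂ e)
    row v (a , b) = trans (∑-distrib-+ (λ w → ind (v Fin.≟ a) * ind (w Fin.≟ b)) (λ w → ind (v Fin.≟ b) * ind (w Fin.≟ a)))
      (cong₂ _+_ (one (ind (v Fin.≟ a)) b) (one (ind (v Fin.≟ b)) a))
      where
      one : ∀ c u → ∑ (λ w → c * ind (w Fin.≟ u)) ≡ c
      one c u = trans (sym (*-distribˡ-sum c (λ w → ind (w Fin.≟ u)))) (trans (cong (c *_) (∑-δ₁ u)) (ℕ.*-identityʳ c))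

-- The test vector

-- Each requirement of the row estimates on the clique size is one summand, recovered by `summands`;
-- `m` is the number of deleted edges.
threshold : ℕ → ℕ → ℕ → ℕ
threshold s y m = C * (y + 2 * m) + s * C + 2 * (2 * m) + (2 * s + y + 2) * (y + 1) + s + 2
  where C = s * s + s * (y + 1) + 4 * (2 * m) + 1

summands : ∀ {a b c d e N} → a + b + c + d + e + 2 ≤ N →
  a + 1 ≤ N × b ≤ N × c ≤ N × d ≤ N × e + 1 ≤ N
summands {a} {b} {c} {d} {e} {N} le =
    part _ (arith₁ a b c d e) , part _ (arith₂ a b c d e) , part _ (arith₃ a b c d e)
  , part _ (arith₄ a b c d e) , part _ (arith₅ a b c d e)
  where
  part : ∀ {i} j → i + j ≡ a + b + c + d + e + 2 → i ≤ N
  part {i} j eq = ℕ.≤-trans (ℕ.m≤m+n i j) (ℕ.≤-trans (ℕ.≤-reflexive eq) le)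
  arith₁ : ∀ a b c d e → a + 1 + (b + c + d + e + 1) ≡ a + b + c + d + e + 2
  arith₁ = solve-∀
  arith₂ : ∀ a b c d e → b + (a + c + d + e + 2) ≡ a + b + c + d + e + 2
  arith₂ = solve-∀
  arith₃ : ∀ a b c d e → c + (a + b + d + e + 2) ≡ a + b + c + d + e + 2
  arith₃ = solve-∀
  arith₄ : ∀ a b c d e → d + (a + b + c + e + 2) ≡ a + b + c + d + e + 2
  arith₄ = solve-∀
  arith₅ : ∀ a b c d e → e + 1 + (a + b + c + d + 1) ≡ a + b + c + d + e + 2
  arith₅ = solve-∀

-- The test vector is constant on the high vertices up to first-order corrections: a vertex of the clique
-- gains s/N if it lies in Y and loses 2/N for every deleted edge. These gains sum to less than zero,
-- and the margin of order 1/N absorbs the second-order terms collected in C.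
module _ {n : ℕ} (G : Graph (Fin n)) {P : Set} {s y : ℕ} (S : Structure G P s y)
         (es : List (Edge n))
         (missing : All (λ (a , b) → NonAdj G a b × ¬ Structure.X S a × ¬ Structure.X S b) es)
         (distinct : AllPairs Different es) (many : s * y + 1 ≤ 4 * length es) where

  open Structure S

  private
    mult : Fin n → Fin n → ℕ
    mult = multiplicity es
    M c₁ C : ℕ
    M = 2 * length es
    -- Vertices of `X` get weight `(y + 1) * N`. Their row needs 2yN² for the y neighbours in `Y`,
    -- each of weight at most 2N², and the remaining 2N² of 2N(y + 1)N covers everything of lower
    -- order.
    c₁ = y + 1
    -- These are the coefficients that accumulate in `second-order`: two from the neighbours in `X`,
    -- `4 * M` from the deleted edges, and 1 to absorb `s * C`, which is at most `N`.
    C = s * s + s * c₁ + 4 * M + 1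

  module _ {N : ℕ} (n≡ : n ≡ s + N) (large : threshold s y (length es) ≤ N) where

    private
      𝟙X 𝟙Y 𝟙A del sp zA z : Fin n → ℕ
      𝟙X v = ind (X? v)
      𝟙Y v = ind (Y? v)
      𝟙A v = ind (¬? (X? v))
      del v = ∑ (mult v)
      sp v = 𝟙Y v + del v
      -- All weights are scaled by N², so the vector is integral and the first-order corrections are
      -- multiples of `N`.
      zA v = N * (N ∸ 2 * del v) + N * s * 𝟙Y v + C * sp v
      z v = 𝟙X v * (c₁ * N) + 𝟙A v * zA v

    ∑del : ∑ del ≡ M
    ∑del = multiplicity-total es

    ∑sp : ∑ sp ≡ y + M
    ∑sp = trans (∑-distrib-+ 𝟙Y del) (cong₂ _+_ ∣Y∣ ∑del)

    bounds = summands {C * (y + M)} {s * C} {2 * M} {(2 * s + y + 2) * c₁} {s} large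

    N≥₁ : C * (y + M) + 1 ≤ N
    N≥₁ = proj₁ bounds

    N≥₂ : s * C ≤ N
    N≥₂ = proj₁ (proj₂ bounds)

    N≥₃ : 2 * M ≤ N
    N≥₃ = proj₁ (proj₂ (proj₂ bounds))

    N≥₄ : (2 * s + y + 2) * c₁ ≤ N
    N≥₄ = proj₁ (proj₂ (proj₂ (proj₂ bounds)))

    N≥₅ : s + 1 ≤ N
    N≥₅ = proj₂ (proj₂ (proj₂ (proj₂ bounds)))

    1≤N : 1 ≤ N
    1≤N = ℕ.≤-trans (ℕ.m≤n+m 1 s) N≥₅

    pair? : ∀ v w → Dec (NonAdj G v w × ¬ X v × ¬ X w)
    pair? v w = nonAdj? G v w ×-dec (¬? (X? v) ×-dec ¬? (X? w))

    mult-pair : ∀ v w → mult v w ≤ ind (pair? v w)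
    mult-pair = multiplicity≤ pair? (λ (na , ¬Xv , ¬Xw) → nonAdj-sym {G = G} na , ¬Xw , ¬Xv)
      (proj₁ ∘ proj₁) es missing distinct

    mult≤ : ∀ v w → mult v w ≤ ind (nonAdj? G v w)
    mult≤ v w = ℕ.≤-trans (mult-pair v w) (ind-mono (pair? v w) (nonAdj? G v w) proj₁)

    missing-X : ∀ {v w} → ¬ (¬ X v × ¬ X w) → mult v w ≡ 0
    missing-X {v} {w} X∨X = ℕ.n≤0⇒n≡0
      (ℕ.≤-trans (mult-pair v w) (ℕ.≤-reflexive (ind-no (pair? v w) (X∨X ∘ proj₂))))

    del-X : ∀ {v} → X v → del v ≡ 0
    del-X {v} Xv = trans (sum-cong-≗ {n} {mult v} {λ _ → 0} λ w → missing-X {v} {w} λ (¬Xv , _) → ¬Xv Xv) (∑-zero n)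

    del≤M : ∀ v → del v ≤ M
    del≤M v = ℕ.≤-trans (f≤∑f del v) (ℕ.≤-reflexive ∑del)

    -- Removes the truncated subtraction, which is exact because `2 * M ≤ N`.
    zA+ : ∀ v → zA v + 2 * N * del v ≡ N * N + N * s * 𝟙Y v + C * sp v
    zA+ v = begin
      N * k + a + b + 2 * N * del v ≡⟨ arith N k a b (del v) ⟩
      N * (k + 2 * del v) + a + b ≡⟨ cong (λ q → N * q + a + b) (ℕ.m∸n+n≡m
                                              (ℕ.≤-trans (ℕ.*-monoʳ-≤ 2 (del≤M v)) N≥₃)) ⟩
      N * N + a + b ∎
      where
      open ≡-Reasoning
      k a b : ℕ
      k = N ∸ 2 * del v
      a = N * s * 𝟙Y v
      b = C * sp v
      arith : ∀ N k a b d → N * k + a + b + 2 * N * d ≡ N * (k + 2 * d) + a + b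
      arith = solve-∀

    zA≥ : ∀ v → N * N ≤ zA v + 2 * N * M
    zA≥ v = ℕ.≤-trans (ℕ.≤-trans (ℕ.≤-trans (ℕ.m≤m+n (N * N) _) (ℕ.≤-reflexive (sym (ℕ.+-assoc (N * N) _ _))))
      (ℕ.≤-reflexive (sym (zA+ v)))) (ℕ.+-monoʳ-≤ (zA v) (ℕ.*-monoʳ-≤ (2 * N) (del≤M v)))

    zA≤ : ∀ v → zA v ≤ N * N + N * s * 𝟙Y v + C * sp v
    zA≤ v = ℕ.≤-trans (ℕ.m≤m+n (zA v) _) (ℕ.≤-reflexive (zA+ v))

    z-X : ∀ {v} → X v → z v ≡ c₁ * N
    z-X {v} Xv = trans (cong₂ (λ a b → a * (c₁ * N) + b * zA v) (ind-yes (X? v) Xv) (ind-no (¬? (X? v)) λ ¬Xv → ¬Xv Xv))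
      (arith (c₁ * N))
      where
      arith : ∀ a → 1 * a + 0 ≡ a
      arith = solve-∀

    z-A : ∀ {v} → ¬ X v → z v ≡ zA v
    z-A {v} ¬Xv = trans (cong₂ (λ a b → a * (c₁ * N) + b * zA v) (ind-no (X? v) ¬Xv) (ind-yes (¬? (X? v)) ¬Xv))
      (ℕ.*-identityˡ (zA v))

    row-X : ∀ {v} → X v → ∑ (λ w → adj G v w * (z v + z w)) + 2 * z v + 1 ≤ 2 * N * z v
    row-X {v} Xv = begin
      ∑ (λ w → adj G v w * (z v + z w)) + 2 * z v + 1
        ≤⟨ ℕ.+-monoˡ-≤ 1 (ℕ.+-monoˡ-≤ (2 * z v) (∑-mono point)) ⟩
      ∑ (λ w → a * 𝟙X w + b * 𝟙Y w) + 2 * z v + 1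
        ≡⟨ cong₂ (λ p q → p + 2 * q + 1) (trans (∑-distrib-+ (λ w → a * 𝟙X w) (λ w → b * 𝟙Y w))
             (cong₂ _+_ (∑-scale a 𝟙X ∣X∣)
                        (∑-scale b 𝟙Y ∣Y∣))) (z-X Xv) ⟩
      a * s + b * y + 2 * (c₁ * N) + 1
        ≡⟨ arith₁ s y N ⟩
      (2 * s + y + 2) * c₁ * N + 1 + 2 * y * (N * N)
        ≤⟨ ℕ.+-monoˡ-≤ (2 * y * (N * N)) (ℕ.+-mono-≤ (ℕ.*-monoˡ-≤ N N≥₄) (ℕ.*-mono-≤ 1≤N 1≤N)) ⟩
      N * N + N * N + 2 * y * (N * N)
        ≡⟨ arith₂ y N ⟩
      2 * N * (c₁ * N)
        ≡⟨ cong (2 * N *_) (z-X Xv) ⟨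
      2 * N * z v ∎
      where
      open ℕ.≤-Reasoning
      a b : ℕ
      a = 2 * (c₁ * N)
      b = c₁ * N + 2 * (N * N)
      arith₁ : ∀ s y N → 2 * ((y + 1) * N) * s + ((y + 1) * N + 2 * (N * N)) * y + 2 * ((y + 1) * N) + 1
                       ≡ (2 * s + y + 2) * (y + 1) * N + 1 + 2 * y * (N * N)
      arith₁ = solve-∀
      arith₂ : ∀ y N → N * N + N * N + 2 * y * (N * N) ≡ 2 * N * ((y + 1) * N)
      arith₂ = solve-∀
      zA≤2N² : ∀ w → zA w ≤ 2 * (N * N)
      zA≤2N² w = begin
        zA w ≤⟨ zA≤ w ⟩
        N * N + N * s * 𝟙Y w + C * sp w ≤⟨ ℕ.+-mono-≤ (ℕ.+-monoʳ-≤ (N * N) (ℕ.≤-trans (ℕ.*-monoʳ-≤ (N * s) (ind≤1 (Y? w)))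
                                               (ℕ.≤-reflexive (ℕ.*-identityʳ (N * s)))))
                                               (ℕ.≤-trans (ℕ.*-monoʳ-≤ C (ℕ.≤-trans (f≤∑f sp w) (ℕ.≤-reflexive ∑sp)))
                                                 (ℕ.≤-trans (ℕ.m≤m+n (C * (y + M)) 1) N≥₁)) ⟩
        N * N + N * s + N ≡⟨ arith₃ N s ⟩
        N * N + N * (s + 1) ≤⟨ ℕ.+-monoʳ-≤ (N * N) (ℕ.*-monoʳ-≤ N N≥₅) ⟩
        N * N + N * N ≡⟨ cong (λ q → N * N + q) (ℕ.+-identityʳ (N * N)) ⟨
        2 * (N * N) ∎
        where
        arith₃ : ∀ N s → N * N + N * s + N ≡ N * N + N * (s + 1)
        arith₃ = solve-∀
      point : ∀ w → adj G v w * (z v + z w) ≤ a * 𝟙X w + b * 𝟙Y w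
      point w = go (X? w) (Y? w) (adj? G v w) (z-X {w}) (z-A {w})
        where
        go : (p : Dec (X w)) (q : Dec (Y w)) (r : Dec (Adj G v w)) → (X w → z w ≡ c₁ * N) → (¬ X w → z w ≡ zA w) →
          ind r * (z v + z w) ≤ a * ind p + b * ind q
        go p q (no _) _ _ = z≤n
        go (no ¬Xw) (no ¬Yw) (yes v~w) _ _ = contradiction v~w (X-Z Xv ¬Xw ¬Yw)
        go (yes Xw) q (yes _) eq _ = ℕ.≤-trans (ℕ.≤-reflexive (trans (cong₂ (λ i j → 1 * (i + j)) (z-X Xv) (eq Xw)) (arith (c₁ * N) )))
                                     (ℕ.m≤m+n (a * 1) _)
          where
          arith : ∀ i → 1 * (i + i) ≡ 2 * i * 1
          arith = solve-∀
        go (no ¬Xw) (yes Yw) (yes _) _ eq = begin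
          1 * (z v + z w) ≡⟨ cong₂ (λ i j → 1 * (i + j)) (z-X Xv) (eq ¬Xw) ⟩
          1 * (c₁ * N + zA w) ≤⟨ ℕ.*-monoʳ-≤ 1 (ℕ.+-monoʳ-≤ (c₁ * N) (zA≤2N² w)) ⟩
          1 * b ≡⟨ arith a b ⟩
          a * 0 + b * 1 ∎
          where
          arith : ∀ i j → 1 * j ≡ i * 0 + j * 1
          arith = solve-∀

    ∑𝟙A : ∑ 𝟙A ≡ N
    ∑𝟙A = ℕ.+-cancelˡ-≡ s (∑ 𝟙A) N (begin
      s + ∑ 𝟙A ≡⟨ cong (λ a → a + ∑ 𝟙A) (sym ∣X∣) ⟩
      ∑ 𝟙X + ∑ 𝟙A ≡⟨ ∑-distrib-+ 𝟙X 𝟙A ⟨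
      ∑ (λ v → 𝟙X v + 𝟙A v) ≡⟨ sum-cong-≗ (λ v → go (X? v)) ⟩
      ∑ {n} (λ _ → 1) ≡⟨ trans (∑-const n 1) (ℕ.*-identityʳ n) ⟩
      n ≡⟨ n≡ ⟩
      s + N ∎)
      where
      open ≡-Reasoning
      go : ∀ {Q} (d : Dec Q) → ind d + ind (¬? d) ≡ 1
      go (yes _) = refl
      go (no _)  = refl

    -- Here the number of deleted edges enters: the corrections gain `N * (s * y)` and lose N ·
    -- 4|es|, so `many` leaves a margin of `N`.
    ∑𝟙A-zA : ∑ (λ w → 𝟙A w * zA w) + N ≤ N * (N * N) + C * (y + M)
    ∑𝟙A-zA = ℕ.+-cancelʳ-≤ (N * (s * y)) (T + N) (N * (N * N) + C * (y + M)) (begin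
      T + N + N * (s * y)
        ≡⟨ arith₁ T N (s * y) ⟩
      T + N * (s * y + 1)
        ≤⟨ ℕ.+-monoʳ-≤ T (ℕ.*-monoʳ-≤ N many) ⟩
      T + N * (4 * length es)
        ≡⟨ arith₂ T N (length es) ⟩
      T + 2 * N * M
        ≡⟨ cong (λ a → T + 2 * N * a) ∑del ⟨
      T + 2 * N * ∑ del
        ≡⟨ cong (λ a → T + a) (trans (*-distribˡ-sum (2 * N) del) (sum-cong-≗ λ w → cong (2 * N *_) (del-A w))) ⟩
      T + ∑ (λ w → 2 * N * (𝟙A w * del w))
        ≡⟨ ∑-distrib-+ (λ w → 𝟙A w * zA w) (λ w → 2 * N * (𝟙A w * del w)) ⟨
      ∑ (λ w → 𝟙A w * zA w + 2 * N * (𝟙A w * del w))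
        ≤⟨ ∑-mono point ⟩
      ∑ (λ w → (N * N) * 𝟙A w + (N * s) * 𝟙Y w + C * sp w)
        ≡⟨ ∑-distrib-+ (λ w → (N * N) * 𝟙A w + (N * s) * 𝟙Y w) (λ w → C * sp w) ⟩
      ∑ (λ w → (N * N) * 𝟙A w + (N * s) * 𝟙Y w) + ∑ (λ w → C * sp w)
        ≡⟨ cong₂ _+_ (∑-distrib-+ (λ w → (N * N) * 𝟙A w) (λ w → (N * s) * 𝟙Y w))
             (∑-scale C sp ∑sp) ⟩
      ∑ (λ w → (N * N) * 𝟙A w) + ∑ (λ w → (N * s) * 𝟙Y w) + C * (y + M)
        ≡⟨ cong₂ (λ a b → a + b + C * (y + M)) (∑-scale (N * N) 𝟙A ∑𝟙A)
             (∑-scale (N * s) 𝟙Y ∣Y∣) ⟩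
      N * N * N + N * s * y + C * (y + M)
        ≡⟨ arith₃ N s y (C * (y + M)) ⟩
      N * (N * N) + C * (y + M) + N * (s * y) ∎)
      where
      open ℕ.≤-Reasoning
      T = ∑ (λ w → 𝟙A w * zA w)
      arith₁ : ∀ T N a → T + N + N * a ≡ T + N * (a + 1)
      arith₁ = solve-∀
      arith₂ : ∀ T N l → T + N * (4 * l) ≡ T + 2 * N * (2 * l)
      arith₂ = solve-∀
      arith₃ : ∀ N s y c → N * N * N + N * s * y + c ≡ N * (N * N) + c + N * (s * y)
      arith₃ = solve-∀
      del-A : ∀ w → del w ≡ 𝟙A w * del w
      del-A w = go (X? w) (del-X {w})
        where
        go : (d : Dec (X w)) → (X w → del w ≡ 0) → del w ≡ ind (¬? d) * del w
        go (yes Xw) h = h Xw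
        go (no _)   h = sym (ℕ.*-identityˡ (del w))
      point : ∀ w → 𝟙A w * zA w + 2 * N * (𝟙A w * del w) ≤ (N * N) * 𝟙A w + (N * s) * 𝟙Y w + C * sp w
      point w = begin
        𝟙A w * zA w + 2 * N * (𝟙A w * del w) ≡⟨ factor (𝟙A w) (zA w) N (del w) ⟩
        𝟙A w * (zA w + 2 * N * del w) ≡⟨ cong (𝟙A w *_) (zA+ w) ⟩
        𝟙A w * (N * N + N * s * 𝟙Y w + C * sp w) ≡⟨ expand (𝟙A w) (N * N) (N * s * 𝟙Y w) (C * sp w) ⟩
        (N * N) * 𝟙A w + 𝟙A w * (N * s * 𝟙Y w) + 𝟙A w * (C * sp w)
          ≤⟨ ℕ.+-mono-≤ (ℕ.+-monoʳ-≤ (N * N * 𝟙A w) (drop-𝟙 (N * s * 𝟙Y w))) (drop-𝟙 (C * sp w)) ⟩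
        (N * N) * 𝟙A w + (N * s) * 𝟙Y w + C * sp w ∎
        where
        factor : ∀ a z N d → a * z + 2 * N * (a * d) ≡ a * (z + 2 * N * d)
        factor = solve-∀
        expand : ∀ a b c d → a * (b + c + d) ≡ b * a + a * c + a * d
        expand = solve-∀
        drop-𝟙 : ∀ b → 𝟙A w * b ≤ b
        drop-𝟙 b = ℕ.≤-trans (ℕ.*-monoˡ-≤ b (ind≤1 (¬? (X? w)))) (ℕ.≤-reflexive (ℕ.*-identityˡ b))

    module _ {v} (¬Xv : ¬ X v) where

      private
        R Q B : ℕ
        R = ∑ (λ w → adj G v w * (z v + z w))
        Q = ∑ (λ w → mult v w * (zA v + zA w))
        B = s * (𝟙Y v * (zA v + c₁ * N))

      -- The row is compared with that of a complete clique. `Q` is what the deleted edges take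
      -- away, `2 * zA v` the absent diagonal term, and `B` the contribution of `X`, present only
      -- for `v` in `Y`.
      row-bound : R + Q + 2 * zA v ≤ N * zA v + ∑ (λ w → 𝟙A w * zA w) + B
      row-bound = begin
        R + Q + 2 * zA v
          ≡⟨ cong (λ a → R + Q + a) (trans (cong (λ a → zA v + a) (ℕ.+-identityʳ (zA v))) (sym (∑-δ (λ w → zA v + zA w) v))) ⟩
        R + Q + ∑ (λ w → ind (w Fin.≟ v) * (zA v + zA w))
          ≡⟨ cong (λ a → a + ∑ (λ w → ind (w Fin.≟ v) * (zA v + zA w)))
               (∑-distrib-+ (λ w → adj G v w * (z v + z w)) (λ w → mult v w * (zA v + zA w))) ⟨
        ∑ (λ w → adj G v w * (z v + z w) + mult v w * (zA v + zA w)) + ∑ (λ w → ind (w Fin.≟ v) * (zA v + zA w))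
          ≡⟨ ∑-distrib-+ (λ w → adj G v w * (z v + z w) + mult v w * (zA v + zA w))
               (λ w → ind (w Fin.≟ v) * (zA v + zA w)) ⟨
        ∑ (λ w → adj G v w * (z v + z w) + mult v w * (zA v + zA w) + ind (w Fin.≟ v) * (zA v + zA w))
          ≤⟨ ∑-mono point ⟩
        ∑ (λ w → 𝟙A w * (zA v + zA w) + 𝟙X w * b)
          ≡⟨ sum-cong-≗ (λ w → expand (𝟙A w) (zA v) (zA w) (𝟙X w) b) ⟩
        ∑ (λ w → zA v * 𝟙A w + 𝟙A w * zA w + b * 𝟙X w)
          ≡⟨ ∑-distrib-+ (λ w → zA v * 𝟙A w + 𝟙A w * zA w) (λ w → b * 𝟙X w) ⟩
        ∑ (λ w → zA v * 𝟙A w + 𝟙A w * zA w) + ∑ (λ w → b * 𝟙X w)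
          ≡⟨ cong₂ _+_ (∑-distrib-+ (λ w → zA v * 𝟙A w) (λ w → 𝟙A w * zA w))
               (trans (∑-scale b 𝟙X ∣X∣) ((ℕ.*-comm b s))) ⟩
        ∑ (λ w → zA v * 𝟙A w) + ∑ (λ w → 𝟙A w * zA w) + s * b
          ≡⟨ cong (λ a → a + ∑ (λ w → 𝟙A w * zA w) + s * b)
               (trans (∑-scale (zA v) 𝟙A ∑𝟙A) ((ℕ.*-comm (zA v) N))) ⟩
        N * zA v + ∑ (λ w → 𝟙A w * zA w) + B ∎
        where
        open ℕ.≤-Reasoning
        b = 𝟙Y v * (zA v + c₁ * N)
        expand : ∀ a p q x b → a * (p + q) + x * b ≡ p * a + a * q + b * x
        expand = solve-∀
        point : ∀ w → adj G v w * (z v + z w) + mult v w * (zA v + zA w) + ind (w Fin.≟ v) * (zA v + zA w)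
                ≤ 𝟙A w * (zA v + zA w) + 𝟙X w * b
        point w = go (X? w)
          where
          t = zA v + zA w
          collect : ∀ a c d t → a * t + c * t + d * t ≡ (a + c + d) * t
          collect = solve-∀
          adj≤Y : X w → adj G v w ≤ 𝟙Y v
          adj≤Y Xw = ind-mono (adj? G v w) (Y? v) λ v~w → to-Y v~w (Y? v)
            where
            to-Y : Adj G v w → Dec (Y v) → Y v
            to-Y v~w (yes Yv) = Yv
            to-Y v~w (no ¬Yv) = contradiction (adj-sym G v~w) (X-Z Xw ¬Xv ¬Yv)
          go : (d : Dec (X w)) → adj G v w * (z v + z w) + mult v w * t + ind (w Fin.≟ v) * t
             ≤ ind (¬? d) * t + ind d * b
          go (yes Xw) = begin
            adj G v w * (z v + z w) + mult v w * t + ind (w Fin.≟ v) * t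
              ≡⟨ cong₂ (λ p q → adj G v w * (z v + z w) + p * t + q * t) (missing-X {v} {w} λ (_ , ¬Xw) → ¬Xw Xw)
                   (ind-no (w Fin.≟ v) λ { refl → ¬Xv Xw }) ⟩
            adj G v w * (z v + z w) + 0 + 0
              ≡⟨ zeros (adj G v w * (z v + z w)) ⟩
            1 * (adj G v w * (z v + z w))
              ≡⟨ cong₂ (λ p q → 1 * (adj G v w * (p + q))) (z-A ¬Xv) (z-X Xw) ⟩
            1 * (adj G v w * (zA v + c₁ * N))
              ≤⟨ ℕ.*-monoʳ-≤ 1 (ℕ.*-monoˡ-≤ (zA v + c₁ * N) (adj≤Y Xw)) ⟩
            1 * b ∎
            where
            zeros : ∀ a → a + 0 + 0 ≡ 1 * a
            zeros = solve-∀
          go (no ¬Xw) = begin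
            adj G v w * (z v + z w) + mult v w * t + ind (w Fin.≟ v) * t
              ≡⟨ cong₂ (λ p q → adj G v w * (p + q) + mult v w * t + ind (w Fin.≟ v) * t) (z-A ¬Xv) (z-A ¬Xw) ⟩
            adj G v w * t + mult v w * t + ind (w Fin.≟ v) * t
              ≡⟨ collect (adj G v w) (mult v w) (ind (w Fin.≟ v)) t ⟩
            (adj G v w + mult v w + ind (w Fin.≟ v)) * t
              ≤⟨ ℕ.*-monoˡ-≤ t (ℕ.+-monoˡ-≤ _ (ℕ.+-monoʳ-≤ (adj G v w) (mult≤ v w))) ⟩
            (adj G v w + ind (nonAdj? G v w) + ind (w Fin.≟ v)) * t
              ≡⟨ cong (_* t) (adj+nonAdj G v w) ⟩
            1 * t
              ≡⟨ ℕ.+-identityʳ (1 * t) ⟨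
            1 * t + 0 ∎

      -- Both ends of a deleted edge have weight at least N² - 2NM, so each such edge saves 2N² up
      -- to `4 * N * M`.
      deleted-bound : 2 * (N * N) * del v ≤ Q + 4 * N * M * del v
      deleted-bound = begin
        2 * (N * N) * del v
          ≡⟨ *-distribˡ-sum (2 * (N * N)) (mult v) ⟩
        ∑ (λ w → 2 * (N * N) * mult v w)
          ≤⟨ ∑-mono point ⟩
        ∑ (λ w → mult v w * (zA v + zA w) + 4 * N * M * mult v w)
          ≡⟨ ∑-distrib-+ (λ w → mult v w * (zA v + zA w)) (λ w → 4 * N * M * mult v w) ⟩
        Q + ∑ (λ w → 4 * N * M * mult v w)
          ≡⟨ cong (λ a → Q + a) (*-distribˡ-sum (4 * N * M) (mult v)) ⟨
        Q + 4 * N * M * del v ∎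
        where
        open ℕ.≤-Reasoning
        point : ∀ w → 2 * (N * N) * mult v w ≤ mult v w * (zA v + zA w) + 4 * N * M * mult v w
        point w = begin
          2 * (N * N) * m ≡⟨ arith₁ N m ⟩
          m * (N * N + N * N) ≤⟨ ℕ.*-monoʳ-≤ m (ℕ.+-mono-≤ (zA≥ v) (zA≥ w)) ⟩
          m * ((zA v + 2 * N * M) + (zA w + 2 * N * M)) ≡⟨ arith₂ m (zA v) (zA w) N M ⟩
          m * (zA v + zA w) + 4 * N * M * m ∎
          where
          m = mult v w
          arith₁ : ∀ N m → 2 * (N * N) * m ≡ m * (N * N + N * N)
          arith₁ = solve-∀
          arith₂ : ∀ m a b N M → m * ((a + 2 * N * M) + (b + 2 * N * M)) ≡ m * (a + b) + 4 * N * M * m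
          arith₂ = solve-∀

      B≤ : B ≤ s * (N * N) * 𝟙Y v + s * s * N * 𝟙Y v + s * c₁ * N * 𝟙Y v + s * C * sp v
      B≤ = go (Y? v) (zA≤ v)
        where
        open ℕ.≤-Reasoning
        go : (d : Dec (Y v)) → zA v ≤ N * N + N * s * ind d + C * sp v →
          s * (ind d * (zA v + c₁ * N)) ≤ s * (N * N) * ind d + s * s * N * ind d + s * c₁ * N * ind d + s * C * sp v
        go (no _)  _  = ℕ.≤-trans (ℕ.≤-reflexive (ℕ.*-zeroʳ s)) z≤n
        go (yes _) le = begin
          s * (1 * (zA v + c₁ * N))
            ≤⟨ ℕ.*-monoʳ-≤ s (ℕ.*-monoʳ-≤ 1 (ℕ.+-monoˡ-≤ (c₁ * N) le)) ⟩
          s * (1 * (N * N + N * s * 1 + C * sp v + c₁ * N))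
            ≡⟨ arith s N (C * sp v) c₁ ⟩
          s * (N * N) * 1 + s * s * N * 1 + s * c₁ * N * 1 + s * (C * sp v)
            ≡⟨ cong (λ a → s * (N * N) * 1 + s * s * N * 1 + s * c₁ * N * 1 + a) (ℕ.*-assoc s C (sp v)) ⟨
          s * (N * N) * 1 + s * s * N * 1 + s * c₁ * N * 1 + s * C * sp v ∎
          where
          arith : ∀ s N e c → s * (1 * (N * N + N * s * 1 + e + c * N))
                            ≡ s * (N * N) * 1 + s * s * N * 1 + s * c * N * 1 + s * e
          arith = solve-∀

      -- `N≥₁` and `N≥₂` pay for the terms with `C` on the left; the others match the coefficients
      -- in the definition of `C`, as `𝟙Y v` and `del v` are both at most `sp v`.
      second-order : C * (y + M) + 1 + (s * s * N * 𝟙Y v + s * c₁ * N * 𝟙Y v + s * C * sp v) + 4 * N * M * del v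
                     ≤ N + N * (C * sp v)
      second-order = begin
        C * (y + M) + 1 + (s * s * N * 𝟙Y v + s * c₁ * N * 𝟙Y v + s * C * sp v) + 4 * N * M * del v
          ≤⟨ ℕ.+-mono-≤ (ℕ.+-mono-≤ N≥₁ (ℕ.+-mono-≤ (ℕ.+-mono-≤ (ℕ.*-monoʳ-≤ (s * s * N) Y≤sp)
               (ℕ.*-monoʳ-≤ (s * c₁ * N) Y≤sp)) (ℕ.*-monoˡ-≤ (sp v) N≥₂)))
               (ℕ.*-monoʳ-≤ (4 * N * M) (ℕ.m≤n+m (del v) (𝟙Y v))) ⟩
        N + (s * s * N * sp v + s * c₁ * N * sp v + N * sp v) + 4 * N * M * sp v
          ≡⟨ arith N s c₁ M (sp v) ⟩
        N + N * (C * sp v) ∎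
        where
        open ℕ.≤-Reasoning
        Y≤sp : 𝟙Y v ≤ sp v
        Y≤sp = ℕ.m≤m+n (𝟙Y v) (del v)
        arith : ∀ N s c M p → N + (s * s * N * p + s * c * N * p + N * p) + 4 * N * M * p
                            ≡ N + N * ((s * s + s * c + 4 * M + 1) * p)
        arith = solve-∀

      -- The leading orders cancel: N times the correction in `zA v` equals the s N² gained from `X`
      -- for `v` in `Y`, minus the 2N² lost with each deleted edge at `v`. There remain
      -- `second-order` and the margin `N` of `∑𝟙A-zA`.
      row-A : R + 2 * z v + 1 ≤ 2 * N * z v
      row-A = subst (λ a → R + 2 * a + 1 ≤ 2 * N * a) (sym (z-A ¬Xv))
        (ℕ.+-cancelʳ-≤ (Q + 2 * (N * N) * D + N) (R + 2 * Z + 1) (2 * N * Z) (begin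
        R + 2 * Z + 1 + (Q + 2 * (N * N) * D + N)
          ≡⟨ arith₁ R Z Q (2 * (N * N) * D) N ⟩
        (R + Q + 2 * Z) + (2 * (N * N) * D + N + 1)
          ≤⟨ ℕ.+-mono-≤ row-bound (ℕ.+-monoˡ-≤ 1 (ℕ.+-monoˡ-≤ N deleted-bound)) ⟩
        (N * Z + T + B) + (Q + 4 * N * M * D + N + 1)
          ≡⟨ arith₂ (N * Z) T B Q (4 * N * M * D) N ⟩
        (T + N) + B + (N * Z + Q + 4 * N * M * D + 1)
          ≤⟨ ℕ.+-monoˡ-≤ _ (ℕ.+-mono-≤ ∑𝟙A-zA B≤) ⟩
        (N * (N * N) + C * (y + M)) + (s * (N * N) * 𝟙Y v + b₁ + b₂ + b₃) + (N * Z + Q + 4 * N * M * D + 1)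
          ≡⟨ arith₃ (N * (N * N)) (C * (y + M)) (s * (N * N) * 𝟙Y v) b₁ b₂ b₃ (N * Z) Q (4 * N * M * D) ⟩
        (C * (y + M) + 1 + (b₁ + b₂ + b₃) + 4 * N * M * D) + (N * (N * N) + s * (N * N) * 𝟙Y v + N * Z + Q)
          ≤⟨ ℕ.+-monoˡ-≤ _ second-order ⟩
        (N + N * (C * sp v)) + (N * (N * N) + s * (N * N) * 𝟙Y v + N * Z + Q)
          ≡⟨ arith₄ N s (𝟙Y v) (C * sp v) (N * Z) Q ⟩
        N * (N * N + N * s * 𝟙Y v + C * sp v) + (N * Z + Q + N)
          ≡⟨ cong (λ a → N * a + (N * Z + Q + N)) (zA+ v) ⟨
        N * (Z + 2 * N * D) + (N * Z + Q + N)
          ≡⟨ arith₅ N Z D Q ⟩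
        2 * N * Z + (Q + 2 * (N * N) * D + N) ∎))
        where
        open ℕ.≤-Reasoning
        Z D T b₁ b₂ b₃ : ℕ
        Z = zA v
        D = del v
        T = ∑ (λ w → 𝟙A w * zA w)
        b₁ = s * s * N * 𝟙Y v
        b₂ = s * c₁ * N * 𝟙Y v
        b₃ = s * C * sp v
        arith₁ : ∀ r z q d n → r + 2 * z + 1 + (q + d + n) ≡ (r + q + 2 * z) + (d + n + 1)
        arith₁ = solve-∀
        arith₂ : ∀ z t b q d n → (z + t + b) + (q + d + n + 1) ≡ (t + n) + b + (z + q + d + 1)
        arith₂ = solve-∀
        arith₃ : ∀ a c e f g h z q d → (a + c) + (e + f + g + h) + (z + q + d + 1)
                                     ≡ (c + 1 + (f + g + h) + d) + (a + e + z + q)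
        arith₃ = solve-∀
        arith₄ : ∀ N s y e z q → (N + N * e) + (N * (N * N) + s * (N * N) * y + z + q)
                               ≡ N * (N * N + N * s * y + e) + (z + q + N)
        arith₄ = solve-∀
        arith₅ : ∀ N z d q → N * (z + 2 * N * d) + (N * z + q + N) ≡ 2 * N * z + (q + 2 * (N * N) * d + N)
        arith₅ = solve-∀

    row : ∀ v → ∑ (λ w → adj G v w * (z v + z w)) < 2 * (N ∸ 1) * z v
    row v = ℕ.+-cancelʳ-≤ (2 * z v) (suc R) (2 * (N ∸ 1) * z v) (begin
      suc R + 2 * z v ≡⟨ arith₁ R (z v) ⟩
      R + 2 * z v + 1 ≤⟨ go (X? v) ⟩
      2 * N * z v ≡⟨ cong (λ a → 2 * a * z v) (ℕ.m∸n+n≡m 1≤N) ⟨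
      2 * (N ∸ 1 + 1) * z v ≡⟨ arith₂ (N ∸ 1) (z v) ⟩
      2 * (N ∸ 1) * z v + 2 * z v ∎)
      where
      open ℕ.≤-Reasoning
      R = ∑ (λ w → adj G v w * (z v + z w))
      arith₁ : ∀ r z → suc r + 2 * z ≡ r + 2 * z + 1
      arith₁ = solve-∀
      arith₂ : ∀ n z → 2 * (n + 1) * z ≡ 2 * n * z + 2 * z
      arith₂ = solve-∀
      go : Dec (X v) → R + 2 * z v + 1 ≤ 2 * N * z v
      go (yes Xv) = row-X Xv
      go (no ¬Xv) = row-A ¬Xv

    too-many-missing : ∀ q → IsEigenvalue (signlessLaplacian G) q → ¬ (fromℕ (2 * (N ∸ 1)) ≤ᴿ q)
    too-many-missing = collatz-wielandt G z (2 * (N ∸ 1)) row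

-- Block structure

data Tag : Set where
  tY tZ tX : Tag

_≟ᵀ_ : DecidableEquality Tag
tY ≟ᵀ tY = yes refl
tY ≟ᵀ tZ = no λ ()
tY ≟ᵀ tX = no λ ()
tZ ≟ᵀ tY = no λ ()
tZ ≟ᵀ tZ = yes refl
tZ ≟ᵀ tX = no λ ()
tX ≟ᵀ tY = no λ ()
tX ≟ᵀ tZ = no λ ()
tX ≟ᵀ tX = yes refl

tag : ∀ {y z x} → Blocks y z x → Tag
tag (inj₁ _)        = tY
tag (inj₂ (inj₁ _)) = tZ
tag (inj₂ (inj₂ _)) = tX

tag-count : ∀ {n} → Tag → (Fin n → Tag) → ℕ
tag-count t c = ∑ λ v → ind (c v ≟ᵀ t)

module _ {n : ℕ} where

  TaggedBijection : ℕ → ℕ → ℕ → (Fin n → Tag) → Set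
  TaggedBijection y z x c = Σ (Fin n ↔ Blocks y z x) λ f → ∀ v → tag (Inverse.to f v) ≡ c v

insert : ∀ t {y z x} →
  (Fin 1 ⊎ Blocks y z x) ↔ Blocks (ind (t ≟ᵀ tY) + y) (ind (t ≟ᵀ tZ) + z) (ind (t ≟ᵀ tX) + x)
insert tY = mk↔ₛ′
  (λ { (inj₁ zero) → inj₁ zero ; (inj₂ (inj₁ i)) → inj₁ (suc i) ; (inj₂ (inj₂ r)) → inj₂ r })
  (λ { (inj₁ zero) → inj₁ zero ; (inj₁ (suc i)) → inj₂ (inj₁ i) ; (inj₂ r) → inj₂ (inj₂ r) })
  (λ { (inj₁ zero) → refl ; (inj₁ (suc i)) → refl ; (inj₂ r) → refl })
  (λ { (inj₁ zero) → refl ; (inj₂ (inj₁ i)) → refl ; (inj₂ (inj₂ r)) → refl })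
insert tZ = mk↔ₛ′
  (λ { (inj₁ zero) → inj₂ (inj₁ zero) ; (inj₂ (inj₁ i)) → inj₁ i
     ; (inj₂ (inj₂ (inj₁ i))) → inj₂ (inj₁ (suc i)) ; (inj₂ (inj₂ (inj₂ i))) → inj₂ (inj₂ i) })
  (λ { (inj₁ i) → inj₂ (inj₁ i) ; (inj₂ (inj₁ zero)) → inj₁ zero
     ; (inj₂ (inj₁ (suc i))) → inj₂ (inj₂ (inj₁ i)) ; (inj₂ (inj₂ i)) → inj₂ (inj₂ (inj₂ i)) })
  (λ { (inj₁ i) → refl ; (inj₂ (inj₁ zero)) → refl ; (inj₂ (inj₁ (suc i))) → refl ; (inj₂ (inj₂ i)) → refl })
  (λ { (inj₁ zero) → refl ; (inj₂ (inj₁ i)) → refl ; (inj₂ (inj₂ (inj₁ i))) → refl ; (inj₂ (inj₂ (inj₂ i))) → refl })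
insert tX = mk↔ₛ′
  (λ { (inj₁ zero) → inj₂ (inj₂ zero) ; (inj₂ (inj₁ i)) → inj₁ i
     ; (inj₂ (inj₂ (inj₁ i))) → inj₂ (inj₁ i) ; (inj₂ (inj₂ (inj₂ i))) → inj₂ (inj₂ (suc i)) })
  (λ { (inj₁ i) → inj₂ (inj₁ i) ; (inj₂ (inj₁ i)) → inj₂ (inj₂ (inj₁ i))
     ; (inj₂ (inj₂ zero)) → inj₁ zero ; (inj₂ (inj₂ (suc i))) → inj₂ (inj₂ (inj₂ i)) })
  (λ { (inj₁ i) → refl ; (inj₂ (inj₁ i)) → refl ; (inj₂ (inj₂ zero)) → refl ; (inj₂ (inj₂ (suc i))) → refl })
  (λ { (inj₁ zero) → refl ; (inj₂ (inj₁ i)) → refl ; (inj₂ (inj₂ (inj₁ i))) → refl ; (inj₂ (inj₂ (inj₂ i))) → refl })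

tag-insert-new : ∀ t {y z x} → tag (Inverse.to (insert t {y} {z} {x}) (inj₁ zero)) ≡ t
tag-insert-new tY = refl
tag-insert-new tZ = refl
tag-insert-new tX = refl

tag-insert-old : ∀ t {y z x} (b : Blocks y z x) → tag (Inverse.to (insert t) (inj₂ b)) ≡ tag b
tag-insert-old tY (inj₁ i)        = refl
tag-insert-old tY (inj₂ (inj₁ i)) = refl
tag-insert-old tY (inj₂ (inj₂ i)) = refl
tag-insert-old tZ (inj₁ i)        = refl
tag-insert-old tZ (inj₂ (inj₁ i)) = refl
tag-insert-old tZ (inj₂ (inj₂ i)) = refl
tag-insert-old tX (inj₁ i)        = refl
tag-insert-old tX (inj₂ (inj₁ i)) = refl
tag-insert-old tX (inj₂ (inj₂ i)) = refl

-- Each vertex in turn becomes the new first element of the block named by its tag, so block sizes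
-- and tags agree by construction.
taggedBijection : ∀ {n} (c : Fin n → Tag) → TaggedBijection (tag-count tY c) (tag-count tZ c) (tag-count tX c) c
taggedBijection {zero}  c = mk↔ₛ′ (λ ()) (λ { (inj₁ ()) ; (inj₂ (inj₁ ())) ; (inj₂ (inj₂ ())) })
  (λ { (inj₁ ()) ; (inj₂ (inj₁ ())) ; (inj₂ (inj₂ ())) }) (λ ()) , λ ()
taggedBijection {suc n} c with taggedBijection (c ∘ suc)
... | f , tags = insert (c zero) ↔-∘ ((↔-id _ ⊎-↔ f) ↔-∘ Fin.+↔⊎ {1} {n}) , λ where
  zero    → tag-insert-new (c zero)
  (suc v) → trans (tag-insert-old (c zero) (Inverse.to f v)) (tags v)

module _ {n : ℕ} {G : Graph (Fin n)} {P : Set} {s y : ℕ} (S : Structure G P s y) where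

  open Structure S

  private
    Z? : ∀ v → Dec (¬ X v × ¬ Y v)
    Z? v = ¬? (X? v) ×-dec ¬? (Y? v)

  tagOf : ∀ {v} → Dec (X v) → Dec (Y v) → Tag
  tagOf (yes _) _       = tX
  tagOf (no _)  (yes _) = tY
  tagOf (no _)  (no _)  = tZ

  class : Fin n → Tag
  class v = tagOf (X? v) (Y? v)

  ∣Z∣ : ℕ
  ∣Z∣ = ∑ λ v → ind (Z? v)

  class-X : ∀ v → class v ≡ tX → X v
  class-X v eq with X? v | Y? v
  ... | yes Xv | _ = Xv
  class-X v () | no _ | yes _
  class-X v () | no _ | no _

  class-Y : ∀ v → class v ≡ tY → Y v
  class-Y v eq with X? v | Y? v
  ... | no _ | yes Yv = Yv
  class-Y v () | yes _ | _
  class-Y v () | no _ | no _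

  class-Z : ∀ v → class v ≡ tZ → ¬ X v × ¬ Y v
  class-Z v eq with X? v | Y? v
  ... | no ¬Xv | no ¬Yv = ¬Xv , ¬Yv
  class-Z v () | yes _ | _
  class-Z v () | no _ | yes _

  bijection : TaggedBijection y ∣Z∣ s class
  bijection = resize (trans (sum-cong-≗ count-Y) ∣Y∣) (sum-cong-≗ count-Z) (trans (sum-cong-≗ count-X) ∣X∣)
    (taggedBijection class)
    where
    resize : ∀ {a b c a′ b′ c′} → a ≡ a′ → b ≡ b′ → c ≡ c′ → TaggedBijection a b c class → TaggedBijection a′ b′ c′ class
    resize refl refl refl f = f
    count-X : ∀ v → ind (class v ≟ᵀ tX) ≡ ind (X? v)
    count-X v with X? v | Y? v
    ... | yes _ | _     = refl
    ... | no _  | yes _ = refl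
    ... | no _  | no _  = refl
    count-Y : ∀ v → ind (class v ≟ᵀ tY) ≡ ind (Y? v)
    count-Y v with X? v | Y? v
    ... | yes Xv | yes Yv = contradiction Xv (Y∩X Yv)
    ... | yes _  | no _   = refl
    ... | no _   | yes _  = refl
    ... | no _   | no _   = refl
    count-Z : ∀ v → ind (class v ≟ᵀ tZ) ≡ ind (Z? v)
    count-Z v with X? v | Y? v
    ... | yes _ | yes _ = refl
    ... | yes _ | no _  = refl
    ... | no _  | yes _ = refl
    ... | no _  | no _  = refl

  -- The order `a < b` selects one orientation, so that the list counts every missing edge once.
  Deleted : Edge n → Set
  Deleted (a , b) = a Fin.< b × (¬ X a × ¬ X b) × ¬ Adj G a b

  deleted? : ∀ e → Dec (Deleted e)
  deleted? (a , b) = (a Fin.<? b) ×-dec ((¬? (X? a) ×-dec ¬? (X? b)) ×-dec ¬? (adj? G a b))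

  deletedEdges : List (Edge n)
  deletedEdges = filter deleted? (cartesianProduct (allFin n) (allFin n))

  ∈-deleted⁺ : ∀ {e} → Deleted e → e ∈ deletedEdges
  ∈-deleted⁺ {a , b} d = ∈.∈-filter⁺ deleted? (∈.∈-cartesianProduct⁺ (∈.∈-allFin a) (∈.∈-allFin b)) d

  ∈-deleted⁻ : ∀ {e} → e ∈ deletedEdges → Deleted e
  ∈-deleted⁻ e∈ = proj₂ (∈.∈-filter⁻ deleted? {xs = cartesianProduct (allFin n) (allFin n)} e∈)

  deleted-different : ∀ {es} → All Deleted es → Unique es → AllPairs Different es
  deleted-different []       []       = []
  deleted-different (d ∷ ds) (u ∷ us) =
    All.zipWith (λ {f} (p , q) → p , flipped d q) (u , ds) ∷ deleted-different ds us
    where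
    flipped : ∀ {a b c e} → Deleted (a , b) → Deleted (c , e) → (a , b) ≢ (e , c)
    flipped (a<b , _) (c<e , _) refl = Fin.<-asym a<b c<e

  -- Only the first `m + 1` deleted edges enter the test vector, which keeps the threshold
  -- independent of `n`. Further missing edges only make the rows smaller.
  few-deleted : ∀ {N m} → n ≡ s + N → threshold s y (suc m) ≤ N → s * y + 1 ≤ 4 * suc m →
    ∀ q → IsEigenvalue (signlessLaplacian G) q → fromℕ (2 * (N ∸ 1)) ≤ᴿ q → length deletedEdges ≤ m
  few-deleted {N} {m} n≡ large many q eigen T≤q = ℕ.≮⇒≥ λ lt → absurd
      (trans (List.length-take (suc m) deletedEdges) (ℕ.m≤n⇒m⊓n≡m lt))
    where
    es = take (suc m) deletedEdges
    all : All Deleted es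
    all = All.take⁺ (suc m) (All.tabulate ∈-deleted⁻)
    uniq : Unique es
    uniq = Unique.take⁺ (suc m) (Unique.filter⁺ deleted?
      (Unique.cartesianProduct⁺ (Unique.allFin⁺ n) (Unique.allFin⁺ n)))
    absurd : length es ≡ suc m → ⊥
    absurd len = too-many-missing G S es (All.map (λ (a<b , ¬X , a≁b) → (Fin.<⇒≢ a<b , a≁b) , ¬X) all)
      (deleted-different all uniq) (subst (λ z → s * y + 1 ≤ 4 * z) (sym len) many)
      n≡ (subst (λ z → threshold s y z ≤ N) (sym len) large) q eigen T≤q

  module _ (J : Graph (Fin s)) (P⇒J : ∀ {i j} → i ≢ j → P → Adj J i j) (J⇒P : ∀ {i j} → Adj J i j → P) where

    private
      H : Graph (Blocks y ∣Z∣ s)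
      H = K y ∨ (K ∣Z∣ ∪ J)
      open Inverse (proj₁ bijection) using (to; from; strictlyInverseʳ)
      tagged : ∀ v → tag (to v) ≡ class v
      tagged = proj₂ bijection
      both : Edge n → Blocks y ∣Z∣ s × Blocks y ∣Z∣ s
      both (a , b) = to a , to b

    to-injective : ∀ {u v} → to u ≡ to v → u ≡ v
    to-injective {u} {v} eq = trans (sym (strictlyInverseʳ u)) (trans (cong from eq) (strictlyInverseʳ v))

    X⇒ : ∀ {v i} → to v ≡ inj₂ (inj₂ i) → X v
    X⇒ {v} eq = class-X v (trans (sym (tagged v)) (cong tag eq))

    Y⇒ : ∀ {v i} → to v ≡ inj₁ i → Y v
    Y⇒ {v} eq = class-Y v (trans (sym (tagged v)) (cong tag eq))

    Z⇒ : ∀ {v i} → to v ≡ inj₂ (inj₁ i) → ¬ X v × ¬ Y v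
    Z⇒ {v} eq = class-Z v (trans (sym (tagged v)) (cong tag eq))

    data Low-or-high (v : Fin n) : Set where
      low  : ∀ i → to v ≡ inj₂ (inj₂ i) → Low-or-high v
      high : ¬ X v → InY∪Z (to v) → Low-or-high v

    low-or-high : ∀ v → Low-or-high v
    low-or-high v = go (to v) refl
      where
      go : ∀ b → to v ≡ b → Low-or-high v
      go (inj₁ i)        eq = high (Y∩X (Y⇒ eq)) (subst InY∪Z (sym eq) (inY i))
      go (inj₂ (inj₁ i)) eq = high (proj₁ (Z⇒ eq)) (subst InY∪Z (sym eq) (inZ i))
      go (inj₂ (inj₂ i)) eq = low i eq

    high-adjacent : ∀ {a b} → InY∪Z a → InY∪Z b → a ≢ b → Adj H a b
    high-adjacent (inY i) (inY j) a≢b = λ i≡j → a≢b (cong inj₁ i≡j)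
    high-adjacent (inY i) (inZ j) a≢b = _
    high-adjacent (inZ i) (inY j) a≢b = _
    high-adjacent (inZ i) (inZ j) a≢b = λ i≡j → a≢b (cong (inj₂ ∘ inj₁) i≡j)

    -- Nothing is deleted at `X`, so on such pairs `G` already agrees with `H`.
    low-adjacent : ∀ {u i} → to u ≡ inj₂ (inj₂ i) → ∀ v → (Adj G u v → Adj H (to u) (to v)) × (Adj H (to u) (to v) → Adj G u v)
    low-adjacent {u} {i} eq v rewrite eq = go (to v) refl
      where
      go : ∀ b → to v ≡ b → (Adj G u v → Adj H (inj₂ (inj₂ i)) b) × (Adj H (inj₂ (inj₂ i)) b → Adj G u v)
      go (inj₁ j)        eq′ = (λ _ → _) , λ _ → X-Y (X⇒ eq) (Y⇒ eq′)
      go (inj₂ (inj₁ j)) eq′ = (λ u~v → contradiction u~v (X-Z (X⇒ eq) (proj₁ (Z⇒ eq′)) (proj₂ (Z⇒ eq′)))) , λ ()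
      go (inj₂ (inj₂ j)) eq′ =
          (λ u~v → P⇒J (λ { refl → adj-irrefl G (subst (λ z → Adj G u z) (to-injective (trans eq′ (sym eq))) u~v) })
                     (proj₂ (X-X (X⇒ eq) (X⇒ eq′) λ { refl → adj-irrefl G u~v }) u~v))
        , λ i~j → proj₁ (X-X (X⇒ eq) (X⇒ eq′) λ { refl → adj-irrefl J (subst (λ k → Adj J k j)
                    (inj-X (trans (sym eq) eq′)) i~j) }) (J⇒P i~j)
        where
        inj-X : ∀ {i j : Fin s} → _≡_ {A = Blocks y ∣Z∣ s} (inj₂ (inj₂ i)) (inj₂ (inj₂ j)) → i ≡ j
        inj-X refl = refl

    deletions : ∀ {m} → length deletedEdges ≤ m → G ∈Deletions[ H , m ]
    deletions {m} len = map both deletedEdges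
      , All.map⁺ (All.tabulate λ {e} e∈ → in-E₁ e (∈-deleted⁻ e∈))
      , subst (λ z → z ≤ m) (sym (List.length-map both deletedEdges)) len
      , proj₁ bijection , λ u v → mk⇔ (forward u v) (backward u v)
      where
      in-E₁ : ∀ e → Deleted e → E₁ H (both e)
      in-E₁ (a , b) (a<b , (¬Xa , ¬Xb) , _) with low-or-high a | low-or-high b
      ... | high _ ha | high _ hb = high-adjacent ha hb (Fin.<⇒≢ a<b ∘ to-injective) , ha , hb
      ... | low _ eq  | _         = contradiction (X⇒ eq) ¬Xa
      ... | high _ _  | low _ eq  = contradiction (X⇒ eq) ¬Xb
      was-deleted : ∀ {u v} → (to u , to v) ∈ map both deletedEdges → Deleted (u , v)
      was-deleted {u} {v} i with ∈.∈-map⁻ both i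
      ... | (a , b) , e∈ , eq = subst₂ (λ p q → Deleted (p , q)) (sym (to-injective (cong proj₁ eq)))
              (sym (to-injective (cong proj₂ eq))) (∈-deleted⁻ e∈)
      forward : ∀ u v → Adj G u v → Adj (deleteEdges _≟ᴮ_ H (map both deletedEdges)) (to u) (to v)
      forward u v u~v = in-H (low-or-high u) (low-or-high v) , λ where
          (inj₁ i) → proj₂ (proj₂ (was-deleted i)) u~v
          (inj₂ i) → proj₂ (proj₂ (was-deleted i)) (adj-sym G u~v)
        where
        in-H : Low-or-high u → Low-or-high v → Adj H (to u) (to v)
        in-H (low _ eq)  _           = proj₁ (low-adjacent eq v) u~v
        in-H (high _ _)  (low _ eq)  = adj-sym H {to v} {to u} (proj₁ (low-adjacent eq u) (adj-sym G u~v))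
        in-H (high _ hu) (high _ hv) = high-adjacent hu hv λ eq → adj-irrefl G (subst (λ w → Adj G u w) (sym (to-injective eq)) u~v)
      backward : ∀ u v → Adj (deleteEdges _≟ᴮ_ H (map both deletedEdges)) (to u) (to v) → Adj G u v
      backward u v (h , kept) = in-G (low-or-high u) (low-or-high v)
        where
        in-G : Low-or-high u → Low-or-high v → Adj G u v
        in-G (low _ eq)   _            = proj₂ (low-adjacent eq v) h
        in-G (high _ _)   (low _ eq)   = adj-sym G (proj₂ (low-adjacent eq u) (adj-sym H {to u} {to v} h))
        in-G (high ¬Xu _) (high ¬Xv _) = by-adj (adj? G u v)
          where
          by-adj : Dec (Adj G u v) → Adj G u v
          by-adj (yes u~v) = u~v
          by-adj (no u≁v) with Fin.<-cmp u v
          ... | tri< u<v _ _ = contradiction (inj₁ (∈.∈-map⁺ both (∈-deleted⁺ (u<v , (¬Xu , ¬Xv) , u≁v)))) kept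
          ... | tri> _ _ v<u = contradiction (inj₂ (∈.∈-map⁺ both (∈-deleted⁺ (v<u , (¬Xv , ¬Xu) , u≁v ∘ adj-sym G)))) kept
          ... | tri≈ _ refl _ = contradiction h (adj-irrefl H {to u})

-- From the closure back to the given graph

-- Vertices of `X` have in `G′` only the degree that `G` guarantees, so the closure added no edge at
-- `X`.
structure-subgraph : ∀ {n P s y d} {G G′ : Graph (Fin n)} (S : Structure G′ P s y) → (∀ {u v} → Adj G u v → Adj G′ u v) →
  MinDegreeAtLeast d G → (∀ {x} → Structure.X S x → degree G′ x ≡ d) → Structure G P s y
structure-subgraph {G = G} {G′} S sub δ≤ degree-X = record
  { X = X ; Y = Y ; X? = X? ; Y? = Y? ; Y∩X = Y∩X ; ∣X∣ = ∣X∣ ; ∣Y∣ = ∣Y∣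
  ; X-Y = λ Xu Yv → back Xu (X-Y Xu Yv)
  ; X-Z = λ Xu ¬Xv ¬Yv u~v → X-Z Xu ¬Xv ¬Yv (sub u~v)
  ; X-X = λ Xu Xv u≢v → (λ p → back Xu (proj₁ (X-X Xu Xv u≢v) p)) , λ u~v → proj₂ (X-X Xu Xv u≢v) (sub u~v)
  }
  where
  open Structure S
  back : ∀ {u v} → X u → Adj G′ u v → Adj G u v
  back {u} {v} Xu u~v = 0<ind (adj? G u v) (ℕ.≤-reflexive (sym (trans
    (∑-mono-≡ (λ w → ind-mono (adj? G u w) (adj? G′ u w) sub)
      (subst₂ _≤_ (trans (sym (degree-X Xu)) (degree-∑ G′ u)) (degree-∑ G u) (δ≤ u)) v)
    (ind-yes (adj? G′ u v) u~v))))

codegree-antitone : ∀ {n} {G G′ : Graph (Fin n)} → (∀ {u v} → Adj G u v → Adj G′ u v) → ∀ v → codegree G′ v ≤ codegree G v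
codegree-antitone {G = G} {G′} sub v = ∑-mono λ w → ind-mono (nonAdj? G′ v w) (nonAdj? G v w) λ (v≢w , v≁w) → v≢w , v≁w ∘ sub

-- One edge beyond the rounded-down quarter suffices for the strict inequality `many`.
m<4*suc[m/4] : ∀ m → m + 1 ≤ 4 * suc (m ℕ./ 4)
m<4*suc[m/4] m = begin
  m + 1 ≡⟨ cong (λ z → z + 1) (ℕ.m≡m%n+[m/n]*n m 4) ⟩
  m ℕ.% 4 + m ℕ./ 4 * 4 + 1 ≡⟨ arith (m ℕ.% 4) (m ℕ./ 4) ⟩
  suc (m ℕ.% 4) + 4 * (m ℕ./ 4) ≤⟨ ℕ.+-monoˡ-≤ (4 * (m ℕ./ 4)) (ℕ.m%n<n m 4) ⟩
  4 + 4 * (m ℕ./ 4) ≡⟨ ℕ.*-suc 4 (m ℕ./ 4) ⟨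
  4 * suc (m ℕ./ 4) ∎
  where
  open ℕ.≤-Reasoning
  arith : ∀ a b → a + b * 4 + 1 ≡ suc a + 4 * b
  arith = solve-∀

bound-ℤ : ∀ {n k δ s N} → δ ≡ s + k → n ≡ s + 1 + N →
  + 2 ℤ.* (+ n ℤ.- + δ ℤ.+ + k ℤ.- + 1) ≡ + (2 * N)
bound-ℤ {k = k} {s = s} {N} refl refl = begin
  + 2 ℤ.* (+ (s + 1 + N) ℤ.- + (s + k) ℤ.+ + k ℤ.- + 1)
    ≡⟨ cong₂ (λ a b → + 2 ℤ.* (a ℤ.- b ℤ.+ + k ℤ.- + 1))
         (trans (ℤ.pos-+ (s + 1) N) (cong (ℤ._+ + N) (ℤ.pos-+ s 1))) (ℤ.pos-+ s k) ⟩
  + 2 ℤ.* ((+ s ℤ.+ + 1 ℤ.+ + N) ℤ.- (+ s ℤ.+ + k) ℤ.+ + k ℤ.- + 1)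
    ≡⟨ arith (+ s) (+ k) (+ N) ⟩
  + 2 ℤ.* + N
    ≡⟨ ℤ.pos-* 2 N ⟨
  + (2 * N) ∎
  where
  open ≡-Reasoning
  arith : ∀ s k N → + 2 ℤ.* ((s ℤ.+ + 1 ℤ.+ N) ℤ.- (s ℤ.+ k) ℤ.+ k ℤ.- + 1) ≡ + 2 ℤ.* N
  arith = ℤ.solve-∀

theorem2p3 : (k δ : ℕ) → k + 2 ≤ δ →
    ∃ λ n₀ → (n : ℕ) → n₀ ≤ n →
    (G : Graph (Fin n)) → MinDegreeAtLeast δ G →
    (q : ℝ) → IsSignlessLaplacianRadius G q →
    fromℤ (+ 2 ℤ.* (+ n ℤ.- + δ ℤ.+ + k ℤ.- + 1)) ≤ᴿ q →
    EdgeHamiltonian k G ⊎ G ∈ℋ¹[ k , δ ] ⊎ G ∈ℒ¹[ k , δ ]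
theorem2p3 k δ k+2≤δ = k + 1 + (m₀ + (s + 1) + (tᴴ + tᴸ) + 3) , result
  where
  s hᴴ hᴸ tᴴ tᴸ m₀ : ℕ
  s  = δ ∸ k
  hᴴ = (δ * s) ℕ./ 4
  hᴸ = ((k + 1) * s) ℕ./ 4
  tᴴ = threshold s δ (suc hᴴ)
  tᴸ = threshold s (k + 1) (suc hᴸ)
  -- One summand for each of `h₁`, `h₂` and `h₃`.
  m₀ = suc (4 * s * (k + 1) + 8 * s + (s * (k + 1) + 24 * s * s))
  δ≡ : δ ≡ s + k
  δ≡ = sym (ℕ.m∸n+n≡m (ℕ.≤-trans (ℕ.m≤m+n k 2) k+2≤δ))

  result : (n : ℕ) → k + 1 + (m₀ + (s + 1) + (tᴴ + tᴸ) + 3) ≤ n →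
    (G : Graph (Fin n)) → MinDegreeAtLeast δ G → (q : ℝ) → IsSignlessLaplacianRadius G q →
    fromℤ (+ 2 ℤ.* (+ n ℤ.- + δ ℤ.+ + k ℤ.- + 1)) ≤ᴿ q →
    EdgeHamiltonian k G ⊎ G ∈ℋ¹[ k , δ ] ⊎ G ∈ℒ¹[ k , δ ]
  result n n₀≤n G δ≤ q (eigen , _) T≤q = classify (closure k G)
    where
    m N : ℕ
    m = n ∸ (k + 1)
    -- Since n - δ + k - 1 = n - s - 1, the hypothesis on `q` has the bound `2 * N`. The test vector
    -- is applied with `suc N`, the number n - s of vertices outside `X`.
    N = n ∸ (s + 1)
    large : m₀ + (s + 1) + (tᴴ + tᴸ) + 3 ≤ m
    large = ℕ.≤-trans (ℕ.≤-reflexive (sym (ℕ.m+n∸m≡n (k + 1) _))) (ℕ.∸-monoˡ-≤ (k + 1) n₀≤n)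
    part : ∀ {a} b → a + b ≡ m₀ + (s + 1) + (tᴴ + tᴸ) + 3 → a ≤ m
    part {a} b eq = ℕ.≤-trans (ℕ.≤-trans (ℕ.m≤m+n a b) (ℕ.≤-reflexive eq)) large
    m≤n : m ≤ n
    m≤n = ℕ.m∸n≤m n (k + 1)
    n≡m : n ≡ k + 1 + m
    n≡m = sym (ℕ.m+[n∸m]≡n (ℕ.≤-trans (ℕ.m≤m+n (k + 1) _) n₀≤n))
    s+1+t≤m : (s + 1) + (tᴴ + tᴸ) ≤ m
    s+1+t≤m = part (m₀ + 3) (arith (s + 1) (tᴴ + tᴸ) m₀)
      where
      arith : ∀ a b c → a + b + (c + 3) ≡ c + a + b + 3
      arith = solve-∀
    n≡N : n ≡ s + 1 + N
    n≡N = sym (ℕ.m+[n∸m]≡n (ℕ.≤-trans (ℕ.≤-trans (ℕ.m≤m+n (s + 1) _) s+1+t≤m) m≤n))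
    n≡sucN : n ≡ s + suc N
    n≡sucN = trans n≡N (ℕ.+-assoc s 1 N)
    t≤sucN : tᴴ + tᴸ ≤ suc N
    t≤sucN = ℕ.m≤n⇒m≤1+n (ℕ.≤-trans (ℕ.≤-reflexive (sym (ℕ.m+n∸m≡n (s + 1) _)))
      (ℕ.∸-monoˡ-≤ (s + 1) (ℕ.≤-trans s+1+t≤m m≤n)))
    m₀≤m : m₀ ≤ m
    m₀≤m = part (s + 1 + (tᴴ + tᴸ) + 3) (arith m₀ (s + 1) (tᴴ + tᴸ))
      where
      arith : ∀ a b c → a + (b + c + 3) ≡ a + b + c + 3
      arith = solve-∀
    h₁ : 4 * s * (k + 1) < m
    h₁ = ℕ.≤-trans (s≤s (ℕ.≤-trans (ℕ.m≤m+n _ (8 * s)) (ℕ.m≤m+n _ _))) m₀≤m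
    h₂ : 8 * s < m
    h₂ = ℕ.≤-trans (s≤s (ℕ.≤-trans (ℕ.m≤n+m (8 * s) (4 * s * (k + 1))) (ℕ.m≤m+n _ _))) m₀≤m
    h₃ : s * (k + 1) + 24 * s * s < m
    h₃ = ℕ.≤-trans (s≤s (ℕ.m≤n+m _ (4 * s * (k + 1) + 8 * s))) m₀≤m
    3≤n : 3 ≤ n
    3≤n = ℕ.≤-trans (ℕ.≤-trans (ℕ.m≤n+m 3 (m₀ + (s + 1) + (tᴴ + tᴸ))) large) m≤n
    T≤q′ : fromℕ (2 * N) ≤ᴿ q
    T≤q′ = subst (λ z → fromℤ z ≤ᴿ q) (bound-ℤ δ≡ n≡N) T≤q
    δ≤′ : MinDegreeAtLeast (k + s) G
    δ≤′ v = ℕ.≤-trans (ℕ.≤-reflexive (trans (ℕ.+-comm k s) (sym δ≡))) (δ≤ v)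
    1≤degree : ∀ v → 1 ≤ degree G v
    1≤degree v = ℕ.≤-trans (ℕ.≤-trans (s≤s z≤n) (ℕ.≤-trans (ℕ.m≤n+m 2 k) k+2≤δ)) (δ≤ v)
    few-missing : ∑ (codegree G) ≤ 2 * s * n
    few-missing = by-row (Fin.any? λ v → 2 * N * degree G v ℕ.≤? ∑ (λ w → adj G v w * (degree G v + degree G w)))
      where
      by-row : Dec (∃ λ v → 2 * N * degree G v ≤ ∑ (λ w → adj G v w * (degree G v + degree G w))) →
        ∑ (codegree G) ≤ 2 * s * n
      by-row (yes (v , row)) = sparse {s = s} {N} G n≡N v (1≤degree v) row
      by-row (no none)       = contradiction T≤q′ (collatz-wielandt G (degree G) (2 * N)
        (λ v → ℕ.≰⇒> λ row → none (v , row)) q eigen)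

    into : ∀ {P y b z′} (S : Structure G P s y) (J : Graph (Fin s)) →
      (∀ {i j} → i ≢ j → P → Adj J i j) → (∀ {i j} → Adj J i j → P) →
      threshold s y (suc b) ≤ suc N → s * y + 1 ≤ 4 * suc b → ∣Z∣ S ≡ z′ →
      G ∈Deletions[ K y ∨ (K z′ ∪ J) , b ]
    into S J P⇒J J⇒P large many refl =
      deletions S J P⇒J J⇒P (few-deleted S n≡sucN large many q eigen T≤q′)

    sizes : ∀ {P y} (S : Structure G P s y) → n ≡ s + y + ∣Z∣ S
    sizes S = trans (partition-∑ X? Y? Y∩X) (cong₂ (λ a b → a + b + ∣Z∣ S) ∣X∣ ∣Y∣)
      where open Structure S

    ∣Z∣ᴴ : ∀ {P} (S : Structure G P s δ) → ∣Z∣ S ≡ (n + k) ∸ 2 * δ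
    ∣Z∣ᴴ S = sym (trans (cong (_∸ 2 * δ) (trans (cong (λ z → z + k) (sizes S))
      (trans (arith s δ (∣Z∣ S) k) (cong (λ z → z + δ + ∣Z∣ S) (sym δ≡))))) (trans
      (cong (λ z → δ + δ + ∣Z∣ S ∸ (δ + z)) (ℕ.+-identityʳ δ)) (ℕ.m+n∸m≡n (δ + δ) (∣Z∣ S))))
      where
      arith : ∀ s d z k → s + d + z + k ≡ (s + k) + d + z
      arith = solve-∀

    ∣Z∣ᴸ : ∀ {P} (S : Structure G P s (k + 1)) → ∣Z∣ S ≡ n ∸ (δ + 1)
    ∣Z∣ᴸ S = sym (trans (cong (_∸ (δ + 1)) (trans (sizes S) (cong (λ z → z + ∣Z∣ S)
      (trans (sym (ℕ.+-assoc s k 1)) (cong (λ z → z + 1) (sym δ≡)))))) (ℕ.m+n∸m≡n (δ + 1) (∣Z∣ S)))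

    k+s≡δ : k + s ≡ δ
    k+s≡δ = trans (ℕ.+-comm k s) (sym δ≡)

    in-families : ∀ {P y} → Structure G P s y → (P ≡ ⊥ × y ≡ k + s) ⊎ (P ≡ ⊤ × y ≡ k + 1) → G ∈ℋ¹[ k , δ ] ⊎ G ∈ℒ¹[ k , δ ]
    in-families {P} S (inj₁ (refl , y≡)) = inj₁ (into S′ (I s) (λ _ ()) (λ ())
        (ℕ.≤-trans (ℕ.m≤m+n tᴴ tᴸ) t≤sucN)
        (subst (λ z → z + 1 ≤ 4 * suc hᴴ) (ℕ.*-comm δ s) (m<4*suc[m/4] (δ * s))) (∣Z∣ᴴ S′))
      where
      S′ : Structure G P s δ
      S′ = subst (Structure G P s) (trans y≡ k+s≡δ) S
    in-families {P} S (inj₂ (refl , refl)) = inj₂ (into S (K s) (λ i≢j _ → i≢j) (λ _ → _)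
        (ℕ.≤-trans (ℕ.m≤n+m tᴸ tᴴ) t≤sucN)
        (subst (λ z → z + 1 ≤ 4 * suc hᴸ) (ℕ.*-comm (k + 1) s) (m<4*suc[m/4] ((k + 1) * s))) (∣Z∣ᴸ S))

    classify : (∃ λ (G′ : Graph (Fin n)) → (∀ {u v} → Adj G u v → Adj G′ u v) ×
      (EdgeHamiltonian k G′ → EdgeHamiltonian k G) × Closed k G′) →
      EdgeHamiltonian k G ⊎ G ∈ℋ¹[ k , δ ] ⊎ G ∈ℒ¹[ k , δ ]
    classify (G′ , sub , back , closed) = by-structure (closed-structure n≡m h₁ h₂ h₃ 3≤n G′ closed δ≤″
      (ℕ.≤-trans (∑-mono (codegree-antitone {G = G} {G′} sub)) few-missing))
      where
      δ≤″ : MinDegreeAtLeast (k + s) G′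
      δ≤″ v = ℕ.≤-trans (δ≤′ v) (subst₂ _≤_ (sym (degree-∑ G v)) (sym (degree-∑ G′ v))
        (∑-mono λ w → ind-mono (adj? G v w) (adj? G′ v w) sub))
      by-structure : (EdgeHamiltonian k G′ ⊎
        ∃₂ λ (P : Set) y → Σ (Structure G′ P s y) λ S →
          (∀ {x} → Structure.X S x → degree G′ x ≡ k + s) × ((P ≡ ⊥ × y ≡ k + s) ⊎ (P ≡ ⊤ × y ≡ k + 1))) →
        EdgeHamiltonian k G ⊎ G ∈ℋ¹[ k , δ ] ⊎ G ∈ℒ¹[ k , δ ]
      by-structure (inj₁ eh) = inj₁ (back eh)
      by-structure (inj₂ (P , y , S , degree-X , which)) =
        inj₂ (in-families (structure-subgraph {G = G} {G′} S sub δ≤′ degree-X) which)
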